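{- Let $k\ge 3$ and $n>2k$ be integers, let $X$ be a set with $|X|=n$, and let $\mathcal{H}\subseteq\binom{X}{k}$ be an intersecting family. Assume that $\mathcal{H}\nsubseteq_S \mathcal{F}_0$, that $\mathcal{H}\nsubseteq_S \mathcal{F}_1$, and, if $k=3$, that $\mathcal{H}\nsubseteq_S \mathcal{G}_2$. Then \[ |\mathcal{H}|\le \binom{n-1}{k-1}-\binom{n-k-1}{k-1}-\binom{n-k-2}{k-2}+2 . \] Moreover, for $k=4$ equality holds if and only if $\mathcal{H}$ is isomorphic to $\mathcal{J}_2$, $\mathcal{G}_2$ or $\mathcal{G}_3$; for every other $k\ge 3$, equality holds if and only if $\mathcal{H}$ is isomorphic to $\mathcal{J}_2$.
   Context: A family $\mathcal{F}$ of sets is intersecting if $F_1\cap F_2\neq\emptyset$ for all $F_1,F_2\in\mathcal{F}$; $\binom{X}{k}$ denotes the set of all $k$-element subsets of $X$. For families $\mathcal{H}\subseteq 2^X$, $\mathcal{G}\subseteq 2^Y$, write $\mathcal{H}\subseteq_S\mathcal{G}$ if there is an injective map $f:X\to Y$ with $f(E)\in\mathcal{G}$ for all $E\in\mathcal{H}$; $\mathcal{H}$ and $\mathcal{G}$ are isomorphic if $\mathcal{H}\subseteq_S\mathcal{G}$ and $\mathcal{G}\subseteq_S\mathcal{H}$. All families below are $k$-uniform families on $X$. $\mathcal{F}_0$: any family isomorphic to $\{F\in\binom{X}{k}: x\in F\}$ for some $x\in X$. $\mathcal{F}_1$: any family isomorphic to $\{F\}\cup\{G\in\binom{X}{k}: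 x\in G,\ G\cap F\neq\emptyset\}$ for some $k$-set $F\subseteq X$ and $x\in X\setminus F$. $\mathcal{G}_i$ ($2\le i\le k$): any family isomorphic to $\mathcal{G}(E,x_0)=\{G\in\binom{X}{k}: E\subseteq G\}\cup\{G\in\binom{X}{k}: x_0\in G,\ G\cap E\neq\emptyset\}$, where $E\subseteq X$ is an $i$-set and $x_0\in X\setminus E$. (So $\mathcal{G}_2$ is isomorphic to $\{F\in\binom{X}{k}:|F\cap S|\ge 2\}$ for a 3-set $S$.) $\mathcal{J}_i$ ($1\le i\le k-1$): any family isomorphic to $\mathcal{J}(E,J,x_0)=\{G\in\binom{X}{k}: E\subseteq G,\ G\cap J\neq\emptyset\}\cup\{G\in\binom{X}{k}: J\subseteq G\}\cup\{G\in\binom{X}{k}: x_0\in G,\ G\cap E\neq\emptyset\}$, where $E\subseteq X$ is a $(k-1)$-set, $J\subseteq X\setminus E$ is an $(i+1)$-set and $x_0\in J$. -}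

module Defs where

open import Data.Fin.Base using (Fin)
open import Data.Fin.Properties using (any?; _≟_)
open import Data.Fin.Subset
  using (Subset; inside; outside; _∈_; _∉_; _⊆_; ∁; _∩_; ∣_∣; Nonempty)
open import Data.Fin.Subset.Properties using (_∈?_)
open import Data.List.Base using (List; []; _∷_; _++_; map; filter; length)
open import Data.Nat.Base using (ℕ; zero; suc; _+_; _∸_)
open import Data.Nat.Combinatorics using (_C_)
import Data.Vec.Base as Vec
open import Data.Product.Base using (Σ-syntax; _×_)
open import Data.Sum.Base using (_⊎_)
open import Function.Definitions using (Injective)
open import Level using (0ℓ)
open import Relation.Binary.PropositionalEquality.Core using (_≡_)
open import Relation.Nullary.Decidable.Core using (does; _×-dec_)
open import Relation.Unary using (Pred; Decidable)

-- The ground set with n elements is Fin n.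

Family : ℕ → Set₁
Family n = Pred (Subset n) 0ℓ

subsets : ∀ n → List (Subset n)
subsets zero    = Vec.[] ∷ []
subsets (suc n) =
  map (outside Vec.∷_) (subsets n) ++ map (inside Vec.∷_) (subsets n)

-- Constructively a family has a cardinality only if membership in it is
-- decidable; `subsets n` lists every subset of Fin n exactly once.
card : ∀ {n} {H : Family n} → Decidable H → ℕ
card {n} H? = length (filter H? (subsets n))

Uniform : ∀ {n} → ℕ → Family n → Set
Uniform k H = ∀ F → H F → ∣ F ∣ ≡ k

Intersecting : ∀ {n} → Family n → Set
Intersecting H = ∀ F₁ F₂ → H F₁ → H F₂ → Nonempty (F₁ ∩ F₂)

image : ∀ {m n} → (Fin m → Fin n) → Subset m → Subset n
image f p = Vec.tabulate λ y → does (any? λ x → (x ∈? p) ×-dec (f x ≟ y))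

infix 4 _⊆ₛ_ _≅_ _⊆ₛ*_ _≅*_

_⊆ₛ_ : ∀ {m n} → Family m → Family n → Set
_⊆ₛ_ {m} {n} H G =
  Σ[ f ∈ (Fin m → Fin n) ] Injective _≡_ _≡_ f × (∀ E → H E → G (image f E))

_≅_ : ∀ {m n} → Family m → Family n → Set
H ≅ G = H ⊆ₛ G × G ⊆ₛ H

star : ∀ {n} → ℕ → Fin n → Family n
star k x G = ∣ G ∣ ≡ k × x ∈ G

hiltonMilner : ∀ {n} → ℕ → Subset n → Fin n → Family n
hiltonMilner k F x G =
  G ≡ F ⊎ (∣ G ∣ ≡ k × x ∈ G × Nonempty (G ∩ F))

familyG : ∀ {n} → ℕ → Subset n → Fin n → Family n
familyG k E x₀ G =
  (∣ G ∣ ≡ k × E ⊆ G) ⊎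
  (∣ G ∣ ≡ k × x₀ ∈ G × Nonempty (G ∩ E))

familyJ : ∀ {n} → ℕ → Subset n → Subset n → Fin n → Family n
familyJ k E J x₀ G =
  (∣ G ∣ ≡ k × E ⊆ G × Nonempty (G ∩ J)) ⊎
  (∣ G ∣ ≡ k × J ⊆ G) ⊎
  (∣ G ∣ ≡ k × x₀ ∈ G × Nonempty (G ∩ E))

-- 𝓕₀, 𝓕₁, 𝓖ᵢ and 𝓙ᵢ each stand for "any family isomorphic to" a
-- model, so each is a class of families on Fin n rather than one family.

FamilyClass : ℕ → Set₁
FamilyClass n = Family n → Set

𝓕₀ : ∀ {n} → ℕ → FamilyClass n
𝓕₀ {n} k H = Σ[ x ∈ Fin n ] H ≅ star k x

𝓕₁ : ∀ {n} → ℕ → FamilyClass n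
𝓕₁ {n} k H =
  Σ[ F ∈ Subset n ] Σ[ x ∈ Fin n ]
    ∣ F ∣ ≡ k × x ∉ F × H ≅ hiltonMilner k F x

-- The intended range of the index is 2 ≤ i ≤ k.
𝓖 : ∀ {n} → ℕ → ℕ → FamilyClass n
𝓖 {n} k i H =
  Σ[ E ∈ Subset n ] Σ[ x₀ ∈ Fin n ]
    ∣ E ∣ ≡ i × x₀ ∉ E × H ≅ familyG k E x₀

-- The intended range of the index is 1 ≤ i ≤ k − 1.
𝓙 : ∀ {n} → ℕ → ℕ → FamilyClass n
𝓙 {n} k i H =
  Σ[ E ∈ Subset n ] Σ[ J ∈ Subset n ] Σ[ x₀ ∈ Fin n ]
    ∣ E ∣ ≡ k ∸ 1 × J ⊆ ∁ E × ∣ J ∣ ≡ i + 1 × x₀ ∈ J ×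
    H ≅ familyJ k E J x₀

_⊆ₛ*_ : ∀ {n} → Family n → FamilyClass n → Set₁
_⊆ₛ*_ {n} H 𝓒 = Σ[ G ∈ Family n ] 𝓒 G × H ⊆ₛ G

_≅*_ : ∀ {n} → Family n → FamilyClass n → Set₁
_≅*_ {n} H 𝓒 = Σ[ G ∈ Family n ] 𝓒 G × H ≅ G

-- For n > 2k and k ≥ 3 no subtraction truncates: by Pascal's rule
-- C(n-k-1,k-1) + C(n-k-2,k-2) ≤ C(n-k,k-1) ≤ C(n-1,k-1).
bound : ℕ → ℕ → ℕ
bound n k =
  (n ∸ 1) C (k ∸ 1) ∸ (n ∸ k ∸ 1) C (k ∸ 1) ∸ (n ∸ k ∸ 2) C (k ∸ 2) + 2

{-# OPTIONS --safe #-}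

-- If some point x is missed by at most two members of H, then H is a star, a subfamily of a
-- Hilton–Milner family, or consists of two k-sets C, D and of k-sets through x that meet both;
-- counting the latter gives the bound, with equality only if |C ∩ D| = k − 1, which is 𝓙₂.
-- If every point is missed by at least three members, then H is strictly smaller than the bound,
-- or it lies in a family 𝓖₂ (k = 3, 4) or 𝓖₃ (k = 4). To see this, shift H between neighbouring
-- points for as long as the hypothesis survives. A completely shifted family is estimated by
-- induction on n, starting from n = 2k, where the bound only says that a set and its complement
-- are not both in H. If shifting j to i would leave i missed by at most two members, then at most
-- two members of H avoid {i, j}, and the members containing exactly one of i, j form a pair of
-- cross-intersecting families, which is estimated by shifting and induction as well.
-- Containment in 𝓖₂ or 𝓖₃ is traced back through a shift by a two-colouring argument: a member
-- that the shift could have produced comes from j or from i, and crossing forces one choice throughout.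

module Submission where

open import Defs
open import Data.Bool.Base using (Bool; true; false; _∧_; _∨_; not; T)
open import Data.Bool.Properties using (∧-distribʳ-∨; ∧-identityʳ; ∧-zeroʳ; ∨-comm)
open import Data.Empty using (⊥; ⊥-elim)
open import Data.Fin.Base using (Fin; zero; suc)
open import Data.Fin.Properties using (any?; _≟_)
open import Data.Fin.Subset using (Subset; ∣_∣; _∪_; _∩_; ∁; ⁅_⁆; _∈_; _∉_; _⊆_; Nonempty)
open import Data.Fin.Subset.Properties using (_∈?_; drop-∷-⊆; x∈∁p⇒x∉p; x∉p⇒x∈∁p; ∪-comm; ∪-idem)
open import Data.List.Base using (List; []; _∷_; map; filter; length)
open import Data.List.Properties using (filter-++; length-++)
open import Data.Nat.Base
open import Data.Nat.Combinatorics using (nCk+nC[k+1]≡[n+1]C[k+1]) renaming (_C_ to _choose_)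
open import Data.Nat.Properties hiding (_≟_)
open import Algebra.Properties.CommutativeSemigroup +-commutativeSemigroup using () renaming (interchange to swap-inner)
open import Data.Product.Base using (Σ-syntax; ∃-syntax; _×_; _,_; proj₁; proj₂)
open import Data.Sum.Base using (_⊎_; inj₁; inj₂; [_,_]′)
open import Data.Unit.Base using (⊤; tt)
open import Data.Vec.Base using (Vec; []; _∷_; here; there; initLast; lookup; replicate; tail; zipWith; _∷ʳ_)
open import Data.Vec.Properties using (lookup∘tabulate; tabulate-cong; tabulate∘lookup; []=⇒lookup; lookup⇒[]=)
open import Function.Base using (case_of_; id; _∘_)
open import Function.Bundles using (_⇔_; mk⇔)
open import Function.Definitions using (Injective)
open import Relation.Binary.PropositionalEquality hiding (J)
open import Relation.Nullary using (¬_; Dec; contradiction; does; no; yes)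
open import Relation.Nullary.Decidable using (_×-dec_)
open import Relation.Unary using (Decidable)

-- Every bound is kept in the additive form `♯ H + loss r t ≤ 2 + bin n (suc r)`, where k = r + 2
-- and n counts the points other than one. The deduction `loss` counts the sets that miss one of two
-- sets differing by a single exchange. As a count it obeys Pascal's rule, so deleting a point
-- splits it exactly along the two traces, and an induction on n amounts to adding two inequalities.
-- At n = 2k the deduction is 2, which cancels the summand 2 and leaves the complement bound. The
-- obstacle is that the traces through the deleted point need not inherit the assumption on two or
-- three members. If they are nonempty, they still obey a bound of Hilton-Milner type with summand
-- 1; its deduction exceeds the required one by a coefficient C(t, k - 4). The surplus C(t, k - 4) -
-- 1 vanishes exactly for k = 4: there equality can persist, and the extra extremal families appear.
-- For k = 3 the families of type 𝓖₂ exceed the bound, so they are carried through the induction as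
-- an alternative. The threshold of three members makes the estimates strict: three distinct sets to
-- be hit cost more than two.

private
  variable
    m n : ℕ

-- Linear inequalities

infixl 6 _⊕_
infix 4 _≼_

-- Most estimates below are sums of inequalities between cardinalities and binomial coefficients.
-- Reflecting them lets the type checker verify each sum by comparing coefficients.
data Exp (n : ℕ) : Set where
  var : Fin n → Exp n
  con : ℕ → Exp n
  _⊕_ : Exp n → Exp n → Exp n

pattern x0 = var zero
pattern x1 = var (suc zero)
pattern x2 = var (suc (suc zero))
pattern x3 = var (suc (suc (suc zero)))
pattern x4 = var (suc (suc (suc (suc zero))))
pattern x5 = var (suc (suc (suc (suc (suc zero)))))
pattern x6 = var (suc (suc (suc (suc (suc (suc zero))))))
pattern x7 = var (suc (suc (suc (suc (suc (suc (suc zero)))))))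
pattern x8 = var (suc (suc (suc (suc (suc (suc (suc (suc zero))))))))
pattern x9 = var (suc (suc (suc (suc (suc (suc (suc (suc (suc zero)))))))))
pattern x10 = var (suc (suc (suc (suc (suc (suc (suc (suc (suc (suc zero))))))))))
pattern x11 = var (suc (suc (suc (suc (suc (suc (suc (suc (suc (suc (suc zero)))))))))))
pattern x12 = var (suc (suc (suc (suc (suc (suc (suc (suc (suc (suc (suc (suc zero))))))))))))
pattern x13 = var (suc (suc (suc (suc (suc (suc (suc (suc (suc (suc (suc (suc (suc zero)))))))))))))
pattern x14 = var (suc (suc (suc (suc (suc (suc (suc (suc (suc (suc (suc (suc (suc (suc zero))))))))))))))
pattern x15 = var (suc (suc (suc (suc (suc (suc (suc (suc (suc (suc (suc (suc (suc (suc (suc zero)))))))))))))))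

data Ineq (n : ℕ) : Set where
  _≼_ : Exp n → Exp n → Ineq n

eval : Exp n → Vec ℕ n → ℕ
eval (var i) ρ = lookup ρ i
eval (con c) ρ = c
eval (a ⊕ b) ρ = eval a ρ + eval b ρ

unit : Fin n → Vec ℕ n
unit zero    = 1 ∷ replicate _ 0
unit (suc i) = 0 ∷ unit i

coeffs : Exp n → ℕ × Vec ℕ n
coeffs (var i) = 0 , unit i
coeffs (con c) = c , replicate _ 0
coeffs (a ⊕ b) = proj₁ (coeffs a) + proj₁ (coeffs b) , zipWith _+_ (proj₂ (coeffs a)) (proj₂ (coeffs b))

dot : Vec ℕ n → Vec ℕ n → ℕ
dot []       []      = 0
dot (c ∷ cs) (x ∷ ρ) = c * x + dot cs ρ

dot-0 : (ρ : Vec ℕ n) → dot (replicate _ 0) ρ ≡ 0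
dot-0 []      = refl
dot-0 (x ∷ ρ) = dot-0 ρ

dot-unit : (i : Fin n) (ρ : Vec ℕ n) → dot (unit i) ρ ≡ lookup ρ i
dot-unit zero    (x ∷ ρ) = trans (cong (x + 0 +_) (dot-0 ρ)) (trans (+-identityʳ (x + 0)) (+-identityʳ x))
dot-unit (suc i) (x ∷ ρ) = dot-unit i ρ

shuffle : ∀ a b x c d → (a + b) * x + (c + d) ≡ a * x + c + (b * x + d)
shuffle a b x c d = trans (cong (_+ (c + d)) (*-distribʳ-+ x a b)) (swap-inner (a * x) (b * x) c d)

dot-+ : (u v ρ : Vec ℕ n) → dot (zipWith _+_ u v) ρ ≡ dot u ρ + dot v ρ
dot-+ []      []      []      = refl
dot-+ (a ∷ u) (b ∷ v) (x ∷ ρ) = trans (cong ((a + b) * x +_) (dot-+ u v ρ)) (shuffle a b x (dot u ρ) (dot v ρ))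

coeffs-correct : (e : Exp n) (ρ : Vec ℕ n) → eval e ρ ≡ proj₁ (coeffs e) + dot (proj₂ (coeffs e)) ρ
coeffs-correct (var i) ρ = sym (dot-unit i ρ)
coeffs-correct (con c) ρ = sym (trans (cong (c +_) (dot-0 ρ)) (+-identityʳ c))
coeffs-correct (a ⊕ b) ρ
  rewrite coeffs-correct a ρ | coeffs-correct b ρ | dot-+ (proj₂ (coeffs a)) (proj₂ (coeffs b)) ρ =
  swap-inner (proj₁ (coeffs a)) (dot (proj₂ (coeffs a)) ρ) (proj₁ (coeffs b)) (dot (proj₂ (coeffs b)) ρ)

below : Vec ℕ n → Vec ℕ n → Bool
below []       []       = true
below (a ∷ as) (b ∷ bs) = (a ≤ᵇ b) ∧ below as bs

∧-split : ∀ a {b} → T (a ∧ b) → T a × T b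
∧-split true t = tt , t

below-dot : (u v ρ : Vec ℕ n) → T (below u v) → dot u ρ ≤ dot v ρ
below-dot []      []      []      t = z≤n
below-dot (a ∷ u) (b ∷ v) (x ∷ ρ) t with ∧-split (a ≤ᵇ b) t
... | p , q = +-mono-≤ (*-monoˡ-≤ x (≤ᵇ⇒≤ a b p)) (below-dot u v ρ q)

dominated : Exp n → Exp n → Bool
dominated a b = (proj₁ (coeffs a) ≤ᵇ proj₁ (coeffs b)) ∧ below (proj₂ (coeffs a)) (proj₂ (coeffs b))

dominated-sound : (a b : Exp n) → T (dominated a b) → (ρ : Vec ℕ n) → eval a ρ ≤ eval b ρ
dominated-sound a b t ρ rewrite coeffs-correct a ρ | coeffs-correct b ρ
  with ∧-split (proj₁ (coeffs a) ≤ᵇ proj₁ (coeffs b)) t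
... | p , q = +-mono-≤ (≤ᵇ⇒≤ _ _ p) (below-dot (proj₂ (coeffs a)) (proj₂ (coeffs b)) ρ q)

lhs rhs : List (Ineq n) → Exp n
lhs []             = con 0
lhs ((a ≼ b) ∷ hs) = a ⊕ lhs hs
rhs []             = con 0
rhs ((a ≼ b) ∷ hs) = b ⊕ rhs hs

Holds : Vec ℕ n → List (Ineq n) → Set
Holds ρ []             = ⊤
Holds ρ ((a ≼ b) ∷ hs) = eval a ρ ≤ eval b ρ × Holds ρ hs

holds-sum : (ρ : Vec ℕ n) (hs : List (Ineq n)) → Holds ρ hs → eval (lhs hs) ρ ≤ eval (rhs hs) ρ
holds-sum ρ []             _       = z≤n
holds-sum ρ ((a ≼ b) ∷ hs) (p , q) = +-mono-≤ p (holds-sum ρ hs q)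

-- The conclusion a ≤ b is accepted when a + Σ rhs ≤ b + Σ lhs holds
-- coefficientwise, i.e. when it is the plain sum of the hypotheses.
linear : (ρ : Vec ℕ n) (hs : List (Ineq n)) (a b : Exp n) →
         {T (dominated (a ⊕ rhs hs) (b ⊕ lhs hs))} → Holds ρ hs → eval a ρ ≤ eval b ρ
linear ρ hs a b {t} h = +-cancelʳ-≤ (eval (lhs hs) ρ) _ _
  (≤-trans (+-monoʳ-≤ (eval a ρ) (holds-sum ρ hs h)) (dominated-sound (a ⊕ rhs hs) (b ⊕ lhs hs) t ρ))

-- Binomial coefficients

-- Pascal's rule holds by computation, so a coefficient unfolds into summands that `linear` can
-- treat as separate variables.
bin : ℕ → ℕ → ℕ
bin n       zero    = 1
bin zero    (suc k) = 0
bin (suc n) (suc k) = bin n k + bin n (suc k)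

bin-1 : ∀ n → bin n 1 ≡ n
bin-1 zero    = refl
bin-1 (suc n) = cong suc (bin-1 n)

bin-> : ∀ {n k} → n < k → bin n k ≡ 0
bin-> {zero}  {suc k} _       = refl
bin-> {suc n} {suc k} (s≤s p) = cong₂ _+_ (bin-> p) (bin-> (m≤n⇒m≤1+n p))

bin-diag : ∀ n → bin n n ≡ 1
bin-diag zero    = refl
bin-diag (suc n) = cong₂ _+_ (bin-diag n) (bin-> (n<1+n n))

bin-mono : ∀ {m n} k → m ≤ n → bin m k ≤ bin n k
bin-mono {m}     {n}     zero    _       = ≤-refl
bin-mono {zero}  {n}     (suc k) _       = z≤n
bin-mono {suc m} {suc n} (suc k) (s≤s p) = +-mono-≤ (bin-mono k p) (bin-mono (suc k) p)

bin-pos : ∀ {n k} → k ≤ n → 1 ≤ bin n k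
bin-pos {k = k} p = ≤-trans (≤-reflexive (sym (bin-diag k))) (bin-mono k p)

bin-≥2 : ∀ {n k} → suc k < n → 2 ≤ bin n (suc k)
bin-≥2 {suc n} {k} (s≤s p) = +-mono-≤ (bin-pos (<⇒≤ p)) (bin-pos p)

-- Families of subsets

Fam : ℕ → Set
Fam n = Subset n → Bool

infix 4 _∋_
_∋_ : Fam n → Subset n → Set
F ∋ x = F x ≡ true

infix 20 _⁻ _⁺
_⁻ _⁺ : Fam (suc n) → Fam n
(F ⁻) x = F (false ∷ x)
(F ⁺) x = F (true ∷ x)

-- Recursion on the ground set makes `♯ F` reduce to the sum over the traces `F ⁻` and `F ⁺`, the
-- shape in which all inductions on points proceed.
♯ : Fam n → ℕ
♯ {zero}  F with F []
... | true  = 1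
... | false = 0
♯ {suc n} F = ♯ (F ⁻) + ♯ (F ⁺)

true≢false : ∀ {b} → b ≡ true → b ≡ false → ⊥
true≢false refl ()

♯-mono : {F G : Fam n} → (∀ x → F ∋ x → G ∋ x) → ♯ F ≤ ♯ G
♯-mono {zero} {F} {G} h with F [] in eqF | G [] in eqG
... | true  | true  = ≤-refl
... | true  | false = ⊥-elim (true≢false (h [] eqF) eqG)
... | false | true  = z≤n
... | false | false = z≤n
♯-mono {suc n} h = +-mono-≤ (♯-mono (λ x → h (false ∷ x))) (♯-mono (λ x → h (true ∷ x)))

♯-cong : {F G : Fam n} → (∀ x → F x ≡ G x) → ♯ F ≡ ♯ G
♯-cong h = ≤-antisym (♯-mono (λ x p → trans (sym (h x)) p)) (♯-mono (λ x p → trans (h x) p))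

infixr 6 _∩ᶠ_
infixr 5 _∪ᶠ_
_∩ᶠ_ _∪ᶠ_ : Fam n → Fam n → Fam n
(F ∩ᶠ G) x = F x ∧ G x
(F ∪ᶠ G) x = F x ∨ G x

♯-∪∩ : (F G : Fam n) → ♯ (F ∪ᶠ G) + ♯ (F ∩ᶠ G) ≡ ♯ F + ♯ G
♯-∪∩ {zero} F G with F [] | G []
... | true  | true  = refl
... | true  | false = refl
... | false | true  = refl
... | false | false = refl
♯-∪∩ {suc n} F G =
  trans (swap-inner (♯ (F ⁻ ∪ᶠ G ⁻)) _ (♯ (F ⁻ ∩ᶠ G ⁻)) _)
 (trans (cong₂ _+_ (♯-∪∩ (F ⁻) (G ⁻)) (♯-∪∩ (F ⁺) (G ⁺)))
        (swap-inner (♯ (F ⁻)) _ _ _))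

∨-true : ∀ {a b} → a ∨ b ≡ true → a ≡ true ⊎ b ≡ true
∨-true {true}  p = inj₁ refl
∨-true {false} p = inj₂ p

∨-injˡ : ∀ {a b} → a ≡ true → a ∨ b ≡ true
∨-injˡ refl = refl

∨-injʳ : ∀ {a b} → b ≡ true → a ∨ b ≡ true
∨-injʳ {true}  _ = refl
∨-injʳ {false} p = p

∨-false : ∀ {a b} → a ∨ b ≡ false → a ≡ false × b ≡ false
∨-false {false} p = refl , p

∧-true : ∀ {a b} → a ∧ b ≡ true → a ≡ true × b ≡ true
∧-true {true} p = refl , p

∧-intro : ∀ {a b} → a ≡ true → b ≡ true → a ∧ b ≡ true
∧-intro refl refl = refl

¬true : ∀ {b} → (b ≡ true → ⊥) → b ≡ false
¬true {true}  h = ⊥-elim (h refl)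
¬true {false} h = refl

bool-cong : ∀ {a b} → (a ≡ true → b ≡ true) → (b ≡ true → a ≡ true) → a ≡ b
bool-cong {true}  {b}     p q = sym (p refl)
bool-cong {false} {true}  p q = q refl
bool-cong {false} {false} p q = refl

-- Finite search replaces excluded middle: every distinction between an empty and a nonempty trace
-- goes through it.
search : (F : Fam n) → (∃[ x ] F ∋ x) ⊎ (∀ x → F x ≡ false)
search {zero} F with F [] in eq
... | true  = inj₁ ([] , eq)
... | false = inj₂ λ { [] → eq }
search {suc n} F with search (F ⁻) | search (F ⁺)
... | inj₁ (x , p) | _            = inj₁ (false ∷ x , p)
... | inj₂ _       | inj₁ (x , p) = inj₁ (true ∷ x , p)
... | inj₂ h       | inj₂ g       = inj₂ λ { (false ∷ x) → h x ; (true ∷ x) → g x }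

♯-empty : {F : Fam n} → (∀ x → F x ≡ false) → ♯ F ≡ 0
♯-empty {zero} {F} h with F [] in eq
... | true  = ⊥-elim (true≢false eq (h []))
... | false = refl
♯-empty {suc n} h = cong₂ _+_ (♯-empty (λ x → h (false ∷ x))) (♯-empty (λ x → h (true ∷ x)))

♯-pos : {F : Fam n} {x : Subset n} → F ∋ x → 1 ≤ ♯ F
♯-pos {zero} {F} {[]} p rewrite p = ≤-refl
♯-pos {suc n} {F} {false ∷ x} p = ≤-trans (♯-pos {F = F ⁻} p) (m≤m+n _ _)
♯-pos {suc n} {F} {true ∷ x}  p = ≤-trans (♯-pos {F = F ⁺} p) (m≤n+m _ _)

♯-member : (F : Fam n) → 1 ≤ ♯ F → ∃[ x ] F ∋ x
♯-member F p with search F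
... | inj₁ w = w
... | inj₂ h = contradiction (≤-trans p (≤-reflexive (♯-empty h))) λ ()

♯-disjoint : {F G K : Fam n} → (∀ x → F ∋ x → G ∋ x → ⊥) →
             (∀ x → F ∋ x → K ∋ x) → (∀ x → G ∋ x → K ∋ x) → ♯ F + ♯ G ≤ ♯ K
♯-disjoint {F = F} {G} {K} d f g = begin
  ♯ F + ♯ G                        ≡⟨ ♯-∪∩ F G ⟨
  ♯ (F ∪ᶠ G) + ♯ (F ∩ᶠ G)          ≡⟨ cong (♯ (F ∪ᶠ G) +_) (♯-empty λ x → ¬true λ p → d x (proj₁ (∧-true p))
      (proj₂ (∧-true {F x} p))) ⟩
  ♯ (F ∪ᶠ G) + 0                   ≡⟨ +-identityʳ _ ⟩
  ♯ (F ∪ᶠ G)                       ≤⟨ ♯-mono (λ x p → case ∨-true p of λ { (inj₁ q) → f x q ; (inj₂ q) → g x q }) ⟩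
  ♯ K                              ∎
  where open ≤-Reasoning

-- A member of G outside F would make G strictly larger. This turns equality in a bound into
-- equality with the extremal family.
♯-equal : {F G : Fam n} → (∀ x → F ∋ x → G ∋ x) → ♯ G ≤ ♯ F → ∀ x → G ∋ x → F ∋ x
♯-equal {F = F} {G} h p x q with F x in eq
... | true  = refl
... | false = contradiction (≤-trans (+-monoʳ-≤ (♯ F) (♯-pos {F = G∖F} {x} (∧-intro q (cong not eq))))
    (≤-trans (♯-disjoint {F = F} {G∖F} {G} (λ y f g → true≢false (proj₂ (∧-true {G y} g)) (cong not f)) h
        (λ y g → proj₁ (∧-true g)))
    (≤-trans p (≤-reflexive (sym (+-identityʳ (♯ F))))))) λ r → contradiction (+-cancelˡ-≤ (♯ F) _ _ r) λ ()
  where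
  G∖F : Fam _
  G∖F y = G y ∧ not (F y)

infix 4 _==_
_==_ : Subset n → Subset n → Bool
[]          == []          = true
(true ∷ x)  == (true ∷ y)  = x == y
(true ∷ x)  == (false ∷ y) = false
(false ∷ x) == (true ∷ y)  = false
(false ∷ x) == (false ∷ y) = x == y

==⇒≡ : (x y : Subset n) → (x == y) ≡ true → x ≡ y
==⇒≡ []          []          p = refl
==⇒≡ (true ∷ x)  (true ∷ y)  p = cong (true ∷_) (==⇒≡ x y p)
==⇒≡ (false ∷ x) (false ∷ y) p = cong (false ∷_) (==⇒≡ x y p)

==-refl : (x : Subset n) → (x == x) ≡ true
==-refl []          = refl
==-refl (true ∷ x)  = ==-refl x
==-refl (false ∷ x) = ==-refl x

♯-== : (x : Subset n) → ♯ (x ==_) ≡ 1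
♯-== []          = refl
♯-== (true ∷ x)  = cong₂ _+_ (♯-empty {F = (true ∷ x ==_) ⁻} λ _ → refl) (♯-== x)
♯-== (false ∷ x) = trans (cong₂ _+_ (♯-== x) (♯-empty {F = (false ∷ x ==_) ⁺} λ _ → refl)) refl

infixl 6 _∖_
_∖_ : Fam n → Subset n → Fam n
(F ∖ x) y = F y ∧ not (x == y)

♯-remove : (F : Fam n) (x : Subset n) → F ∋ x → ♯ F ≡ suc (♯ (F ∖ x))
♯-remove F x p = ≤-antisym le ge
  where
  le : ♯ F ≤ 1 + ♯ (F ∖ x)
  le = ≤-trans (♯-mono {F = F} {G = (x ==_) ∪ᶠ (F ∖ x)} split)
      (≤-trans (m≤m+n _ (♯ ((x ==_) ∩ᶠ (F ∖ x))))
      (≤-reflexive (trans (♯-∪∩ (x ==_) (F ∖ x)) (cong (_+ ♯ (F ∖ x)) (♯-== x)))))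
    where
    split : ∀ y → F ∋ y → ((x ==_) ∪ᶠ (F ∖ x)) ∋ y
    split y q with x == y
    ... | true  = refl
    ... | false = ∧-intro q refl
  ge : 1 + ♯ (F ∖ x) ≤ ♯ F
  ge = ≤-trans (≤-reflexive (cong (_+ ♯ (F ∖ x)) (sym (♯-== x))))
      (♯-disjoint {F = x ==_} {F ∖ x} {F}
        (λ y a b → true≢false (proj₂ (∧-true {F y} b)) (cong not a))
        (λ y a → subst (F ∋_) (==⇒≡ x y a) p) (λ y b → proj₁ (∧-true b)))

∖-member : {F : Fam n} {x y : Subset n} → (F ∖ x) ∋ y → F ∋ y × x ≢ y
∖-member {F = F} {x} {y} p with ∧-true {F y} p
... | f , g = f , λ { refl → true≢false g (cong not (==-refl x)) }

♯-two : (F : Fam n) → 2 ≤ ♯ F → ∃[ x ] ∃[ y ] (F ∋ x × F ∋ y × x ≢ y)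
♯-two F p with ♯-member F (≤-trans (s≤s z≤n) p)
... | x , fx with ♯-member (F ∖ x) (s≤s⁻¹ (≤-trans p (≤-reflexive (♯-remove F x fx))))
... | y , q = x , y , fx , ∖-member {F = F} q

♯-three : (F : Fam n) → 3 ≤ ♯ F →
          ∃[ x ] ∃[ y ] ∃[ z ] (F ∋ x × F ∋ y × F ∋ z × x ≢ y × x ≢ z × y ≢ z)
♯-three F p =
  let x , fx = ♯-member F (≤-trans (s≤s z≤n) p)
      y , z , gy , gz , y≢z = ♯-two (F ∖ x) (s≤s⁻¹ (≤-trans p (≤-reflexive (♯-remove F x fx))))
      fy , x≢y = ∖-member {F = F} {x} gy
      fz , x≢z = ∖-member {F = F} {x} gz
  in x , y , z , fx , fy , fz , x≢y , x≢z , y≢z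

♯-≥2 : (F : Fam n) {x y : Subset n} → F ∋ x → F ∋ y → x ≢ y → 2 ≤ ♯ F
♯-≥2 F {x} {y} fx fy x≢y =
  ≤-trans (s≤s (♯-pos {F = F ∖ x} {y} (∧-intro fy (cong not (¬true λ q → x≢y (==⇒≡ x y q))))))
          (≤-reflexive (sym (♯-remove F x fx)))
 

-- Uniform families, and counting sets that hit one, two or three given sets

meet : Subset n → Subset n → Bool
meet []      []      = false
meet (a ∷ x) (b ∷ y) = (a ∧ b) ∨ meet x y

co : Subset n → ℕ
co []          = 0
co (true ∷ x)  = co x
co (false ∷ x) = suc (co x)

size+co : (x : Subset n) → ∣ x ∣ + co x ≡ n
size+co []          = refl
size+co (true ∷ x)  = cong suc (size+co x)
size+co (false ∷ x) = trans (+-suc ∣ x ∣ (co x)) (cong suc (size+co x))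

co-size : (x : Subset n) {s t : ℕ} → n ≡ s + t → ∣ x ∣ ≡ s → co x ≡ t
co-size x {s} {t} p q = +-cancelˡ-≡ s _ _ (trans (cong (_+ co x) (sym q)) (trans (size+co x) p))

meet-sym : (x y : Subset n) → meet x y ≡ meet y x
meet-sym []          []          = refl
meet-sym (true ∷ x)  (true ∷ y)  = refl
meet-sym (true ∷ x)  (false ∷ y) = meet-sym x y
meet-sym (false ∷ x) (true ∷ y)  = meet-sym x y
meet-sym (false ∷ x) (false ∷ y) = meet-sym x y

meet-∪ : (x y z : Subset n) → meet x (y ∪ z) ≡ meet x y ∨ meet x z
meet-∪ []          []          []          = refl
meet-∪ (true ∷ x)  (true ∷ y)  (c ∷ z)     = refl
meet-∪ (true ∷ x)  (false ∷ y) (true ∷ z)  = sym (∨-injʳ {meet x y} refl)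
meet-∪ (true ∷ x)  (false ∷ y) (false ∷ z) = meet-∪ x y z
meet-∪ (false ∷ x) (b ∷ y)     (c ∷ z)     = meet-∪ x y z

meet-empty : (x y : Subset n) → ∣ x ∣ ≡ 0 → meet x y ≡ false
meet-empty []          []      p = refl
meet-empty (false ∷ x) (b ∷ y) p = meet-empty x y p

Unif : ℕ → Fam n → Set
Unif k F = ∀ x → F ∋ x → ∣ x ∣ ≡ k

Hits : Subset n → Fam n → Set
Hits c F = ∀ x → F ∋ x → meet x c ≡ true

Cross : Fam n → Fam n → Set
Cross F G = ∀ x y → F ∋ x → G ∋ y → meet x y ≡ true

Cross-sym : {F G : Fam n} → Cross F G → Cross G F
Cross-sym c y x q p = trans (meet-sym y x) (c x y p q)

unif⁺ : ∀ {k} {F : Fam (suc n)} → Unif (suc k) F → Unif k (F ⁺)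
unif⁺ u x p = suc-injective (u (true ∷ x) p)

unif⁻ : ∀ {k} {F : Fam (suc n)} → Unif k F → Unif k (F ⁻)
unif⁻ u x = u (false ∷ x)

hits⁻ : ∀ {b} {c : Subset n} {F : Fam (suc n)} → Hits (b ∷ c) F → Hits c (F ⁻)
hits⁻ h x = h (false ∷ x)

hits⁺ : {c : Subset n} {F : Fam (suc n)} → Hits (false ∷ c) F → Hits c (F ⁺)
hits⁺ h x = h (true ∷ x)

unif⁺-0 : {F : Fam (suc n)} → Unif 0 F → ∀ x → (F ⁺) x ≡ false
unif⁺-0 u x = ¬true λ p → contradiction (u (true ∷ x) p) λ ()

♯-unif : ∀ {k} (F : Fam n) → Unif k F → ♯ F ≤ bin n k
♯-unif {zero} {zero} F u with F []
... | true  = ≤-refl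
... | false = z≤n
♯-unif {zero} {suc k} F u with F [] in eq
... | true  = contradiction (u [] eq) λ ()
... | false = z≤n
♯-unif {suc n} {zero} F u rewrite ♯-empty (unif⁺-0 {F = F} u) | +-identityʳ (♯ (F ⁻)) = ♯-unif (F ⁻) (unif⁻ u)
♯-unif {suc n} {suc k} F u = ≤-trans (+-mono-≤ (♯-unif (F ⁻) (unif⁻ u)) (♯-unif (F ⁺) (unif⁺ u)))
  (≤-reflexive (+-comm (bin n (suc k)) (bin n k)))

avoiding : ℕ → Subset n → Fam n
avoiding r c x = (∣ x ∣ ≡ᵇ r) ∧ not (meet x c)

♯-avoiding : ∀ r (c : Subset n) → ♯ (avoiding r c) ≡ bin (co c) r
♯-avoiding {zero}  zero    []          = refl
♯-avoiding {zero}  (suc r) []          = refl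
♯-avoiding {suc n} zero    (true ∷ c)  =
  trans (cong₂ _+_ (♯-avoiding 0 c) (♯-empty {F = avoiding 0 (true ∷ c) ⁺} λ _ → refl)) refl
♯-avoiding {suc n} (suc r) (true ∷ c)  =
  trans (cong₂ _+_ (♯-avoiding (suc r) c) (♯-empty {F = avoiding (suc r) (true ∷ c) ⁺} λ x → ¬true λ p →
    contradiction (proj₂ (∧-true {∣ x ∣ ≡ᵇ r} p)) λ ())) (+-identityʳ _)
♯-avoiding {suc n} zero    (false ∷ c) =
  trans (cong₂ _+_ (♯-avoiding 0 c) (♯-empty {F = avoiding 0 (false ∷ c) ⁺} λ _ → refl)) refl
♯-avoiding {suc n} (suc r) (false ∷ c) =
  trans (cong₂ _+_ (♯-avoiding (suc r) c) (♯-avoiding r c)) (+-comm _ (bin (co c) r))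

≡ᵇ-true : ∀ {a b} → (a ≡ᵇ b) ≡ true → a ≡ b
≡ᵇ-true {a} {b} p = ≡ᵇ⇒≡ a b (subst T (sym p) tt)

≡ᵇ-intro : ∀ {a b} → a ≡ b → (a ≡ᵇ b) ≡ true
≡ᵇ-intro {zero}  refl = refl
≡ᵇ-intro {suc a} refl = ≡ᵇ-intro {a} refl

not-true : ∀ {b} → not b ≡ true → b ≡ false
not-true {false} _ = refl

meeting : ℕ → Subset n → Subset n → Fam n
meeting r c d x = (∣ x ∣ ≡ᵇ r) ∧ (meet x c ∧ meet x d)

♯-size : ∀ r n → ♯ {n} (λ x → ∣ x ∣ ≡ᵇ r) ≡ bin n r
♯-size zero    zero    = refl
♯-size (suc r) zero    = refl
♯-size zero    (suc n) = trans (cong₂ _+_ (♯-size 0 n) (♯-empty {n} {F = λ x → suc ∣ x ∣ ≡ᵇ 0} λ _ → refl)) refl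
♯-size (suc r) (suc n) = trans (cong₂ _+_ (♯-size (suc r) n) (♯-size r n)) (+-comm _ (bin n r))

-- Inclusion-exclusion over the r-sets that miss c or d; those that miss both are the ones that miss
-- `c ∪ d`.
♯-meeting : ∀ r (c d : Subset n) →
            ♯ (meeting r c d) + (bin (co c) r + bin (co d) r) ≡ bin n r + bin (co (c ∪ d)) r
♯-meeting {n} r c d = begin
  ♯ M + (bin (co c) r + bin (co d) r)   ≡⟨ cong (♯ M +_) (cong₂ _+_ (♯-avoiding r c) (♯-avoiding r d)) ⟨
  ♯ M + (♯ A + ♯ B)                     ≡⟨ cong (♯ M +_) (♯-∪∩ A B) ⟨
  ♯ M + (♯ (A ∪ᶠ B) + ♯ (A ∩ᶠ B))       ≡⟨ +-assoc (♯ M) _ _ ⟨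
  ♯ M + ♯ (A ∪ᶠ B) + ♯ (A ∩ᶠ B)         ≡⟨ cong₂ _+_ split (trans (♯-cong both) (♯-avoiding r (c ∪ d))) ⟩
  bin n r + bin (co (c ∪ d)) r          ∎
  where
  open ≡-Reasoning
  M A B : Fam n
  M = meeting r c d
  A = avoiding r c
  B = avoiding r d
  both : ∀ x → (A ∩ᶠ B) x ≡ avoiding r (c ∪ d) x
  both x rewrite meet-∪ x c d with ∣ x ∣ ≡ᵇ r | meet x c | meet x d
  ... | true  | true  | _     = refl
  ... | true  | false | true  = refl
  ... | true  | false | false = refl
  ... | false | _     | _     = refl
  split : ♯ M + ♯ (A ∪ᶠ B) ≡ bin n r
  split = trans (sym (♯-∪∩ M (A ∪ᶠ B))) (trans (cong₂ _+_ (trans (♯-cong all) (♯-size r n)) (♯-empty none))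
      (+-identityʳ _))
    where
    all : ∀ x → (M ∪ᶠ (A ∪ᶠ B)) x ≡ (∣ x ∣ ≡ᵇ r)
    all x with ∣ x ∣ ≡ᵇ r | meet x c | meet x d
    ... | true  | true  | true  = refl
    ... | true  | true  | false = refl
    ... | true  | false | true  = refl
    ... | true  | false | false = refl
    ... | false | _     | _     = refl
    none : ∀ x → (M ∩ᶠ (A ∪ᶠ B)) x ≡ false
    none x with ∣ x ∣ ≡ᵇ r | meet x c | meet x d
    ... | true  | true  | true  = refl
    ... | true  | true  | false = refl
    ... | true  | false | _     = refl
    ... | false | _     | _     = refl

-- R and the r-sets that avoid c are disjoint families of r-sets.
♯-hits : ∀ {r} {R : Fam n} {c : Subset n} → Unif r R → Hits c R → ♯ R + bin (co c) r ≤ bin n r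
♯-hits {n} {r} {R} {c} u h = begin
  ♯ R + bin (co c) r             ≡⟨ cong (♯ R +_) (♯-avoiding r c) ⟨
  ♯ R + ♯ (avoiding r c)         ≤⟨ ♯-disjoint {F = R} {avoiding r c} {λ x → ∣ x ∣ ≡ᵇ r}
                                      (λ x p q → true≢false (proj₂ (∧-true {∣ x ∣ ≡ᵇ r} q)) (cong not (h x p)))
                                      (λ x p → ≡ᵇ-intro (u x p)) (λ x q → proj₁ (∧-true q)) ⟩
  ♯ {n} (λ x → ∣ x ∣ ≡ᵇ r)       ≡⟨ ♯-size r n ⟩
  bin n r                        ∎
  where open ≤-Reasoning

co-∪ : (x y : Subset n) → co (x ∪ y) ≤ co x
co-∪ []          []          = z≤n
co-∪ (true ∷ x)  (b ∷ y)     = co-∪ x y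
co-∪ (false ∷ x) (true ∷ y)  = m≤n⇒m≤1+n (co-∪ x y)
co-∪ (false ∷ x) (false ∷ y) = s≤s (co-∪ x y)

co-∪-≡ : (x y : Subset n) → co (x ∪ y) ≡ co x → co x ≡ co y → x ≡ y
co-∪-≡ []          []          p q = refl
co-∪-≡ (true ∷ x)  (true ∷ y)  p q = cong (true ∷_) (co-∪-≡ x y p q)
co-∪-≡ (true ∷ x)  (false ∷ y) p q = contradiction
  (≤-trans (≤-reflexive (sym (trans (trans (cong co (∪-comm y x)) p) q))) (co-∪ y x)) 1+n≰n
co-∪-≡ (false ∷ x) (true ∷ y)  p q = contradiction (≤-trans (≤-reflexive (sym p)) (co-∪ x y)) 1+n≰n
co-∪-≡ (false ∷ x) (false ∷ y) p q = cong (false ∷_) (co-∪-≡ x y (suc-injective p) (suc-injective q))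

-- The number of (r+1)-sets that miss c or d, when co c = co d = t + 1 and
-- co (c ∪ d) = t; the bound of the theorem is bin (n − 1) (k − 1) − loss + 2.
loss : ℕ → ℕ → ℕ
loss r t = bin (suc t) (suc r) + bin t r

-- Distinct c and d of equal size leave at most t points outside their union, so the number of sets
-- missing one of them is smallest when exactly t points are left; that smallest value is
-- `loss r t`.
♯-hits₂ : ∀ {r t} {R : Fam n} {c d : Subset n} → c ≢ d → co c ≡ suc t → co d ≡ suc t →
          Unif (suc r) R → Hits c R → Hits d R → ♯ R + loss r t ≤ bin n (suc r)
♯-hits₂ {n} {r} {t} {R} {c} {d} c≢d pc pd u hc hd =
  linear (♯ R ∷ ♯ (meeting (suc r) c d) ∷ bin t r ∷ bin t (suc r) ∷ bin n (suc r) ∷ bin (co (c ∪ d)) (suc r) ∷ [])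
    ((x0 ≼ x1) ∷ (x1 ⊕ (x2 ⊕ x3 ⊕ (x2 ⊕ x3)) ≼ x4 ⊕ x5) ∷ (x5 ≼ x3) ∷ [])
    (x0 ⊕ (x2 ⊕ x3 ⊕ x2)) x4
    ( ♯-mono (λ x p → ∧-intro (≡ᵇ-intro (u x p)) (∧-intro (hc x p) (hd x p)))
    , ≤-reflexive (subst₂ (λ a b → ♯ (meeting (suc r) c d) + (bin a (suc r) + bin b (suc r)) ≡ bin n (suc r) + bin
        (co (c ∪ d)) (suc r)) pc pd (♯-meeting (suc r) c d))
    , bin-mono (suc r) (s≤s⁻¹ (≤-trans (≤∧≢⇒< (co-∪ c d) λ q → c≢d (co-∪-≡ c d q (trans pc (sym pd))))
        (≤-reflexive pc)))
    , tt)

∷-≢ : ∀ {b} {x y : Subset n} → (b ∷ x) ≢ (b ∷ y) → x ≢ y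
∷-≢ h refl = h refl

co-0 : {x y : Subset n} → co x ≡ 0 → co y ≡ 0 → x ≡ y
co-0 {x = []}       {[]}       p q = refl
co-0 {x = true ∷ x} {true ∷ y} p q = cong (true ∷_) (co-0 p q)

-- In the degenerate case r = t = 0 the three sets are complements of points.
Room : ℕ → ℕ → Set
Room r t = (1 ≤ r × r ≤ t) ⊎ (r ≡ 0 × t ≡ 0)

room-≤ : ∀ {r t} → Room r t → r ≤ t
room-≤ (inj₁ (_ , p))       = p
room-≤ (inj₂ (refl , refl)) = ≤-refl

-- The first point lies in only one of the three sets. Members avoiding it must hit e, members
-- through it must hit c and d; the two deductions together exceed the loss by a positive
-- coefficient.
♯-hits₃-111 : ∀ {r t} {R : Fam (suc n)} {c d e : Subset n} → c ≢ d →
              co c ≡ t → co d ≡ t → co e ≡ suc t → Room r t →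
              Unif (suc r) R → Hits (false ∷ c) R → Hits (false ∷ d) R → Hits (true ∷ e) R →
              suc (♯ R + loss r t) ≤ bin (suc n) (suc r)
♯-hits₃-111 {t = zero} c≢d pc pd pe room u hc hd he = ⊥-elim (c≢d (co-0 pc pd))
♯-hits₃-111 {r = zero} {t = suc t} c≢d pc pd pe (inj₁ (() , _)) u hc hd he
♯-hits₃-111 {r = zero} {t = suc t} c≢d pc pd pe (inj₂ (_ , ())) u hc hd he
♯-hits₃-111 {n} {r = suc r} {suc t} {R} {c} {d} {e} c≢d pc pd pe room u hc hd he =
  linear (♯ (R ⁻) ∷ ♯ (R ⁺) ∷ bin (2 + t) (2 + r) ∷ bin (suc t) (suc r) ∷ bin t r ∷ bin n (suc r) ∷ bin n
      (2 + r) ∷ [])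
    ((x0 ⊕ x2 ≼ x6) ∷ (x1 ⊕ (x3 ⊕ x4) ≼ x5) ∷ (con 1 ≼ x4) ∷ [])
    (con 1 ⊕ (x0 ⊕ x1 ⊕ (x2 ⊕ x3))) (x5 ⊕ x6)
    ( subst (λ a → ♯ (R ⁻) + bin a (suc (suc r)) ≤ bin n (suc (suc r))) pe (♯-hits {R = R ⁻} (unif⁻ u) (hits⁻ he))
    , ♯-hits₂ {R = R ⁺} c≢d pc pd (unif⁺ u) (hits⁺ hc) (hits⁺ hd)
    , bin-pos (s≤s⁻¹ (room-≤ room))
    , tt)

-- The first point lies in two of the three sets. Members avoiding it already suffer the whole loss
-- of c and d, and members through it must still hit e.
♯-hits₃-110 : ∀ {r t} {R : Fam (suc n)} {c d e : Subset n} → c ≢ d →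
              co c ≡ suc t → co d ≡ suc t → co e ≡ t → Room r t →
              Unif (suc r) R → Hits (true ∷ c) R → Hits (true ∷ d) R → Hits (false ∷ e) R →
              suc (♯ R + loss r t) ≤ bin (suc n) (suc r)
♯-hits₃-110 {n} {r} {t} {R} c≢d pc pd pe room u hc hd he =
  linear (♯ (R ⁻) ∷ ♯ (R ⁺) ∷ bin (suc t) (suc r) ∷ bin t r ∷ bin n r ∷ bin n (suc r) ∷ [])
    ((x0 ⊕ (x2 ⊕ x3) ≼ x5) ∷ (x1 ⊕ x3 ≼ x4) ∷ (con 1 ≼ x3) ∷ [])
    (con 1 ⊕ (x0 ⊕ x1 ⊕ (x2 ⊕ x3))) (x4 ⊕ x5)
    ( ♯-hits₂ {R = R ⁻} c≢d pc pd (unif⁻ u) (hits⁻ hc) (hits⁻ hd)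
    , subst (λ a → ♯ (R ⁺) + bin a r ≤ bin n r) pe (♯-hits {R = R ⁺} (unif⁺ u) (hits⁺ he))
    , bin-pos (room-≤ room)
    , tt)

♯-hits₃ : ∀ {r t} {R : Fam n} {c d e : Subset n} → c ≢ d → c ≢ e → d ≢ e →
          co c ≡ suc t → co d ≡ suc t → co e ≡ suc t → Room r t →
          Unif (suc r) R → Hits c R → Hits d R → Hits e R → suc (♯ R + loss r t) ≤ bin n (suc r)
♯-hits₃ {c = []} {[]} c≢d c≢e d≢e pc pd pe room u hc hd he = ⊥-elim (c≢d refl)
♯-hits₃ {suc n} {r} {t} {R} {true ∷ c} {true ∷ d} {true ∷ e} c≢d c≢e d≢e pc pd pe room u hc hd he =
  linear (♯ (R ⁻) ∷ ♯ (R ⁺) ∷ loss r t ∷ bin n r ∷ bin n (suc r) ∷ [])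
    ((con 1 ⊕ (x0 ⊕ x2) ≼ x4) ∷ (x1 ≼ x3) ∷ [])
    (con 1 ⊕ (x0 ⊕ x1 ⊕ x2)) (x3 ⊕ x4)
    ( ♯-hits₃ {R = R ⁻} (∷-≢ c≢d) (∷-≢ c≢e) (∷-≢ d≢e) pc pd pe room (unif⁻ u) (hits⁻ hc) (hits⁻ hd) (hits⁻ he)
    , ♯-unif (R ⁺) (unif⁺ u)
    , tt)
♯-hits₃ {t = zero} {c = false ∷ c} {false ∷ d} {false ∷ e} c≢d c≢e d≢e pc pd pe room u hc hd he =
  ⊥-elim (c≢d (cong (false ∷_) (co-0 (suc-injective pc) (suc-injective pd))))
♯-hits₃ {suc n} {zero} {suc t} {R} {false ∷ c} {false ∷ d} {false ∷ e} c≢d c≢e d≢e pc pd pe (inj₁ (() , _)) u hc hd he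
♯-hits₃ {suc n} {zero} {suc t} {R} {false ∷ c} {false ∷ d} {false ∷ e} c≢d c≢e d≢e pc pd pe (inj₂ (_ , ())) u hc hd he
♯-hits₃ {suc n} {suc r} {suc t} {R} {false ∷ c} {false ∷ d} {false ∷ e} c≢d c≢e d≢e pc pd pe room u hc hd he
  -- The point lies in none of the three sets. Strictness comes from the trace avoiding it while
  -- `suc r` still fits under t; at r = t only the trace through it keeps `Room`.
  with m≤n⇒m<n∨m≡n (room-≤ room)
... | inj₁ r<t =
  linear (♯ (R ⁻) ∷ ♯ (R ⁺) ∷ bin (suc t) (2 + r) ∷ bin (suc t) (suc r) ∷ bin t (suc r) ∷ bin t r ∷ bin n
      (suc r) ∷ bin n (2 + r) ∷ [])
    ((con 1 ⊕ (x0 ⊕ (x2 ⊕ x4)) ≼ x7) ∷ (x1 ⊕ (x3 ⊕ x5) ≼ x6) ∷ [])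
    (con 1 ⊕ (x0 ⊕ x1 ⊕ ((x3 ⊕ x2) ⊕ (x5 ⊕ x4)))) (x6 ⊕ x7)
    ( ♯-hits₃ {R = R ⁻} (∷-≢ c≢d) (∷-≢ c≢e) (∷-≢ d≢e) (suc-injective pc) (suc-injective pd) (suc-injective pe)
        (inj₁ (s≤s z≤n , s≤s⁻¹ r<t)) (unif⁻ u) (hits⁻ hc) (hits⁻ hd) (hits⁻ he)
    , ♯-hits₂ {R = R ⁺} (∷-≢ c≢d) (suc-injective pc) (suc-injective pd) (unif⁺ u) (hits⁺ hc) (hits⁺ hd)
    , tt)
... | inj₂ refl =
  linear (♯ (R ⁻) ∷ ♯ (R ⁺) ∷ bin (suc t) (2 + r) ∷ bin (suc t) (suc r) ∷ bin t (suc r) ∷ bin t r ∷ bin n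
      (suc r) ∷ bin n (2 + r) ∷ [])
    ((x0 ⊕ (x2 ⊕ x4) ≼ x7) ∷ (con 1 ⊕ (x1 ⊕ (x3 ⊕ x5)) ≼ x6) ∷ [])
    (con 1 ⊕ (x0 ⊕ x1 ⊕ ((x3 ⊕ x2) ⊕ (x5 ⊕ x4)))) (x6 ⊕ x7)
    ( ♯-hits₂ {R = R ⁻} (∷-≢ c≢d) (suc-injective pc) (suc-injective pd) (unif⁻ u) (hits⁻ hc) (hits⁻ hd)
    , ♯-hits₃ {R = R ⁺} (∷-≢ c≢d) (∷-≢ c≢e) (∷-≢ d≢e) (suc-injective pc) (suc-injective pd) (suc-injective pe)
        (room′ r) (unif⁺ u) (hits⁺ hc) (hits⁺ hd) (hits⁺ he)
    , tt)
  where
  room′ : ∀ r → Room r r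
  room′ zero    = inj₂ (refl , refl)
  room′ (suc r) = inj₁ (s≤s z≤n , ≤-refl)
♯-hits₃ {c = false ∷ c} {false ∷ d} {true ∷ e} c≢d c≢e d≢e pc pd pe room u hc hd he =
  ♯-hits₃-111 (∷-≢ c≢d) (suc-injective pc) (suc-injective pd) pe room u hc hd he
♯-hits₃ {c = false ∷ c} {true ∷ d} {false ∷ e} c≢d c≢e d≢e pc pd pe room u hc hd he =
  ♯-hits₃-111 (∷-≢ c≢e) (suc-injective pc) (suc-injective pe) pd room u hc he hd
♯-hits₃ {c = true ∷ c} {false ∷ d} {false ∷ e} c≢d c≢e d≢e pc pd pe room u hc hd he =
  ♯-hits₃-111 (∷-≢ d≢e) (suc-injective pd) (suc-injective pe) pc room u hd he hc
♯-hits₃ {c = true ∷ c} {true ∷ d} {false ∷ e} c≢d c≢e d≢e pc pd pe room u hc hd he =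
  ♯-hits₃-110 (∷-≢ c≢d) pc pd (suc-injective pe) room u hc hd he
♯-hits₃ {c = true ∷ c} {false ∷ d} {true ∷ e} c≢d c≢e d≢e pc pd pe room u hc hd he =
  ♯-hits₃-110 (∷-≢ c≢e) pc pe (suc-injective pd) room u hc he hd
♯-hits₃ {c = false ∷ c} {true ∷ d} {true ∷ e} c≢d c≢e d≢e pc pd pe room u hc hd he =
  ♯-hits₃-110 (∷-≢ d≢e) pd pe (suc-injective pc) room u hd he hc

♯-w1 : {F : Fam n} {p : Subset n} → Unif 1 F → Hits p F → ♯ F ≤ ∣ p ∣
♯-w1 {n} {F} {p} u h = +-cancelʳ-≤ (co p) _ _ (begin
  ♯ F + co p           ≡⟨ cong (♯ F +_) (bin-1 (co p)) ⟨
  ♯ F + bin (co p) 1   ≤⟨ ♯-hits {R = F} u h ⟩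
  bin n 1              ≡⟨ bin-1 n ⟩
  n                    ≡⟨ size+co p ⟨
  ∣ p ∣ + co p         ∎)
  where open ≤-Reasoning

♯-hits-empty : {F : Fam n} {p : Subset n} → ∣ p ∣ ≡ 0 → Hits p F → ♯ F ≡ 0
♯-hits-empty {F = F} {p} z h = ♯-empty λ x → ¬true λ q → true≢false (h x q) (trans (meet-sym x p) (meet-empty p x z))

-- A 2-set hitting two disjoint sets is an edge between them.
♯-w2 : {F : Fam n} {p q : Subset n} → meet p q ≡ false → Unif 2 F → Hits p F → Hits q F → ♯ F ≤ ∣ p ∣ * ∣ q ∣
♯-w2 {zero} {F} {[]} {[]} d u hp hq = ≤-reflexive (♯-hits-empty {F = F} {[]} refl hp)
♯-w2 {suc n} {F} {true ∷ p} {false ∷ q} d u hp hq =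
  ≤-trans (≤-reflexive (+-comm (♯ (F ⁻)) _)) (+-mono-≤ (♯-w1 {F = F ⁺} (unif⁺ u) (hits⁺ hq))
      (♯-w2 {F = F ⁻} d (unif⁻ u) (hits⁻ hp) (hits⁻ hq)))
♯-w2 {suc n} {F} {false ∷ p} {true ∷ q} d u hp hq = begin
  ♯ (F ⁻) + ♯ (F ⁺)              ≤⟨ +-mono-≤ (♯-w2 {F = F ⁻} d (unif⁻ u) (hits⁻ hp) (hits⁻ hq))
      (♯-w1 {F = F ⁺} (unif⁺ u) (hits⁺ hp)) ⟩
  ∣ p ∣ * ∣ q ∣ + ∣ p ∣          ≡⟨ +-comm (∣ p ∣ * ∣ q ∣) _ ⟩
  ∣ p ∣ + ∣ p ∣ * ∣ q ∣          ≡⟨ *-suc ∣ p ∣ ∣ q ∣ ⟨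
  ∣ p ∣ * suc ∣ q ∣              ∎
  where open ≤-Reasoning
♯-w2 {suc n} {F} {false ∷ p} {false ∷ q} d u hp hq = begin
  ♯ (F ⁻) + ♯ (F ⁺)              ≤⟨ +-mono-≤ (♯-w2 {F = F ⁻} d (unif⁻ u) (hits⁻ hp) (hits⁻ hq))
      (≤-reflexive (♯-empty {F = F ⁺} λ x → ¬true λ e →
                                       1-set x (unif⁺ u x e) (hp (true ∷ x) e) (hq (true ∷ x) e))) ⟩
  ∣ p ∣ * ∣ q ∣ + 0              ≡⟨ +-identityʳ _ ⟩
  ∣ p ∣ * ∣ q ∣                  ∎
  where
  open ≤-Reasoning
  1-set : ∀ x → ∣ x ∣ ≡ 1 → meet x p ≡ true → meet x q ≡ true → ⊥
  1-set x e a b = go x p q d e a b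
    where
    go : ∀ {n} (x p q : Subset n) → meet p q ≡ false → ∣ x ∣ ≡ 1 → meet x p ≡ true → meet x q ≡ true → ⊥
    go (true ∷ x) (true ∷ p) (false ∷ q) d e a b = true≢false b (meet-empty x q (suc-injective e))
    go (true ∷ x) (false ∷ p) (b′ ∷ q) d e a b = true≢false a (meet-empty x p (suc-injective e))
    go (false ∷ x) (true ∷ p) (false ∷ q) d e a b = go x p q d e a b
    go (false ∷ x) (false ∷ p) (b′ ∷ q) d e a b = go x p q d e a b

-- Shifted families

-- The head of a vector is the least preferred point: shifting moves points
-- towards the end.
Shifted : Fam n → Set
Shifted {zero}        F = ⊤
Shifted {suc zero}    F = ⊤
Shifted {suc (suc n)} F =
  (∀ x → F ∋ true ∷ false ∷ x → F ∋ false ∷ true ∷ x) × Shifted (F ⁻) × Shifted (F ⁺)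

shifted⁻ : {F : Fam (suc n)} → Shifted F → Shifted (F ⁻)
shifted⁻ {zero}  s = tt
shifted⁻ {suc n} s = proj₁ (proj₂ s)

shifted⁺ : {F : Fam (suc n)} → Shifted F → Shifted (F ⁺)
shifted⁺ {zero}  s = tt
shifted⁺ {suc n} s = proj₂ (proj₂ s)

-- The first point is exchanged for the earliest point outside x and y. The size bound supplies such
-- a point, and adjacent shifts carry the exchange past the points of x and y.
escape : {F : Fam (suc n)} → Shifted F → (x y : Subset n) → meet x y ≡ false → ∣ x ∣ + ∣ y ∣ < n →
         F ∋ true ∷ x → ∃[ z ] (F ∋ false ∷ z × meet z y ≡ false)
escape {F = F} (s , s⁻ , s⁺) (false ∷ x) (false ∷ y) d l p = true ∷ x , s x p , d
escape {F = F} (s , s⁻ , s⁺) (true ∷ x) (false ∷ y) d l p =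
  let z , q , e = escape {F = F ⁺} s⁺ x y d (s≤s⁻¹ l) p in true ∷ z , s z q , e
escape {F = F} (s , s⁻ , s⁺) (false ∷ x) (true ∷ y) d l p =
  let z , q , e = escape {F = F ⁻} s⁻ x y d (s≤s⁻¹ (≤-trans (≤-reflexive (cong suc (sym (+-suc ∣ x ∣ ∣ y ∣)))) l))
          (s x p)
  in false ∷ z , q , e

empty : Subset n
empty = replicate _ false

size-empty : ∀ n → ∣ empty {n} ∣ ≡ 0
size-empty zero    = refl
size-empty (suc n) = size-empty n

size-0 : {x y : Subset n} → ∣ x ∣ ≡ 0 → ∣ y ∣ ≡ 0 → x ≡ y
size-0 {x = []}        {[]}        p q = refl
size-0 {x = false ∷ x} {false ∷ y} p q = cong (false ∷_) (size-0 p q)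

∅-∪ : (y : Subset n) → empty ∪ y ≡ y
∅-∪ []      = refl
∅-∪ (b ∷ y) = cong (b ∷_) (∅-∪ y)

∪-∅ : (x : Subset n) → x ∪ empty ≡ x
∪-∅ x = trans (∪-comm x empty) (∅-∪ x)

∅-meet : (y : Subset n) → meet empty y ≡ false
∅-meet {n} y = meet-empty empty y (size-empty n)

meet-∅ : (x : Subset n) → meet x empty ≡ false
meet-∅ x = trans (meet-sym x empty) (∅-meet x)

not-false : ∀ {b} → (b ≡ false → ⊥) → b ≡ true
not-false {true}  h = refl
not-false {false} h = ⊥-elim (h refl)

-- If x and y were disjoint, exchanging the first point of `true ∷ x` for a free one would give a
-- member that misses `true ∷ y`. Hence the traces through the first point cross again, which is
-- what makes induction on shifted families possible.
cross-escape : {F : Fam (suc n)} {x : Subset n} (b : Bool) {y : Subset n} → Shifted F →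
               (∀ z → F ∋ z → meet z (b ∷ y) ≡ true) → F ∋ true ∷ x → ∣ x ∣ + ∣ b ∷ y ∣ ≤ n → meet x y ≡ true
cross-escape {x = x} false s c p l = c (true ∷ x) p
cross-escape {F = F} {x} true {y} s c p l = not-false λ d →
  let z , q , e = escape {F = F} s x y d (≤-trans (≤-reflexive (sym (+-suc ∣ x ∣ ∣ y ∣))) l) p
  in true≢false (c (false ∷ z) q) e

-- The same for two points at once; if the opposite set contains both, two successive exchanges are
-- made, and uniformity gives the size bound for the second.
cross-escape₂ : ∀ {k} {F : Fam (2 + n)} {x : Subset n} (a b : Bool) {y : Subset n} → Shifted F → Unif k F →
                (∀ z → F ∋ z → meet z (a ∷ b ∷ y) ≡ true) → F ∋ true ∷ true ∷ x → ∣ x ∣ + ∣ a ∷ b ∷ y ∣ ≤ n →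
                    meet x y ≡ true
cross-escape₂ {F = F} false b s u c p l =
  cross-escape {F = F ⁺} b (shifted⁺ {F = F} s) (λ z → c (true ∷ z)) p l
cross-escape₂ {F = F} {x} true false {y} s u c p l = not-false λ d →
  let z , q , e = escape {F = F} s (true ∷ x) (false ∷ y) d (s≤s (≤-trans (≤-reflexive (sym (+-suc ∣ x ∣ ∣ y ∣))) l))
          p
  in true≢false (c (false ∷ z) q) e
cross-escape₂ {n} {F = F} {x} true true {y} s u c p l = not-false λ d →
  let l′ = ≤-trans (≤-reflexive (sym (trans (+-suc ∣ x ∣ (suc ∣ y ∣)) (cong suc (+-suc ∣ x ∣ ∣ y ∣))))) l
      z , q , e = escape {F = F ⁺} (shifted⁺ {F = F} s) x y d (≤-trans (n≤1+n _) l′) p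
      same = suc-injective (trans (u (true ∷ false ∷ z) q) (sym (u (true ∷ true ∷ x) p)))
      w , r , f = escape {F = F} s (false ∷ z) (true ∷ y) e
        (s≤s (≤-trans (≤-reflexive (trans (cong (_+ suc ∣ y ∣) same) (cong suc (+-suc ∣ x ∣ ∣ y ∣)))) l′)) q
  in true≢false (c (false ∷ w) r) f

-- The complements of the members of Q are a-sets outside P. This is the base case of every
-- induction on n.
complement-bound : ∀ {a b} (P Q : Fam n) → n ≡ a + b → Unif a P → Unif b Q → Cross P Q → ♯ P + ♯ Q ≤ bin n a
complement-bound {n} {a} {b} P Q e u v c = begin
  ♯ P + ♯ Q                   ≡⟨ cong (♯ P +_) (♯-∁ Q) ⟨
  ♯ P + ♯ (Q ∘ ∁)             ≤⟨ ♯-disjoint {F = P} {Q ∘ ∁} {λ x → ∣ x ∣ ≡ᵇ a}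
                                   (λ x p q → true≢false (c x (∁ x) p q) (meet-∁ x)) (λ x p → ≡ᵇ-intro (u x p))
                                   (λ x q → ≡ᵇ-intro (+-cancelʳ-≡ b _ _
                                       (trans (cong (∣ x ∣ +_) (sym (trans (sym (size-∁ x)) (v (∁ x) q))))
                                       (trans (size+co x) e)))) ⟩
  ♯ {n} (λ x → ∣ x ∣ ≡ᵇ a)    ≡⟨ ♯-size a n ⟩
  bin n a                     ∎
  where
  open ≤-Reasoning
  size-∁ : ∀ {n} (x : Subset n) → ∣ ∁ x ∣ ≡ co x
  size-∁ []          = refl
  size-∁ (true ∷ x)  = size-∁ x
  size-∁ (false ∷ x) = cong suc (size-∁ x)
  meet-∁ : ∀ {n} (x : Subset n) → meet x (∁ x) ≡ false
  meet-∁ []          = refl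
  meet-∁ (true ∷ x)  = meet-∁ x
  meet-∁ (false ∷ x) = meet-∁ x
  ♯-∁ : ∀ {n} (F : Fam n) → ♯ (F ∘ ∁) ≡ ♯ F
  ♯-∁ {zero}  F = refl
  ♯-∁ {suc n} F = trans (cong₂ _+_ (♯-∁ (F ⁺)) (♯-∁ (F ⁻))) (+-comm (♯ (F ⁺)) _)

sub : Subset n → Subset n → Bool
sub []      []      = true
sub (a ∷ x) (b ∷ y) = (not a ∨ b) ∧ sub x y

sub-∅ : (x z : Subset n) → ∣ x ∣ ≡ 0 → sub x z ≡ true
sub-∅ []          []      p = refl
sub-∅ (false ∷ x) (c ∷ z) p = sub-∅ x z p

Contains : Subset n → Fam n → Set
Contains c F = ∀ x → F ∋ x → sub c x ≡ true

missing : (e q : Subset n) → sub e q ≡ false →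
          ∃[ y ] ∃[ e′ ] (∣ y ∣ ≡ 1 × e ≡ e′ ∪ y × ∣ e ∣ ≡ suc ∣ e′ ∣ × meet y q ≡ false × meet e′ y ≡ false)
missing [] [] ()
missing (true ∷ e) (true ∷ q) p =
  let y , e′ , a , b , c , d , f = missing e q p in false ∷ y , true ∷ e′ , a , cong (true ∷_) b , cong suc c , d , f
missing {suc n} (true ∷ e) (false ∷ q) p =
  true ∷ empty , false ∷ e , cong suc (size-empty n) , cong (true ∷_) (sym (∪-∅ e)) , refl , meet-empty empty q
      (size-empty n) , meet-∅ e
missing (false ∷ e) (b ∷ q) p =
  let y , e′ , a , b , c , d , f = missing e q p in false ∷ y , false ∷ e′ , a , cong (false ∷_) b , c , d , f

meet-singletons : (x y : Subset n) → ∣ x ∣ ≡ 1 → ∣ y ∣ ≡ 1 → meet x y ≡ true → x ≡ y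
meet-singletons (true ∷ x)  (true ∷ y)  p q r = cong (true ∷_) (size-0 (suc-injective p) (suc-injective q))
meet-singletons (true ∷ x)  (false ∷ y) p q r = ⊥-elim (true≢false r (meet-empty x y (suc-injective p)))
meet-singletons (false ∷ x) (true ∷ y)  p q r = ⊥-elim (true≢false r
    (trans (meet-sym x y) (meet-empty y x (suc-injective q))))
meet-singletons (false ∷ x) (false ∷ y) p q r = cong (false ∷_) (meet-singletons x y p q r)

-- Shifted cross-intersecting pairs

cross⁻ : {P Q : Fam (suc n)} → Cross P Q → Cross (P ⁻) (Q ⁻)
cross⁻ c x y = c (false ∷ x) (false ∷ y)

nonempty⁻ : ∀ {l} {F : Fam (suc n)} → Shifted F → Unif l F → l ≤ n → 1 ≤ ♯ F → 1 ≤ ♯ (F ⁻)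
nonempty⁻ {n} {l} {F} s u l≤n p with ♯-member F p
... | false ∷ x , q = ♯-pos {F = F ⁻} {x} q
... | true ∷ x  , q =
  let z , r , _ = escape {F = F} s x empty (meet-∅ x)
                    (≤-trans (≤-reflexive (trans (cong (λ a → suc (∣ x ∣ + a)) (size-empty n))
                        (trans (cong suc (+-identityʳ _)) (u (true ∷ x) q)))) l≤n) q
  in ♯-pos {F = F ⁻} {z} r

extra : (x z : Subset n) → ∣ x ∣ < ∣ z ∣ → ∃[ y ] (∣ y ∣ ≡ 1 × meet x y ≡ false × meet z y ≡ true)
extra (true ∷ x)  (true ∷ z)  p = let y , a , b , c = extra x z (s≤s⁻¹ p) in false ∷ y , a , b , c
extra (true ∷ x)  (false ∷ z) p = let y , a , b , c = extra x z (<⇒≤ p) in false ∷ y , a , b , c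
extra {suc n} (false ∷ x) (true ∷ z) p = true ∷ empty , cong suc (size-empty n) , meet-∅ x , refl
extra (false ∷ x) (false ∷ z) p = let y , a , b , c = extra x z p in false ∷ y , a , b , c

-- A member through the first point can give it up in two ways: the second exchange avoids the point
-- y gained by the first, so the two results differ.
two⁻ : ∀ {l} {F : Fam (suc n)} → Shifted F → Unif l F → l < n → 2 ≤ ♯ F → 2 ≤ ♯ (F ⁻)
two⁻ {n} {l} {F} s u l<n p with search (F ⁺)
... | inj₂ none = ≤-trans p (≤-reflexive (trans (cong (♯ (F ⁻) +_) (♯-empty none)) (+-identityʳ _)))
... | inj₁ (x , q) =
  let sx = u (true ∷ x) q
      z , r , _ = escape {F = F} s x empty (meet-∅ x)
                    (≤-trans (≤-reflexive (trans (cong (λ a → suc (∣ x ∣ + a)) (size-empty n))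
                        (trans (cong suc (+-identityʳ _)) sx))) (<⇒≤ l<n)) q
      y , a , b , c = extra x z (≤-reflexive (trans sx (sym (u (false ∷ z) r))))
      w , t , e = escape {F = F} s x y b (≤-trans (≤-reflexive
          (cong suc (trans (cong (∣ x ∣ +_) a) (trans (+-comm ∣ x ∣ 1) sx)))) l<n) q
  in ♯-≥2 (F ⁻) {z} {w} r t λ z≡w → true≢false c (trans (cong (λ v → meet v y) z≡w) e)

-- The Hilton-Milner type bound for two nonempty crossing families. After deleting the first point,
-- either one trace through it is empty and the other hits a fixed set, or both are nonempty and
-- cross again with smaller sets.
cross-bound₁ : ∀ l {t} {P Q : Fam n} → n ≡ suc l + t → suc l ≤ t → Shifted P → Shifted Q →
               Unif (suc l) P → Unif (suc l) Q → Cross P Q → 1 ≤ ♯ P → 1 ≤ ♯ Q →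
               ♯ P + ♯ Q + bin t (suc l) ≤ suc (bin n (suc l))
cross-bound₁ {n} l {t} {P} {Q} e le sP sQ uP uQ c p q with m≤n⇒m<n∨m≡n le
... | inj₂ refl = linear (♯ P ∷ ♯ Q ∷ bin t t ∷ bin n t ∷ [])
  ((x0 ⊕ x1 ≼ x3) ∷ (x2 ≼ con 1) ∷ []) (x0 ⊕ x1 ⊕ x2) (con 1 ⊕ x3)
  (complement-bound P Q e uP uQ c , ≤-reflexive (bin-diag t) , tt)
cross-bound₁ {suc n} l {suc t} {P} {Q} e le sP sQ uP uQ c p q | inj₁ (s≤s l<t) = main (search (P ⁺)) (search (Q ⁺))
  where
  n≡ : n ≡ suc l + t
  n≡ = suc-injective (trans e (cong suc (+-suc l t)))
  l≤n : suc l ≤ n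
  l≤n = ≤-trans (m≤m+n (suc l) t) (≤-reflexive (sym n≡))
  p⁻ : 1 ≤ ♯ (P ⁻)
  p⁻ = nonempty⁻ {F = P} sP uP l≤n p
  q⁻ : 1 ≤ ♯ (Q ⁻)
  q⁻ = nonempty⁻ {F = Q} sQ uQ l≤n q
  IH : ♯ (P ⁻) + ♯ (Q ⁻) + bin t (suc l) ≤ suc (bin n (suc l))
  IH = cross-bound₁ l {P = P ⁻} {Q ⁻} n≡ l<t (shifted⁻ {F = P} sP) (shifted⁻ {F = Q} sQ) (unif⁻ uP) (unif⁻ uQ)
      (cross⁻ c) p⁻ q⁻
  Goal = ♯ P + ♯ Q + bin (suc t) (suc l) ≤ suc (bin (suc n) (suc l))
  one-sided : ∀ {P Q : Fam (suc n)} → Unif (suc l) P → Unif (suc l) Q → Cross P Q → 1 ≤ ♯ (Q ⁻) → ♯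
      (P ⁺) + bin t l ≤ bin n l
  one-sided {P} {Q} uP uQ c q⁻ =
    let x , x∈ = ♯-member (Q ⁻) q⁻
    in subst (λ a → ♯ (P ⁺) + bin a l ≤ bin n l) (co-size x n≡ (uQ (false ∷ x) x∈))
         (♯-hits {R = P ⁺} {x} (unif⁺ uP) λ y y∈ → c (true ∷ y) (false ∷ x) y∈ x∈)
  main : _ → _ → Goal
  main _ (inj₂ none) =
    linear (♯ (P ⁻) ∷ ♯ (P ⁺) ∷ ♯ (Q ⁻) ∷ ♯ (Q ⁺) ∷ bin t l ∷ bin t (suc l) ∷ bin n l ∷ bin n (suc l) ∷ [])
      ((x0 ⊕ x2 ⊕ x5 ≼ con 1 ⊕ x7) ∷ (x1 ⊕ x4 ≼ x6) ∷ (x3 ≼ con 0) ∷ [])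
      (x0 ⊕ x1 ⊕ (x2 ⊕ x3) ⊕ (x4 ⊕ x5)) (con 1 ⊕ (x6 ⊕ x7))
      (IH , one-sided {P} {Q} uP uQ c q⁻ , ≤-reflexive (♯-empty none) , tt)
  main (inj₂ none) _ =
    linear (♯ (P ⁻) ∷ ♯ (P ⁺) ∷ ♯ (Q ⁻) ∷ ♯ (Q ⁺) ∷ bin t l ∷ bin t (suc l) ∷ bin n l ∷ bin n (suc l) ∷ [])
      ((x0 ⊕ x2 ⊕ x5 ≼ con 1 ⊕ x7) ∷ (x3 ⊕ x4 ≼ x6) ∷ (x1 ≼ con 0) ∷ [])
      (x0 ⊕ x1 ⊕ (x2 ⊕ x3) ⊕ (x4 ⊕ x5)) (con 1 ⊕ (x6 ⊕ x7))
      (IH , one-sided {Q} {P} uQ uP (Cross-sym {F = P} {Q} c) p⁻ , ≤-reflexive (♯-empty none) , tt)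
  main (inj₁ (x , x∈)) (inj₁ (y , y∈)) = both l refl
    where
    meets : ∀ x y → (P ⁺) ∋ x → (Q ⁺) ∋ y → meet x y ≡ true
    meets x y x∈ y∈ = cross-escape {F = P} true sP (λ z z∈ → c z (true ∷ y) z∈ y∈) x∈
      (≤-trans (+-mono-≤ (≤-reflexive (suc-injective (uP _ x∈))) (≤-reflexive (uQ _ y∈)))
        (≤-trans (≤-reflexive (+-comm l (suc l))) (≤-trans (+-monoʳ-≤ (suc l) (≤-trans (n≤1+n l) l<t))
            (≤-reflexive (sym n≡)))))
    both : ∀ k → k ≡ l → Goal
    both zero    refl = ⊥-elim (true≢false (meets x y x∈ y∈) (meet-empty x y (suc-injective (uP _ x∈))))
    -- Each trace pair brings a summand 1, but only one is allowed; the deduction `bin (suc t) l` of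
    -- the smaller case exceeds `bin t l` by `bin t k`, which pays for the other.
    both (suc k) refl =
      linear (♯ (P ⁻) ∷ ♯ (P ⁺) ∷ ♯ (Q ⁻) ∷ ♯ (Q ⁺) ∷ bin t l ∷ bin t (suc l) ∷ bin n l ∷ bin n
          (suc l) ∷ bin t k ∷ [])
        ((x0 ⊕ x2 ⊕ x5 ≼ con 1 ⊕ x7) ∷ (x1 ⊕ x3 ⊕ (x8 ⊕ x4) ≼ con 1 ⊕ x6) ∷ (con 1 ≼ x8) ∷ [])
        (x0 ⊕ x1 ⊕ (x2 ⊕ x3) ⊕ (x4 ⊕ x5)) (con 1 ⊕ (x6 ⊕ x7))
        ( IH
        , cross-bound₁ k {P = P ⁺} {Q ⁺} (trans n≡ (cong suc (sym (+-suc k t))))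
            (≤-trans (≤-trans (n≤1+n l) l<t) (n≤1+n t))
            (shifted⁺ {F = P} sP) (shifted⁺ {F = Q} sQ) (unif⁺ uP) (unif⁺ uQ) meets (♯-pos {F = P ⁺} x∈)
                (♯-pos {F = Q ⁺} y∈)
        , bin-pos (≤-trans (n≤1+n k) (≤-trans (n≤1+n l) l<t))
        , tt)

-- The first summand is deducted from the traces through the deleted point, the second from the
-- traces avoiding it.
Pascal : ∀ r t → loss (suc r) (suc t) ≡ loss r t + loss (suc r) t
Pascal r t = swap-inner (bin (suc t) (suc r)) (bin (suc t) (2 + r)) (bin t r) (bin t (suc r))

-- Estimates for the traces through the first point, to be added to the inductive bound for the
-- traces that avoid it.
module Level {n} k {t} (P Q : Fam (suc n)) (n≡ : n ≡ 3 + k + suc t) (k≤t : suc (suc k) ≤ t)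
             (sP : Shifted P) (sQ : Shifted Q) (uP : Unif (3 + k) P) (uQ : Unif (3 + k) Q)
             (c : Cross P Q) where

  r : ℕ
  r = suc (suc k)

  small : ∀ {a} → a ≤ suc r → r + a ≤ n
  small {a} p = ≤-trans (+-mono-≤ k≤t p) (≤-trans (≤-trans (≤-reflexive (+-comm t (suc r)))
      (+-monoʳ-≤ (suc r) (n≤1+n t))) (≤-reflexive (sym n≡)))

  <n : suc r < n
  <n = ≤-trans (≤-reflexive (+-comm 1 (suc r))) (≤-trans (+-monoʳ-≤ (suc r) (s≤s z≤n)) (≤-reflexive (sym n≡)))

  meets : ∀ x y → P ∋ true ∷ x → Q ∋ y → meet x (tail y) ≡ true
  meets x (b ∷ y) x∈ y∈ = cross-escape {F = P} b sP (λ z z∈ → c z (b ∷ y) z∈ y∈) x∈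
    (≤-trans (+-monoˡ-≤ _ (≤-reflexive (suc-injective (uP _ x∈)))) (small (≤-reflexive (uQ _ y∈))))

  one-sided : 2 ≤ ♯ (Q ⁻) → ♯ (P ⁺) + loss (suc k) t ≤ bin n r
  one-sided q⁻ =
    let x , y , x∈ , y∈ , x≢y = ♯-two (Q ⁻) q⁻
    in ♯-hits₂ {R = P ⁺} x≢y (co-size x n≡ (uQ _ x∈)) (co-size y n≡ (uQ _ y∈)) (unif⁺ uP)
         (λ z z∈ → c (true ∷ z) (false ∷ x) z∈ x∈) (λ z z∈ → c (true ∷ z) (false ∷ y) z∈ y∈)

  one-sided-strict : 3 ≤ ♯ (Q ⁻) → suc (♯ (P ⁺) + loss (suc k) t) ≤ bin n r
  one-sided-strict q⁻ =
    let x , y , z , x∈ , y∈ , z∈ , x≢y , x≢z , y≢z = ♯-three (Q ⁻) q⁻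
    in ♯-hits₃ {R = P ⁺} x≢y x≢z y≢z (co-size x n≡ (uQ _ x∈)) (co-size y n≡ (uQ _ y∈)) (co-size z n≡ (uQ _ z∈))
         (inj₁ (s≤s z≤n , <⇒≤ k≤t)) (unif⁺ uP)
         (λ w w∈ → c (true ∷ w) (false ∷ x) w∈ x∈) (λ w w∈ → c (true ∷ w) (false ∷ y) w∈ y∈)
             (λ w w∈ → c (true ∷ w) (false ∷ z) w∈ z∈)

  -- Only nonemptiness is inherited, so `cross-bound₁` is used; two steps of Pascal's rule split its
  -- deduction into the loss and `bin t k`. The latter is at least 2 for k ≥ 1 but equals 1 for k =
  -- 0, which is why pairs of 3-uniform families have exceptions.
  two-sided : 1 ≤ ♯ (P ⁺) → 1 ≤ ♯ (Q ⁺) → ♯ (P ⁺) + ♯ (Q ⁺) + loss (suc k) t + bin t k ≤ suc (bin n r)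
  two-sided p q =
    linear (♯ (P ⁺) ∷ ♯ (Q ⁺) ∷ bin t k ∷ bin t (suc k) ∷ bin (suc t) r ∷ bin n r ∷ [])
      ((x0 ⊕ x1 ⊕ (x2 ⊕ x3 ⊕ x4) ≼ con 1 ⊕ x5) ∷ []) (x0 ⊕ x1 ⊕ (x4 ⊕ x3) ⊕ x2) (con 1 ⊕ x5)
      ( cross-bound₁ (suc k) {P = P ⁺} {Q ⁺} (trans n≡ (cong (2 +_) (sym (+-suc k (suc t)))))
          (≤-trans k≤t (≤-trans (n≤1+n t) (n≤1+n _)))
          (shifted⁺ {F = P} sP) (shifted⁺ {F = Q} sQ) (unif⁺ uP) (unif⁺ uQ) (λ x y x∈ y∈ → meets x (true ∷ y) x∈ y∈)
              p q
      , tt)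

cross-bound₂ : ∀ k {t} {P Q : Fam n} → n ≡ 3 + k + suc t → suc (suc k) ≤ t → Shifted P → Shifted Q →
               Unif (3 + k) P → Unif (3 + k) Q → Cross P Q → 2 ≤ ♯ P → 2 ≤ ♯ Q →
               ♯ P + ♯ Q + loss (2 + k) t ≤ 2 + bin n (3 + k)
cross-bound₂ {n} k {t} {P} {Q} e le sP sQ uP uQ c p q with m≤n⇒m<n∨m≡n le
-- Here n is twice the size of the sets, and the loss 1 + 1 cancels the summand 2.
... | inj₂ refl = linear (♯ P ∷ ♯ Q ∷ bin (suc t) (suc t) ∷ bin t t ∷ bin n (suc t) ∷ [])
  ((x0 ⊕ x1 ≼ x4) ∷ (x2 ≼ con 1) ∷ (x3 ≼ con 1) ∷ []) (x0 ⊕ x1 ⊕ (x2 ⊕ x3)) (con 2 ⊕ x4)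
  (complement-bound P Q e uP uQ c , ≤-reflexive (bin-diag (suc t)) , ≤-reflexive (bin-diag t) , tt)
cross-bound₂ {suc n} k {suc t} {P} {Q} e le sP sQ uP uQ c p q | inj₁ (s≤s k<t) =
  subst (λ a → ♯ P + ♯ Q + a ≤ 2 + bin (suc n) (suc r)) (sym (Pascal (suc k) t))
    (linear (♯ (P ⁻) ∷ ♯ (P ⁺) ∷ ♯ (Q ⁻) ∷ ♯ (Q ⁺) ∷ loss (suc k) t ∷ loss r t ∷ bin n r ∷ bin n (suc r) ∷ [])
      ((x0 ⊕ x2 ⊕ x5 ≼ con 2 ⊕ x7) ∷ (x1 ⊕ x3 ⊕ x4 ≼ x6) ∷ [])
      (x0 ⊕ x1 ⊕ (x2 ⊕ x3) ⊕ (x4 ⊕ x5)) (con 2 ⊕ (x6 ⊕ x7))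
      ( cross-bound₂ k {P = P ⁻} {Q ⁻} n≡ k<t (shifted⁻ {F = P} sP) (shifted⁻ {F = Q} sQ) (unif⁻ uP) (unif⁻ uQ)
          (cross⁻ c) p⁻ q⁻
      , step (search (P ⁺)) (search (Q ⁺))
      , tt))
  where
  n≡ : n ≡ 3 + k + suc t
  n≡ = suc-injective (trans e (cong suc (cong (2 +_) (+-suc k (suc t)))))
  open Level k P Q n≡ k<t sP sQ uP uQ c
  module Swapped = Level k Q P n≡ k<t sQ sP uQ uP (Cross-sym {F = P} {Q} c)
  p⁻ = two⁻ {F = P} sP uP <n p
  q⁻ = two⁻ {F = Q} sQ uQ <n q
  step : _ → _ → ♯ (P ⁺) + ♯ (Q ⁺) + loss (suc k) t ≤ bin n r
  step _ (inj₂ none) = linear (♯ (P ⁺) ∷ ♯ (Q ⁺) ∷ loss (suc k) t ∷ bin n r ∷ [])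
    ((x0 ⊕ x2 ≼ x3) ∷ (x1 ≼ con 0) ∷ []) (x0 ⊕ x1 ⊕ x2) x3 (one-sided q⁻ , ≤-reflexive (♯-empty none) , tt)
  step (inj₂ none) _ = linear (♯ (P ⁺) ∷ ♯ (Q ⁺) ∷ loss (suc k) t ∷ bin n r ∷ [])
    ((x1 ⊕ x2 ≼ x3) ∷ (x0 ≼ con 0) ∷ []) (x0 ⊕ x1 ⊕ x2) x3 (Swapped.one-sided p⁻ , ≤-reflexive (♯-empty none) , tt)
  step (inj₁ (x , x∈)) (inj₁ (y , y∈)) = linear (♯ (P ⁺) ∷ ♯ (Q ⁺) ∷ loss (suc k) t ∷ bin n r ∷ bin t k ∷ [])
    ((x0 ⊕ x1 ⊕ x2 ⊕ x4 ≼ con 1 ⊕ x3) ∷ (con 1 ≼ x4) ∷ []) (x0 ⊕ x1 ⊕ x2) x3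
    ( two-sided (♯-pos {F = P ⁺} x∈) (♯-pos {F = Q ⁺} y∈)
    , bin-pos (≤-trans (n≤1+n k) (≤-trans (n≤1+n _) k<t))
    , tt)

-- Pairs of 3-uniform (or 2-uniform) families whose union with two new points
-- lies in a family of type 𝓖₂ or 𝓖₃
CommonPoint : Fam n → Fam n → Set
CommonPoint P Q = ∃[ y ] (∣ y ∣ ≡ 1 × Hits y P × Hits y Q)

CommonPair : Fam n → Fam n → Set
CommonPair P Q = ∃[ e ] (∣ e ∣ ≡ 2 × Hits e P × Contains e Q)

Exceptional : Fam n → Fam n → Set
Exceptional P Q = CommonPoint P Q ⊎ CommonPair P Q ⊎ CommonPair Q P

hits-∷ : ∀ {b} {x : Subset n} {F : Fam (suc n)} → (∀ a y → F ∋ a ∷ y → meet x y ≡ true) → Hits (b ∷ x) F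
hits-∷ {b = b} {x} h (a ∷ y) y∈ = ∨-injʳ {a ∧ b} (trans (meet-sym y x) (h a y y∈))

-- For 3-sets the surplus of `two-sided` vanishes, so the second point is split off as well.
module Three {n t} (P Q : Fam (2 + n)) (n≡ : suc n ≡ 3 + suc t) (le : 2 ≤ t)
             (sP : Shifted P) (sQ : Shifted Q) (uP : Unif 3 P) (uQ : Unif 3 Q) (c : Cross P Q)
             (p : 3 ≤ ♯ P) (q : 3 ≤ ♯ Q) where

  4≤n : 4 ≤ n
  4≤n = ≤-trans (s≤s (s≤s le)) (≤-trans (n≤1+n _) (≤-reflexive (sym (suc-injective n≡))))

  open Level 0 P Q n≡ le sP sQ uP uQ c
  module Swapped = Level 0 Q P n≡ le sQ sP uQ uP (Cross-sym {F = P} {Q} c)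

  meets₂ : ∀ x y → P ∋ true ∷ true ∷ x → Q ∋ y → meet x (tail (tail y)) ≡ true
  meets₂ x (a ∷ b ∷ y) x∈ y∈ = cross-escape₂ {F = P} a b sP uP (λ z z∈ → c z (a ∷ b ∷ y) z∈ y∈) x∈
    (≤-trans (+-mono-≤ (≤-reflexive (suc-injective (suc-injective (uP _ x∈)))) (≤-reflexive (uQ _ y∈))) 4≤n)

  hits-point : ∀ x → P ∋ true ∷ true ∷ x → Hits (false ∷ false ∷ x) Q
  hits-point x x∈ = hits-∷ {F = Q} λ { a (b ∷ y) y∈ → meets₂ x (a ∷ b ∷ y) x∈ y∈ }

  Strict : Set
  Strict = suc (♯ P + ♯ Q + loss 2 (suc t)) ≤ 2 + bin (2 + n) 3

  -- The limit 1 is what n = t + 3 affords: 1 for strictness, 1 from `cross-bound₁`, 1 for the sets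
  -- through both points, and t from the loss.
  count : ♯ (P ⁺ ⁺) + ♯ (Q ⁺ ⁺) ≤ 1 → 1 ≤ ♯ (P ⁺) → 1 ≤ ♯ (Q ⁺) → Strict
  count few p⁺ q⁺ =
    linear (♯ (P ⁻) ∷ ♯ (P ⁺ ⁻) ∷ ♯ (P ⁺ ⁺) ∷ ♯ (Q ⁻) ∷ ♯ (Q ⁺ ⁻) ∷ ♯ (Q ⁺ ⁺) ∷ loss 2 t ∷ bin (suc t) 2 ∷ t ∷ loss 2
        (suc t) ∷ bin n 2 ∷ bin (suc n) 3 ∷ bin n 1 ∷ [])
      ( (x0 ⊕ x3 ⊕ x6 ≼ con 2 ⊕ x11) ∷ (x1 ⊕ x4 ⊕ x7 ≼ con 1 ⊕ x10) ∷ (x2 ⊕ x5 ≼ con 1)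
      ∷ (x9 ≼ x7 ⊕ x8 ⊕ x6) ∷ (con 3 ⊕ x8 ≼ x12) ∷ [])
      (con 1 ⊕ (x0 ⊕ (x1 ⊕ x2) ⊕ (x3 ⊕ (x4 ⊕ x5)) ⊕ x9)) (con 2 ⊕ ((x12 ⊕ x10) ⊕ x11))
      ( cross-bound₂ 0 {P = P ⁻} {Q ⁻} n≡ le (shifted⁻ {F = P} sP) (shifted⁻ {F = Q} sQ) (unif⁻ uP) (unif⁻ uQ)
          (cross⁻ c)
          (two⁻ {F = P} sP uP <n (<⇒≤ p)) (two⁻ {F = Q} sQ uQ <n (<⇒≤ q))
      , cross-bound₁ 1 {t = suc t} {P = P ⁺ ⁻} {Q ⁺ ⁻} (suc-injective n≡) (≤-trans le (n≤1+n t))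
          (shifted⁻ {F = P ⁺} sP⁺) (shifted⁻ {F = Q ⁺} sQ⁺) (unif⁻ (unif⁺ uP)) (unif⁻ (unif⁺ uQ))
              (λ x y x∈ y∈ → meets (false ∷ x) (true ∷ false ∷ y) x∈ y∈)
          (nonempty⁻ {F = P ⁺} sP⁺ (unif⁺ uP) 2≤n p⁺) (nonempty⁻ {F = Q ⁺} sQ⁺ (unif⁺ uQ) 2≤n q⁺)
      , few
      , ≤-reflexive (trans (Pascal 1 t) (cong (λ a → bin (suc t) 2 + a + loss 2 t) (bin-1 t)))
      , ≤-reflexive (trans (sym (suc-injective n≡)) (sym (bin-1 n)))
      , tt)
    where
    sP⁺ = shifted⁺ {F = P} sP
    sQ⁺ = shifted⁺ {F = Q} sQ
    2≤n : 2 ≤ n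
    2≤n = ≤-trans (s≤s (s≤s z≤n)) 4≤n

  -- If a member z of Q omits a point of the pair, every singleton in `P ⁺ ⁺` has to meet both the
  -- pair and z, hence is the other point of the pair; then `count` applies.
  pair : ∀ e → Q ∋ true ∷ e → 1 ≤ ♯ (P ⁺) → (∀ y → Q (true ∷ true ∷ y) ≡ false) → Strict ⊎ CommonPair P Q
  pair (true ∷ e) e∈ p⁺ none = ⊥-elim (true≢false e∈ (none e))
  pair (false ∷ e) e∈ p⁺ none with search (λ z → Q z ∧ not (sub (false ∷ false ∷ e) z))
  ... | inj₂ all = inj₂ (false ∷ false ∷ e , suc-injective (uQ _ e∈) , hits-∷
      (λ a y y∈ → Swapped.meets (false ∷ e) (a ∷ y) e∈ y∈) ,
          λ x x∈ → not-false λ f → true≢false (∧-intro x∈ (cong not f)) (all x))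
  ... | inj₁ (a ∷ b ∷ z , w) =
    let z∈ , z⊉ = ∧-true {Q (a ∷ b ∷ z)} w
        y , e′ , sy , e≡ , se , miss , _ = missing e z (not-true z⊉)
        few : ♯ (P ⁺ ⁺) ≤ 1
        few = ≤-trans (♯-w1 {F = P ⁺ ⁺} {e′} (unif⁺ (unif⁺ uP)) λ x x∈ →
                case ∨-true (trans (sym (meet-∪ x e′ y))
                    (subst (λ a → meet x a ≡ true) e≡ (meets₂ x (true ∷ false ∷ e) x∈ e∈))) of λ
                  { (inj₁ m) → m
                  ; (inj₂ m) → ⊥-elim (true≢false (meets₂ x (a ∷ b ∷ z) x∈ z∈)
                      (trans (cong (λ v → meet v z) (meet-singletons x y (suc-injective (suc-injective (uP _ x∈))) sy
                          m)) miss)) })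
              (≤-reflexive (suc-injective (trans (sym se) (suc-injective (uQ _ e∈)))))
    in inj₁ (count (≤-trans (+-mono-≤ few (≤-reflexive (♯-empty {F = Q ⁺ ⁺} none))) (≤-reflexive (+-identityʳ 1))) p⁺
        (♯-pos {F = Q ⁺} {false ∷ e} e∈))

module StrictBound {n k t} (P Q : Fam (suc n)) (n≡ : n ≡ 3 + k + suc t) (k≤t : suc (suc k) ≤ t)
             (sP : Shifted P) (sQ : Shifted Q) (uP : Unif (3 + k) P) (uQ : Unif (3 + k) Q)
             (c : Cross P Q) (p : 3 ≤ ♯ P) (q : 3 ≤ ♯ Q) where

  open Level k P Q n≡ k≤t sP sQ uP uQ c
  module Swapped = Level k Q P n≡ k≤t sQ sP uQ uP (Cross-sym {F = P} {Q} c)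

  Strict : Set
  Strict = suc (♯ P + ♯ Q + loss r (suc t)) ≤ 2 + bin (suc n) (suc r)

  strict : suc (♯ (P ⁺) + ♯ (Q ⁺) + loss (suc k) t) ≤ bin n r → Strict
  strict h = subst (λ a → suc (♯ P + ♯ Q + a) ≤ 2 + bin (suc n) (suc r)) (sym (Pascal (suc k) t))
    (linear (♯ (P ⁻) ∷ ♯ (P ⁺) ∷ ♯ (Q ⁻) ∷ ♯ (Q ⁺) ∷ loss (suc k) t ∷ loss r t ∷ bin n r ∷ bin n (suc r) ∷ [])
      ((x0 ⊕ x2 ⊕ x5 ≼ con 2 ⊕ x7) ∷ (con 1 ⊕ (x1 ⊕ x3 ⊕ x4) ≼ x6) ∷ [])
      (con 1 ⊕ (x0 ⊕ x1 ⊕ (x2 ⊕ x3) ⊕ (x4 ⊕ x5))) (con 2 ⊕ (x6 ⊕ x7))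
      ( cross-bound₂ k {P = P ⁻} {Q ⁻} n≡ k≤t (shifted⁻ {F = P} sP) (shifted⁻ {F = Q} sQ) (unif⁻ uP) (unif⁻ uQ)
          (cross⁻ c)
          (two⁻ {F = P} sP uP <n (<⇒≤ p)) (two⁻ {F = Q} sQ uQ <n (<⇒≤ q))
      , h , tt))

  all⁻ : {F : Fam (suc n)} → (∀ x → (F ⁺) x ≡ false) → 3 ≤ ♯ F → 3 ≤ ♯ (F ⁻)
  all⁻ {F} none f = ≤-trans f (≤-reflexive (trans (cong (♯ (F ⁻) +_) (♯-empty none)) (+-identityʳ _)))

  Outcome : Set
  Outcome = Strict ⊎ (k ≡ 0 × ∃[ x ] (P ∋ true ∷ x × ∃[ y ] Q ∋ true ∷ y))

  dichotomy : Outcome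
  dichotomy with search (P ⁺) | search (Q ⁺)
  ... | _ | inj₂ none = inj₁ (strict (linear (♯ (P ⁺) ∷ ♯ (Q ⁺) ∷ loss (suc k) t ∷ bin n r ∷ [])
    ((con 1 ⊕ (x0 ⊕ x2) ≼ x3) ∷ (x1 ≼ con 0) ∷ []) (con 1 ⊕ (x0 ⊕ x1 ⊕ x2)) x3
        (one-sided-strict (all⁻ {Q} none q) , ≤-reflexive (♯-empty none) , tt)))
  ... | inj₂ none | inj₁ _ = inj₁ (strict (linear (♯ (P ⁺) ∷ ♯ (Q ⁺) ∷ loss (suc k) t ∷ bin n r ∷ [])
    ((con 1 ⊕ (x1 ⊕ x2) ≼ x3) ∷ (x0 ≼ con 0) ∷ []) (con 1 ⊕ (x0 ⊕ x1 ⊕ x2)) x3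
        (Swapped.one-sided-strict (all⁻ {P} none p) , ≤-reflexive (♯-empty none) , tt)))
  ... | inj₁ (x , x∈) | inj₁ (y , y∈) = go k refl
    where
    go : ∀ j → j ≡ k → Outcome
    go zero    refl = inj₂ (refl , x , x∈ , y , y∈)
    go (suc j) refl = inj₁ (strict (linear (♯ (P ⁺) ∷ ♯ (Q ⁺) ∷ loss (suc k) t ∷ bin n r ∷ bin t k ∷ [])
      ((x0 ⊕ x1 ⊕ x2 ⊕ x4 ≼ con 1 ⊕ x3) ∷ (con 2 ≼ x4) ∷ []) (con 1 ⊕ (x0 ⊕ x1 ⊕ x2)) x3
      (two-sided (♯-pos {F = P ⁺} x∈) (♯-pos {F = Q ⁺} y∈) , bin-≥2 (≤-trans (n≤1+n _) k≤t) , tt)))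

cross-strict : ∀ k {t} {P Q : Fam n} → n ≡ 3 + k + suc t → suc (suc k) < t → Shifted P → Shifted Q →
               Unif (3 + k) P → Unif (3 + k) Q → Cross P Q → 3 ≤ ♯ P → 3 ≤ ♯ Q →
               suc (♯ P + ♯ Q + loss (2 + k) t) ≤ 2 + bin n (3 + k) ⊎ (k ≡ 0 × Exceptional P Q)
cross-strict {suc n} k {suc t} {P} {Q} e (s≤s k<t) sP sQ uP uQ c p q = conclude
    (StrictBound.dichotomy P Q n≡ k<t sP sQ uP uQ c p q)
  where
  n≡ : n ≡ 3 + k + suc t
  n≡ = suc-injective (trans e (cong suc (cong (2 +_) (+-suc k (suc t)))))
  conclude : StrictBound.Outcome P Q n≡ k<t sP sQ uP uQ c p q →
             suc (♯ P + ♯ Q + loss (2 + k) (suc t)) ≤ 2 + bin (suc n) (3 + k) ⊎ (k ≡ 0 × Exceptional P Q)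
  conclude (inj₁ s) = inj₁ s
  conclude (inj₂ (refl , x , x∈ , y , y∈)) = three n n≡ P Q sP sQ uP uQ c p q x x∈ y y∈
    where
    three : ∀ n → n ≡ 3 + suc t → (P Q : Fam (suc n)) → Shifted P → Shifted Q → Unif 3 P → Unif 3 Q → Cross P Q →
        3 ≤ ♯ P → 3 ≤ ♯ Q →
            ∀ x → P ∋ true ∷ x → ∀ y → Q ∋ true ∷ y →
            suc (♯ P + ♯ Q + loss 2 (suc t)) ≤ 2 + bin (suc n) 3 ⊎ (0 ≡ 0 × Exceptional P Q)
    three (suc n) n≡ P Q sP sQ uP uQ c p q x x∈ y y∈ with search (P ⁺ ⁺) | search (Q ⁺ ⁺)
    -- The third point of a member through the first two points hits the whole opposite family. The
    -- third points a and b must meet each other, so they are the same common point.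
    ... | inj₁ (a , a∈) | inj₁ (b , b∈) = inj₂ (refl , inj₁
        (false ∷ false ∷ a , suc-injective (suc-injective (uP _ a∈)) ,
            subst (λ v → Hits (false ∷ false ∷ v) P) (sym a≡b) (S.hits-point b b∈) , T.hits-point a a∈))
      where
      module T = Three P Q n≡ k<t sP sQ uP uQ c p q
      module S = Three Q P n≡ k<t sQ sP uQ uP (Cross-sym {F = P} {Q} c) q p
      a≡b : a ≡ b
      a≡b = meet-singletons a b (suc-injective (suc-injective (uP _ a∈))) (suc-injective (suc-injective (uQ _ b∈)))
          (T.meets₂ a (true ∷ true ∷ b) a∈ b∈)
    ... | _ | inj₂ none = case Three.pair P Q n≡ k<t sP sQ uP uQ c p q y y∈ (♯-pos {F = P ⁺} x∈) none of λ
      { (inj₁ s) → inj₁ s ; (inj₂ w) → inj₂ (refl , inj₂ (inj₁ w)) }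
    ... | inj₂ none | inj₁ _ = case Three.pair Q P n≡ k<t sQ sP uQ uP (Cross-sym {F = P} {Q} c) q p x x∈
        (♯-pos {F = Q ⁺} y∈) none of λ
      { (inj₁ s) → inj₁ (subst (λ a → suc (a + loss 2 (suc t)) ≤ 2 + bin (2 + n) 3) (+-comm (♯ Q) (♯ P)) s) ;
          (inj₂ w) → inj₂ (refl , inj₂ (inj₂ w)) }

-- Cross-intersecting graphs, for k = 3

♯-⁻ : (F : Fam (suc n)) → (∀ x → (F ⁺) x ≡ false) → ♯ F ≡ ♯ (F ⁻)
♯-⁻ F none = trans (cong (♯ (F ⁻) +_) (♯-empty none)) (+-identityʳ _)

-- The edge through the first point forces y to hit Q. An edge x of P avoiding y would leave only
-- the two edges between y and x for Q, which has three.
cross-point : (P Q : Fam (suc n)) → 3 ≤ n → Shifted P → Unif 2 P → Unif 2 Q → Cross P Q → 3 ≤ ♯ Q → ∀ y →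
    P ∋ true ∷ y → CommonPoint P Q
cross-point P Q 3≤n sP uP uQ c q y y∈ = false ∷ y , sy , (λ x x∈ → not-false λ f → contradiction
    (≤-trans q (≤-trans (♯-w2 {F = Q} {false ∷ y} {x} (trans (meet-sym (false ∷ y) x) f) uQ hitsQ λ z z∈ → trans
        (meet-sym z x) (c x z x∈ z∈))
      (≤-reflexive (cong₂ _*_ sy (uP x x∈))))) λ { (s≤s (s≤s ())) }) , hitsQ
  where
  sy : ∣ y ∣ ≡ 1
  sy = suc-injective (uP _ y∈)
  hitsQ : Hits (false ∷ y) Q
  hitsQ = hits-∷ {F = Q} λ b z z∈ → cross-escape {F = P} b sP (λ w w∈ → c w (b ∷ z) w∈ z∈) y∈
    (≤-trans (+-mono-≤ (≤-reflexive sy) (≤-reflexive (uQ _ z∈))) 3≤n)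

-- Points used by neither graph are deleted until a used one is found or four points remain; 6 is
-- the number of edges on four points.
cross-graphs : ∀ d {P Q : Fam n} → n ≡ 4 + d → Shifted P → Shifted Q → Unif 2 P → Unif 2 Q → Cross P Q → 3 ≤ ♯ P →
    3 ≤ ♯ Q →
               ♯ P + ♯ Q ≤ 6 ⊎ CommonPoint P Q
cross-graphs zero {P} {Q} refl sP sQ uP uQ c p q = inj₁ (complement-bound P Q refl uP uQ c)
cross-graphs {suc n} (suc d) {P} {Q} e sP sQ uP uQ c p q with search (P ⁺) | search (Q ⁺)
... | inj₁ (y , y∈) | _ = inj₂ (cross-point P Q 3≤n sP uP uQ c q y y∈)
  where
  3≤n = ≤-trans (s≤s (s≤s (s≤s z≤n))) (≤-reflexive (sym (suc-injective e)))
... | inj₂ _ | inj₁ (y , y∈) = inj₂ (swap (cross-point Q P 3≤n sQ uQ uP (Cross-sym {F = P} {Q} c) p y y∈))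
  where
  3≤n = ≤-trans (s≤s (s≤s (s≤s z≤n))) (≤-reflexive (sym (suc-injective e)))
  swap : CommonPoint Q P → CommonPoint P Q
  swap (y , s , a , b) = y , s , b , a
... | inj₂ noP | inj₂ noQ with cross-graphs d {P ⁻} {Q ⁻} (suc-injective e) (shifted⁻ {F = P} sP)
    (shifted⁻ {F = Q} sQ) (unif⁻ uP) (unif⁻ uQ) (cross⁻ c)
                       (≤-trans p (≤-reflexive (♯-⁻ P noP))) (≤-trans q (≤-reflexive (♯-⁻ Q noQ)))
...   | inj₁ h = inj₁ (≤-trans (≤-reflexive (cong₂ _+_ (♯-⁻ P noP) (♯-⁻ Q noQ))) h)
...   | inj₂ (y , s , a , b) = inj₂ (false ∷ y , s , lift P noP a , lift Q noQ b)
  where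
  lift : (F : Fam (suc n)) → (∀ x → (F ⁺) x ≡ false) → Hits y (F ⁻) → Hits (false ∷ y) F
  lift F none h (true ∷ x)  x∈ = ⊥-elim (true≢false x∈ (none x))
  lift F none h (false ∷ x) x∈ = h x x∈

-- Counting members that contain a given set

sub-size : (c x : Subset n) → sub c x ≡ true → ∣ c ∣ ≤ ∣ x ∣
sub-size []          []          p = z≤n
sub-size (true ∷ c)  (true ∷ x)  p = s≤s (sub-size c x p)
sub-size (false ∷ c) (true ∷ x)  p = m≤n⇒m≤1+n (sub-size c x p)
sub-size (false ∷ c) (false ∷ x) p = sub-size c x p

contains⁻ : {c : Subset n} {F : Fam (suc n)} → Contains (false ∷ c) F → Contains c (F ⁻)
contains⁻ h x = h (false ∷ x)

contains⁺ : ∀ {b} {c : Subset n} {F : Fam (suc n)} → Contains (b ∷ c) F → Contains c (F ⁺)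
contains⁺ {b = true}  h x = h (true ∷ x)
contains⁺ {b = false} h x = h (true ∷ x)

contains⁻-none : {c : Subset n} {F : Fam (suc n)} → Contains (true ∷ c) F → ∀ x → (F ⁻) x ≡ false
contains⁻-none h x = ¬true λ p → case h (false ∷ x) p of λ ()

too-small : ∀ {b} {c : Subset n} {F : Fam (suc n)} → Unif (∣ c ∣ + 0) F → Contains (b ∷ c) F → ∀ x → (F ⁺) x ≡ false
too-small {c = c} {F} u h x = ¬true λ p → contradiction
  (≤-trans (s≤s (sub-size c x (contains⁺ {F = F} h x p))) (≤-reflexive (trans (u _ p) (+-identityʳ _)))) 1+n≰n

unif-+ : ∀ {s j} {F : Fam (suc n)} → Unif (s + suc j) F → Unif (s + j) (F ⁺)
unif-+ {s = s} {j} u x p = suc-injective (trans (u _ p) (+-suc s j))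

♯-contains : ∀ j {c : Subset n} {F : Fam n} → Unif (∣ c ∣ + j) F → Contains c F → ♯ F ≤ bin (co c) j
♯-contains j {[]} {F} u h = ♯-unif F u
♯-contains j {true ∷ c} {F} u h =
  ≤-trans (≤-reflexive (cong (_+ ♯ (F ⁺)) (♯-empty (contains⁻-none h))))
      (♯-contains j {c} {F ⁺} (unif⁺ u) (contains⁺ {F = F} h))
♯-contains zero {false ∷ c} {F} u h =
  ≤-trans (≤-reflexive (trans (cong (♯ (F ⁻) +_) (♯-empty (too-small {F = F} u h))) (+-identityʳ _)))
      (♯-contains 0 {c} {F ⁻} (unif⁻ u) (contains⁻ h))
♯-contains (suc j) {false ∷ c} {F} u h =
  ≤-trans (+-mono-≤ (♯-contains (suc j) {c} {F ⁻} (unif⁻ u) (contains⁻ h))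
      (♯-contains j {c} {F ⁺} (unif-+ {s = ∣ c ∣} {F = F} u) (contains⁺ {F = F} h)))
          (≤-reflexive (+-comm (bin (co c) (suc j)) _))

♯-contains-hits : ∀ j {c a : Subset n} {F : Fam n} → meet c a ≡ false → Unif (∣ c ∣ + j) F → Contains c F → Hits a F →
                  ♯ F + bin (co (c ∪ a)) j ≤ bin (co c) j
♯-contains-hits j {[]} {[]} {F} d u h g = ≤-reflexive (cong (_+ bin 0 j) (♯-hits-empty {F = F} refl g))
♯-contains-hits j {true ∷ c} {false ∷ a} {F} d u h g =
  ≤-trans (≤-reflexive (cong (λ b → b + ♯ (F ⁺) + bin (co (c ∪ a)) j) (♯-empty (contains⁻-none h))))
          (♯-contains-hits j {c} {a} {F ⁺} d (unif⁺ u) (contains⁺ {F = F} h) (hits⁺ g))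
♯-contains-hits zero {false ∷ c} {b ∷ a} {F} d u h g =
  ≤-trans (≤-reflexive (cong (_+ 1) (trans (cong (♯ (F ⁻) +_) (♯-empty (too-small {F = F} u h))) (+-identityʳ _))))
          (♯-contains-hits 0 {c} {a} {F ⁻} d (unif⁻ u) (contains⁻ h) (hits⁻ g))
♯-contains-hits (suc j) {false ∷ c} {true ∷ a} {F} d u h g =
  linear (♯ (F ⁻) ∷ ♯ (F ⁺) ∷ bin (co (c ∪ a)) (suc j) ∷ bin (co c) j ∷ bin (co c) (suc j) ∷ [])
    ((x0 ⊕ x2 ≼ x4) ∷ (x1 ≼ x3) ∷ []) (x0 ⊕ x1 ⊕ x2) (x3 ⊕ x4)
    ( ♯-contains-hits (suc j) {c} {a} {F ⁻} d (unif⁻ u) (contains⁻ h) (hits⁻ g)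
    , ♯-contains j {c} {F ⁺} (unif-+ {s = ∣ c ∣} {F = F} u) (contains⁺ {F = F} h) , tt)
♯-contains-hits (suc j) {false ∷ c} {false ∷ a} {F} d u h g =
  linear (♯ (F ⁻) ∷ ♯ (F ⁺) ∷ bin (co (c ∪ a)) (suc j) ∷ bin (co (c ∪ a)) j ∷ bin (co c) j ∷ bin (co c) (suc j) ∷ [])
    ((x0 ⊕ x2 ≼ x5) ∷ (x1 ⊕ x3 ≼ x4) ∷ []) (x0 ⊕ x1 ⊕ (x3 ⊕ x2)) (x4 ⊕ x5)
    ( ♯-contains-hits (suc j) {c} {a} {F ⁻} d (unif⁻ u) (contains⁻ h) (hits⁻ g)
    , ♯-contains-hits j {c} {a} {F ⁺} d (unif-+ {s = ∣ c ∣} {F = F} u) (contains⁺ {F = F} h) (hits⁺ g) , tt)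

-- The traces of a shifted intersecting (l+1)-uniform family on the points
-- other than the most preferred one: A comes from the members through it.
record Link {n} (l : ℕ) (A B : Fam n) : Set where
  field
    sA     : Shifted A
    sB     : Shifted B
    uA     : Unif l A
    uB     : Unif (suc l) B
    cAB    : Cross A B
    cBB    : Cross B B
    shadow : ∀ x y → ∣ y ∣ ≡ 1 → meet x y ≡ false → B ∋ (x ∪ y) → A ∋ x

open Link

-- Shifted intersecting families, seen from the most preferred point

link⁻ : ∀ {l} {A B : Fam (suc n)} → Link l A B → Link l (A ⁻) (B ⁻)
link⁻ {A = A} {B} L = record
  { sA = shifted⁻ {F = A} (sA L) ; sB = shifted⁻ {F = B} (sB L) ; uA = unif⁻ (uA L) ; uB = unif⁻ (uB L)
  ; cAB = cross⁻ (cAB L) ; cBB = cross⁻ (cBB L) ; shadow = λ x y → shadow L (false ∷ x) (false ∷ y) }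

-- The size condition is the one `cross-escape` requires for B against itself, the more demanding of
-- its two uses.
link⁺ : ∀ {l} {A B : Fam (suc n)} → Link (suc l) A B → suc l + suc (suc l) ≤ n → Link l (A ⁺) (B ⁺)
link⁺ {l = l} {A} {B} L le = record
  { sA = shifted⁺ {F = A} (sA L) ; sB = shifted⁺ {F = B} (sB L) ; uA = unif⁺ (uA L) ; uB = unif⁺ (uB L)
  ; cAB = λ x y x∈ y∈ → cross-escape {F = A} true (sA L) (λ z z∈ → cAB L z (true ∷ y) z∈ y∈) x∈
      (≤-trans (+-mono-≤ (≤-reflexive (suc-injective (uA L _ x∈))) (≤-reflexive (uB L _ y∈))) (<⇒≤ le))
  ; cBB = λ x y x∈ y∈ → cross-escape {F = B} true (sB L) (λ z z∈ → cBB L z (true ∷ y) z∈ y∈) x∈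
      (≤-trans (+-mono-≤ (≤-reflexive (suc-injective (uB L _ x∈))) (≤-reflexive (uB L _ y∈))) le)
  ; shadow = λ x y → shadow L (true ∷ x) (false ∷ y) }

link-0 : {A B : Fam n} → Link 0 A B → ∀ x → B x ≡ false
link-0 {B = B} L x = ¬true λ p → true≢false
  (cAB L empty x (shadow L empty x (uB L x p) (∅-meet x) (subst (B ∋_) (sym (∅-∪ x)) p)) p) (∅-meet x)

-- This is the Hilton-Milner bound for a shifted family of (l + 1)-sets on n + 1 points:
-- nonemptiness of B says that the most preferred point is not common to all members.
link-bound₁ : ∀ l {t} {A B : Fam n} → n ≡ suc l + t → l ≤ t → Link l A B → 1 ≤ ♯ B →
              ♯ A + ♯ B + bin t l ≤ suc (bin n l)
link-bound₁ {n} l {t} {A} {B} e le L b with m≤n⇒m<n∨m≡n le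
... | inj₂ refl = linear (♯ A ∷ ♯ B ∷ bin t t ∷ bin n t ∷ [])
  ((x0 ⊕ x1 ≼ x3) ∷ (x2 ≼ con 1) ∷ []) (x0 ⊕ x1 ⊕ x2) (con 1 ⊕ x3)
  (complement-bound A B (trans e (sym (+-suc t t))) (uA L) (uB L) (cAB L) , ≤-reflexive (bin-diag t) , tt)
link-bound₁ zero {B = B} e le L b | inj₁ _ = contradiction (≤-trans b (≤-reflexive (♯-empty (link-0 L)))) λ ()
link-bound₁ {suc n} (suc l) {suc t} {A} {B} e le L b | inj₁ (s≤s l<t) = main (search (B ⁺))
  where
  n≡ : n ≡ 2 + l + t
  n≡ = suc-injective (trans e (cong (2 +_) (+-suc l t)))
  b⁻ : 1 ≤ ♯ (B ⁻)
  b⁻ = nonempty⁻ {F = B} (sB L) (uB L) (≤-trans (m≤m+n (2 + l) t) (≤-reflexive (sym n≡))) b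
  IH : ♯ (A ⁻) + ♯ (B ⁻) + bin t (suc l) ≤ suc (bin n (suc l))
  IH = link-bound₁ (suc l) n≡ l<t (link⁻ L) b⁻
  room : suc l + suc (suc l) ≤ n
  room = ≤-trans (≤-reflexive (+-comm (suc l) (2 + l))) (≤-trans (+-monoʳ-≤ (2 + l) l<t) (≤-reflexive (sym n≡)))
  main : _ → ♯ A + ♯ B + bin (suc t) (suc l) ≤ suc (bin (suc n) (suc l))
  main (inj₂ none) =
    let x , x∈ = ♯-member (B ⁻) b⁻
    in linear (♯ (A ⁻) ∷ ♯ (A ⁺) ∷ ♯ (B ⁻) ∷ ♯ (B ⁺) ∷ bin t l ∷ bin t (suc l) ∷ bin n l ∷ bin n (suc l) ∷ [])
      ((x0 ⊕ x2 ⊕ x5 ≼ con 1 ⊕ x7) ∷ (x1 ⊕ x4 ≼ x6) ∷ (x3 ≼ con 0) ∷ [])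
      (x0 ⊕ x1 ⊕ (x2 ⊕ x3) ⊕ (x4 ⊕ x5)) (con 1 ⊕ (x6 ⊕ x7))
      ( IH
      , subst (λ a → ♯ (A ⁺) + bin a l ≤ bin n l) (co-size x n≡ (uB L _ x∈))
          (♯-hits {R = A ⁺} {x} (unif⁺ (uA L)) λ y y∈ → cAB L (true ∷ y) (false ∷ x) y∈ x∈)
      , ≤-reflexive (♯-empty none) , tt)
  main (inj₁ (x , x∈)) = both l refl
    where
    both : ∀ k → k ≡ l → ♯ A + ♯ B + bin (suc t) (suc l) ≤ suc (bin (suc n) (suc l))
    both zero    refl = ⊥-elim (true≢false x∈ (link-0 (link⁺ L room) x))
    both (suc k) refl =
      linear (♯ (A ⁻) ∷ ♯ (A ⁺) ∷ ♯ (B ⁻) ∷ ♯ (B ⁺) ∷ bin t l ∷ bin t (suc l) ∷ bin n l ∷ bin n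
          (suc l) ∷ bin t k ∷ [])
        ((x0 ⊕ x2 ⊕ x5 ≼ con 1 ⊕ x7) ∷ (x1 ⊕ x3 ⊕ (x8 ⊕ x4) ≼ con 1 ⊕ x6) ∷ (con 1 ≼ x8) ∷ [])
        (x0 ⊕ x1 ⊕ (x2 ⊕ x3) ⊕ (x4 ⊕ x5)) (con 1 ⊕ (x6 ⊕ x7))
        ( IH
        , link-bound₁ l (trans n≡ (cong suc (sym (+-suc l t)))) (≤-trans (n≤1+n l) (≤-trans l<t (n≤1+n t)))
            (link⁺ L room) (♯-pos {F = B ⁺} x∈)
        , bin-pos (≤-trans (n≤1+n k) (≤-trans (n≤1+n l) l<t))
        , tt)

-- Together with the most preferred point, e spans a family of type 𝓖₂ or 𝓖₃.
Spanned : ℕ → Fam n → Fam n → Set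
Spanned s A B = ∃[ e ] (∣ e ∣ ≡ s × Hits e A × Contains e B)

hits-∷∷ : ∀ {b c} {x : Subset n} {F : Fam (2 + n)} → (∀ a b y → F ∋ a ∷ b ∷ y → meet x y ≡ true) → Hits (b ∷ c ∷ x) F
hits-∷∷ {b = b} {c} {x} h (a ∷ d ∷ y) y∈ = ∨-injʳ {a ∧ b} (∨-injʳ {d ∧ c} (trans (meet-sym y x) (h a d y y∈)))

contains-or : (e : Subset n) (F : Fam n) → (∃[ q ] (F ∋ q × sub e q ≡ false)) ⊎ Contains e F
contains-or e F with search (λ q → F q ∧ not (sub e q))
... | inj₁ (q , p) = inj₁ (q , proj₁ (∧-true {F q} p) , not-true (proj₂ (∧-true {F q} p)))
... | inj₂ none    = inj₂ λ x x∈ → not-false λ f → true≢false (∧-intro x∈ (cong not f)) (none x)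

module LinkLevel {n} k {t} (A B : Fam (suc n)) (n≡ : n ≡ 4 + k + suc t) (k≤t : suc (suc k) ≤ t)
                 (L : Link (3 + k) A B) where

  r : ℕ
  r = suc (suc k)

  room : ∀ {a b} → a ≤ suc r → b ≤ 2 + r → a + b ≤ n
  room p q = ≤-trans (+-mono-≤ p q) (≤-trans (≤-reflexive (+-comm (suc r) (2 + r)))
               (≤-trans (+-monoʳ-≤ (2 + r) (s≤s k≤t)) (≤-reflexive (sym n≡))))

  <n : suc (suc r) < n
  <n = ≤-trans (≤-reflexive (+-comm 1 (2 + r))) (≤-trans (+-monoʳ-≤ (2 + r) (s≤s z≤n)) (≤-reflexive (sym n≡)))

  L⁺ : Link r (A ⁺) (B ⁺)
  L⁺ = link⁺ L (room ≤-refl ≤-refl)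

  IH-room : n ≡ suc r + suc (suc t)
  IH-room = trans n≡ (sym (+-suc (suc r) (suc t)))

  one-sided : 2 ≤ ♯ (B ⁻) → ♯ (A ⁺) + loss (suc k) t ≤ bin n r
  one-sided b =
    let x , y , x∈ , y∈ , x≢y = ♯-two (B ⁻) b
    in ♯-hits₂ {R = A ⁺} x≢y (co-size x n≡ (uB L _ x∈)) (co-size y n≡ (uB L _ y∈)) (unif⁺ (uA L))
         (λ z z∈ → cAB L (true ∷ z) (false ∷ x) z∈ x∈) (λ z z∈ → cAB L (true ∷ z) (false ∷ y) z∈ y∈)

  one-sided-strict : 3 ≤ ♯ (B ⁻) → suc (♯ (A ⁺) + loss (suc k) t) ≤ bin n r
  one-sided-strict b =
    let x , y , z , x∈ , y∈ , z∈ , x≢y , x≢z , y≢z = ♯-three (B ⁻) b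
    in ♯-hits₃ {R = A ⁺} x≢y x≢z y≢z (co-size x n≡ (uB L _ x∈)) (co-size y n≡ (uB L _ y∈)) (co-size z n≡ (uB L _ z∈))
         (inj₁ (s≤s z≤n , <⇒≤ k≤t)) (unif⁺ (uA L))
         (λ w w∈ → cAB L (true ∷ w) (false ∷ x) w∈ x∈) (λ w w∈ → cAB L (true ∷ w) (false ∷ y) w∈ y∈)
             (λ w w∈ → cAB L (true ∷ w) (false ∷ z) w∈ z∈)

  two-sided : 1 ≤ ♯ (B ⁺) → ♯ (A ⁺) + ♯ (B ⁺) + loss (suc k) t + bin t k ≤ suc (bin n r)
  two-sided b =
    linear (♯ (A ⁺) ∷ ♯ (B ⁺) ∷ bin t k ∷ bin t (suc k) ∷ bin (suc t) r ∷ bin n r ∷ [])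
      ((x0 ⊕ x1 ⊕ (x2 ⊕ x3 ⊕ x4) ≼ con 1 ⊕ x5) ∷ []) (x0 ⊕ x1 ⊕ (x4 ⊕ x3) ⊕ x2) (con 1 ⊕ x5)
      (link-bound₁ r IH-room (≤-trans k≤t (≤-trans (n≤1+n t) (n≤1+n _))) L⁺ b , tt)

-- Two members of B suffice: they constrain `A ⁺` when `B ⁺` is empty, and otherwise the
-- Hilton-Milner bound for the smaller link leaves the surplus `bin t k`.
link-bound₂ : ∀ k {t} {A B : Fam n} → n ≡ 4 + k + suc t → suc (suc k) ≤ t →
              Link (3 + k) A B → 2 ≤ ♯ B → ♯ A + ♯ B + loss (2 + k) t ≤ 2 + bin n (3 + k)
link-bound₂ {n} k {t} {A} {B} e le L b with m≤n⇒m<n∨m≡n le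
... | inj₂ refl = linear (♯ A ∷ ♯ B ∷ bin (suc t) (suc t) ∷ bin t t ∷ bin n (suc t) ∷ [])
  ((x0 ⊕ x1 ≼ x4) ∷ (x2 ≼ con 1) ∷ (x3 ≼ con 1) ∷ []) (x0 ⊕ x1 ⊕ (x2 ⊕ x3)) (con 2 ⊕ x4)
  (complement-bound A B (trans e (sym (+-suc (suc t) (suc t)))) (uA L) (uB L) (cAB L) , ≤-reflexive
      (bin-diag (suc t)) , ≤-reflexive (bin-diag t) , tt)
link-bound₂ {suc n} k {suc t} {A} {B} e le L b | inj₁ (s≤s k<t) =
  subst (λ a → ♯ A + ♯ B + a ≤ 2 + bin (suc n) (suc r)) (sym (Pascal (suc k) t))
    (linear (♯ (A ⁻) ∷ ♯ (A ⁺) ∷ ♯ (B ⁻) ∷ ♯ (B ⁺) ∷ loss (suc k) t ∷ loss r t ∷ bin n r ∷ bin n (suc r) ∷ [])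
      ((x0 ⊕ x2 ⊕ x5 ≼ con 2 ⊕ x7) ∷ (x1 ⊕ x3 ⊕ x4 ≼ x6) ∷ [])
      (x0 ⊕ x1 ⊕ (x2 ⊕ x3) ⊕ (x4 ⊕ x5)) (con 2 ⊕ (x6 ⊕ x7))
      (link-bound₂ k n≡ k<t (link⁻ L) b⁻ , step (search (B ⁺)) , tt))
  where
  n≡ : n ≡ 4 + k + suc t
  n≡ = suc-injective (trans e (cong (4 +_) (+-suc k (suc t))))
  open LinkLevel k A B n≡ k<t L
  b⁻ = two⁻ {F = B} (sB L) (uB L) <n b
  step : _ → ♯ (A ⁺) + ♯ (B ⁺) + loss (suc k) t ≤ bin n r
  step (inj₂ none) = linear (♯ (A ⁺) ∷ ♯ (B ⁺) ∷ loss (suc k) t ∷ bin n r ∷ [])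
    ((x0 ⊕ x2 ≼ x3) ∷ (x1 ≼ con 0) ∷ []) (x0 ⊕ x1 ⊕ x2) x3 (one-sided b⁻ , ≤-reflexive (♯-empty none) , tt)
  step (inj₁ (y , y∈)) = linear (♯ (A ⁺) ∷ ♯ (B ⁺) ∷ loss (suc k) t ∷ bin n r ∷ bin t k ∷ [])
    ((x0 ⊕ x1 ⊕ x2 ⊕ x4 ≼ con 1 ⊕ x3) ∷ (con 1 ≼ x4) ∷ []) (x0 ⊕ x1 ⊕ x2) x3
    (two-sided (♯-pos {F = B ⁺} y∈) , bin-pos (≤-trans (n≤1+n k) (≤-trans (n≤1+n _) k<t)) , tt)

module LinkThree {n t} (A B : Fam (2 + n)) (n≡ : suc n ≡ 4 + suc t) (le : 2 ≤ t) (L : Link 3 A B) (b : 3 ≤ ♯ B) where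

  open LinkLevel 0 A B n≡ le L

  6≤n : 6 ≤ n
  6≤n = ≤-trans (s≤s (s≤s (s≤s (s≤s le)))) (≤-reflexive (sym (suc-injective n≡)))

  Strict : Set
  Strict = suc (♯ A + ♯ B + loss 2 (suc t)) ≤ 2 + bin (2 + n) 3

  strict : suc (♯ (A ⁺) + ♯ (B ⁺) + loss 1 t) ≤ bin (suc n) 2 → Strict
  strict h = subst (λ a → suc (♯ A + ♯ B + a) ≤ 2 + bin (2 + n) 3) (sym (Pascal 1 t))
    (linear (♯ (A ⁻) ∷ ♯ (A ⁺) ∷ ♯ (B ⁻) ∷ ♯ (B ⁺) ∷ loss 1 t ∷ loss 2 t ∷ bin (suc n) 2 ∷ bin (suc n) 3 ∷ [])
      ((x0 ⊕ x2 ⊕ x5 ≼ con 2 ⊕ x7) ∷ (con 1 ⊕ (x1 ⊕ x3 ⊕ x4) ≼ x6) ∷ [])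
      (con 1 ⊕ (x0 ⊕ x1 ⊕ (x2 ⊕ x3) ⊕ (x4 ⊕ x5))) (con 2 ⊕ (x6 ⊕ x7))
      (link-bound₂ 0 n≡ le (link⁻ L) (two⁻ {F = B} (sB L) (uB L) <n (<⇒≤ b)) , h , tt))

  meetsA : ∀ x a b y → A ∋ true ∷ true ∷ x → B ∋ a ∷ b ∷ y → meet x y ≡ true
  meetsA x a b y x∈ y∈ = cross-escape₂ {F = A} a b (sA L) (uA L) (λ z z∈ → cAB L z (a ∷ b ∷ y) z∈ y∈) x∈
    (≤-trans (+-mono-≤ (≤-reflexive (suc-injective (suc-injective (uA L _ x∈)))) (≤-reflexive (uB L _ y∈))) (<⇒≤ 6≤n))

  meetsB : ∀ x a b y → B ∋ true ∷ true ∷ x → A ∋ a ∷ b ∷ y → meet x y ≡ true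
  meetsB x a b y x∈ y∈ = cross-escape₂ {F = B} a b (sB L) (uB L) (λ z z∈ → trans (meet-sym z (a ∷ b ∷ y))
      (cAB L (a ∷ b ∷ y) z y∈ z∈)) x∈
    (≤-trans (+-mono-≤ (≤-reflexive (suc-injective (suc-injective (uB L _ x∈)))) (≤-reflexive (uA L _ y∈))) (<⇒≤ 6≤n))

  meetsB₁ : ∀ x a y → B ∋ true ∷ x → A ∋ a ∷ y → meet x y ≡ true
  meetsB₁ x a y x∈ y∈ = cross-escape {F = B} a (sB L) (λ z z∈ → trans (meet-sym z (a ∷ y)) (cAB L (a ∷ y) z y∈ z∈)) x∈
    (≤-trans (+-mono-≤ (≤-reflexive (suc-injective (uB L _ x∈))) (≤-reflexive (uA L _ y∈))) (≤-trans 6≤n (n≤1+n n)))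

  -- By the shadow property, each point y of z together with the first two points is a member of A.
  -- Crossing it with any q in B puts y into q, so all of B contains z: type 𝓖₂.
  pair : ∀ z → B ∋ true ∷ true ∷ z → Spanned 2 A B
  pair z z∈ = false ∷ false ∷ z , suc-injective (suc-injective (uB L _ z∈)) , hits-∷∷
      (λ a b y y∈ → meetsB z a b y z∈ y∈) ,
    λ { (a ∷ b ∷ q) q∈ → not-false λ f →
      let y , e , sy , z≡ , se , miss , disj = missing z q f
      in true≢false (meetsA y a b q (shadow L (true ∷ true ∷ y) (false ∷ false ∷ e)
            (suc-injective (trans (sym se) (suc-injective (suc-injective (uB L _ z∈)))))
            (trans (meet-sym y e) disj) (subst (λ v → B ∋ true ∷ true ∷ v) (trans z≡ (∪-comm e y)) z∈)) q∈) miss }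

  -- If all of B contains z, the type is 𝓖₃. Otherwise a member of B omits a point of z, the
  -- singletons of `A ⁺ ⁺` lie among the other two, and n = t + 4 is just enough for a strict bound.
  triple : ∀ z → B ∋ true ∷ z → (∀ y → B (true ∷ true ∷ y) ≡ false) → Strict ⊎ Spanned 3 A B
  triple (true ∷ z) z∈ none = ⊥-elim (true≢false z∈ (none z))
  triple (false ∷ z) z∈ none with contains-or (false ∷ false ∷ z) B
  ... | inj₂ all = inj₂ (false ∷ false ∷ z , suc-injective (uB L _ z∈) , hits-∷
      (λ a y y∈ → meetsB₁ (false ∷ z) a y z∈ y∈) , all)
  ... | inj₁ (a ∷ b ∷ q , q∈ , f) =
    let y , e , sy , z≡ , se , miss , _ = missing z q f
        few : ♯ (A ⁺ ⁺) ≤ 2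
        few = ≤-trans (♯-w1 {F = A ⁺ ⁺} {e} (unif⁺ (unif⁺ (uA L))) λ x x∈ →
                case ∨-true (trans (sym (meet-∪ x e y)) (subst (λ a → meet x a ≡ true) z≡
                    (meetsA x true false z x∈ z∈))) of λ
                  { (inj₁ m) → m
                  ; (inj₂ m) → ⊥-elim (true≢false (meetsA x a b q x∈ q∈)
                      (trans (cong (λ v → meet v q) (meet-singletons x y (suc-injective (suc-injective (uA L _ x∈)))
                          sy m)) miss)) })
              (≤-reflexive (suc-injective (trans (sym se) (suc-injective (uB L _ z∈)))))
    in inj₁ (strict (linear (♯ (A ⁺ ⁻) ∷ ♯ (A ⁺ ⁺) ∷ ♯ (B ⁺ ⁻) ∷ ♯ (B ⁺ ⁺) ∷ bin (suc t) 2 ∷ bin t 1 ∷ bin n 1 ∷ bin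
        n 2 ∷ [])
      ((x0 ⊕ x2 ⊕ x4 ≼ con 1 ⊕ x7) ∷ (x1 ≼ con 2) ∷ (x3 ≼ con 0) ∷ (con 4 ⊕ x5 ≼ x6) ∷ [])
      (con 1 ⊕ (x0 ⊕ x1 ⊕ (x2 ⊕ x3) ⊕ (x4 ⊕ x5))) (x6 ⊕ x7)
      ( link-bound₁ 2 (suc-injective n≡) (≤-trans le (n≤1+n t)) (link⁻ L⁺) (♯-pos {F = B ⁺ ⁻} z∈)
      , few
      , ≤-reflexive (♯-empty {F = B ⁺ ⁺} none)
      , ≤-reflexive (trans (cong (4 +_) (bin-1 t)) (trans (sym (suc-injective n≡)) (sym (bin-1 n))))
      , tt)))

link-strict : ∀ k {t} {A B : Fam n} → n ≡ 4 + k + suc t → suc (suc k) < t →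
              Link (3 + k) A B → 3 ≤ ♯ B →
              suc (♯ A + ♯ B + loss (2 + k) t) ≤ 2 + bin n (3 + k) ⊎ (k ≡ 0 × (Spanned 2 A B ⊎ Spanned 3 A B))
link-strict {suc n} k {suc t} {A} {B} e (s≤s k<t) L b = main (search (B ⁺))
  where
  n≡ : n ≡ 4 + k + suc t
  n≡ = suc-injective (trans e (cong (4 +_) (+-suc k (suc t))))
  open LinkLevel k A B n≡ k<t L
  b⁻ = two⁻ {F = B} (sB L) (uB L) <n (<⇒≤ b)
  Goal : Set
  Goal = suc (♯ A + ♯ B + loss (2 + k) (suc t)) ≤ 2 + bin (suc n) (3 + k) ⊎ (k ≡ 0 × (Spanned 2 A B ⊎ Spanned 3 A B))
  strict : suc (♯ (A ⁺) + ♯ (B ⁺) + loss (suc k) t) ≤ bin n r → Goal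
  strict h = inj₁ (subst (λ a → suc (♯ A + ♯ B + a) ≤ 2 + bin (suc n) (suc r)) (sym (Pascal (suc k) t))
    (linear (♯ (A ⁻) ∷ ♯ (A ⁺) ∷ ♯ (B ⁻) ∷ ♯ (B ⁺) ∷ loss (suc k) t ∷ loss r t ∷ bin n r ∷ bin n (suc r) ∷ [])
      ((x0 ⊕ x2 ⊕ x5 ≼ con 2 ⊕ x7) ∷ (con 1 ⊕ (x1 ⊕ x3 ⊕ x4) ≼ x6) ∷ [])
      (con 1 ⊕ (x0 ⊕ x1 ⊕ (x2 ⊕ x3) ⊕ (x4 ⊕ x5))) (con 2 ⊕ (x6 ⊕ x7))
      (link-bound₂ k n≡ k<t (link⁻ L) b⁻ , h , tt)))
  main : (∃[ x ] (B ⁺) ∋ x) ⊎ (∀ x → (B ⁺) x ≡ false) → Goal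
  main (inj₂ none) = strict (linear (♯ (A ⁺) ∷ ♯ (B ⁺) ∷ loss (suc k) t ∷ bin n r ∷ [])
    ((con 1 ⊕ (x0 ⊕ x2) ≼ x3) ∷ (x1 ≼ con 0) ∷ []) (con 1 ⊕ (x0 ⊕ x1 ⊕ x2)) x3
    (one-sided-strict (≤-trans b (≤-reflexive (♯-⁻ B none))) , ≤-reflexive (♯-empty none) , tt))
  main (inj₁ (x , x∈)) = go k refl
    where
    go : ∀ j → j ≡ k → Goal
    go (suc j) refl = strict (linear (♯ (A ⁺) ∷ ♯ (B ⁺) ∷ loss (suc k) t ∷ bin n r ∷ bin t k ∷ [])
      ((x0 ⊕ x1 ⊕ x2 ⊕ x4 ≼ con 1 ⊕ x3) ∷ (con 2 ≼ x4) ∷ []) (con 1 ⊕ (x0 ⊕ x1 ⊕ x2)) x3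
      (two-sided (♯-pos {F = B ⁺} x∈) , bin-≥2 (≤-trans (n≤1+n _) k<t) , tt))
    go zero refl = three n n≡ A B L b x x∈
      where
      three : ∀ n → n ≡ 4 + suc t → (A B : Fam (suc n)) → Link 3 A B → 3 ≤ ♯ B → ∀ x → B ∋ true ∷ x →
              suc (♯ A + ♯ B + loss 2 (suc t)) ≤ 2 + bin (suc n) 3 ⊎ (0 ≡ 0 × (Spanned 2 A B ⊎ Spanned 3 A B))
      three (suc n) n≡ A B L b x x∈ with search (B ⁺ ⁺)
      ... | inj₁ (z , z∈) = inj₂ (refl , inj₁ (LinkThree.pair A B n≡ k<t L b z z∈))
      ... | inj₂ none = case LinkThree.triple A B n≡ k<t L b x x∈ none of λ
        { (inj₁ s) → inj₁ s ; (inj₂ w) → inj₂ (refl , inj₂ w) }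

sub-∪ : ∀ {n} (x y z : Subset n) → sub x z ≡ true → sub y z ≡ true → sub (x ∪ y) z ≡ true
sub-∪ []          []          []          p q = refl
sub-∪ (false ∷ x) (false ∷ y) (c ∷ z)     p q = sub-∪ x y z p q
sub-∪ (false ∷ x) (true ∷ y)  (true ∷ z)  p q = sub-∪ x y z p q
sub-∪ (true ∷ x)  (false ∷ y) (true ∷ z)  p q = sub-∪ x y z p q
sub-∪ (true ∷ x)  (true ∷ y)  (true ∷ z)  p q = sub-∪ x y z p q

sub-singleton : ∀ {n} (x z : Subset n) → ∣ x ∣ ≡ 1 → meet x z ≡ true → sub x z ≡ true
sub-singleton (true ∷ x)  (true ∷ z)  p q = sub-∅ x z (suc-injective p)
sub-singleton (true ∷ x)  (false ∷ z) p q = ⊥-elim (true≢false q (meet-empty x z (suc-injective p)))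
sub-singleton (false ∷ x) (c ∷ z)     p q = sub-singleton x z p q

size-∪ : ∀ {n} (x y : Subset n) → meet x y ≡ false → ∣ x ∪ y ∣ ≡ ∣ x ∣ + ∣ y ∣
size-∪ []          []          d = refl
size-∪ (true ∷ x)  (false ∷ y) d = cong suc (size-∪ x y d)
size-∪ (false ∷ x) (true ∷ y)  d = trans (cong suc (size-∪ x y d)) (sym (+-suc ∣ x ∣ ∣ y ∣))
size-∪ (false ∷ x) (false ∷ y) d = size-∪ x y d

-- The case k = 3

-- For 3-sets a single member of B through the first point already forces type 𝓖₂, so estimates are
-- made only when `B ⁺` is empty.
module LinkTwo {n t} (A B : Fam (suc n)) (n≡ : n ≡ 3 + suc t) (le : 1 ≤ t) (L : Link 2 A B) where

  5≤n : 5 ≤ n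
  5≤n = ≤-trans (s≤s (s≤s (s≤s (s≤s le)))) (≤-reflexive (sym n≡))

  pair : ∀ z → B ∋ true ∷ z → Spanned 2 A B
  pair z z∈ = false ∷ z , suc-injective (uB L _ z∈) ,
    hits-∷ (λ a y y∈ → cross-escape {F = B} a (sB L) (λ w w∈ → trans (meet-sym w (a ∷ y)) (cAB L (a ∷ y) w y∈ w∈)) z∈
      (≤-trans (+-mono-≤ (≤-reflexive (suc-injective (uB L _ z∈))) (≤-reflexive (uA L _ y∈))) (<⇒≤ 5≤n))) ,
    λ { (a ∷ q) q∈ → not-false λ f →
      let y , e , sy , z≡ , se , miss , disj = missing z q f
          y∈ = shadow L (true ∷ y) (false ∷ e)
            (suc-injective (trans (sym se) (suc-injective (uB L _ z∈))))
            (trans (meet-sym y e) disj) (subst (λ v → B ∋ true ∷ v) (trans z≡ (∪-comm e y)) z∈)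
      in true≢false (cross-escape {F = A} a (sA L) (λ w w∈ → cAB L w (a ∷ q) w∈ q∈) y∈
           (≤-trans (+-mono-≤ (≤-reflexive sy) (≤-reflexive (uB L _ q∈))) (<⇒≤ 5≤n))) miss }

  -- A member of A through the first point that missed e could escape to a member of `A ⁻` still
  -- missing e.
  lift : (∀ x → (B ⁺) x ≡ false) → Spanned 2 (A ⁻) (B ⁻) → Spanned 2 A B
  lift none (e , se , h , g) = false ∷ e , se , hits , contains
    where
    hits : Hits (false ∷ e) A
    hits (false ∷ a) a∈ = h a a∈
    hits (true ∷ a)  a∈ = not-false λ f →
      let z , z∈ , d = escape {F = A} (sA L) a e f
            (≤-trans (≤-reflexive (cong₂ (λ u v → suc (u + v)) (suc-injective (uA L _ a∈)) se)) (<⇒≤ 5≤n)) a∈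
      in true≢false (h z z∈) d
    contains : Contains (false ∷ e) B
    contains (false ∷ b) b∈ = g b b∈
    contains (true ∷ b)  b∈ = ⊥-elim (true≢false b∈ (none b))

  one-sided : 2 ≤ ♯ (B ⁻) → ♯ (A ⁺) + loss 0 t ≤ bin n 1
  one-sided b =
    let x , y , x∈ , y∈ , x≢y = ♯-two (B ⁻) b
    in ♯-hits₂ {R = A ⁺} x≢y (co-size x n≡ (uB L _ x∈)) (co-size y n≡ (uB L _ y∈)) (unif⁺ (uA L))
         (λ z z∈ → cAB L (true ∷ z) (false ∷ x) z∈ x∈) (λ z z∈ → cAB L (true ∷ z) (false ∷ y) z∈ y∈)

  -- Two points y and z of `A ⁺` lie in every member of B. A member a of A missing both would have
  -- to contain the third point of every member of B, allowing only two members.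
  last-step : (∀ x → (B ⁺) x ≡ false) → 3 ≤ ♯ B → suc (♯ (A ⁺) + loss 0 t) ≤ bin n 1 ⊎ Spanned 2 A B
  last-step none b with ♯ (A ⁺) ≤? 1
  ... | yes few = inj₁ (linear (♯ (A ⁺) ∷ bin t 1 ∷ bin n 1 ∷ [])
    ((x0 ≼ con 1) ∷ (con 4 ⊕ x1 ≼ x2) ∷ []) (con 1 ⊕ (x0 ⊕ (con 1 ⊕ x1 ⊕ con 1))) x2
    (few , ≤-reflexive (trans (cong (4 +_) (bin-1 t)) (trans (sym n≡) (sym (bin-1 n)))) , tt))
  ... | no many =
    let y , z , y∈ , z∈ , y≢z = ♯-two (A ⁺) (≰⇒> many)
        sy = suc-injective (uA L _ y∈)
        sz = suc-injective (uA L _ z∈)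
        disj = ¬true λ m → y≢z (meet-singletons y z sy sz m)
    in inj₂ (conclude y z y∈ z∈ sy sz disj)
    where
    conclude : ∀ y z → A ∋ true ∷ y → A ∋ true ∷ z → ∣ y ∣ ≡ 1 → ∣ z ∣ ≡ 1 → meet y z ≡ false → Spanned 2 A B
    conclude y z y∈ z∈ sy sz disj = e , se , hits , contains
      where
      e : Subset (suc n)
      e = false ∷ (y ∪ z)
      se : ∣ e ∣ ≡ 2
      se = trans (size-∪ y z disj) (cong₂ _+_ sy sz)
      contains : Contains e B
      contains (true ∷ b)  b∈ = ⊥-elim (true≢false b∈ (none b))
      contains (false ∷ b) b∈ = sub-∪ y z b (sub-singleton y b sy (cAB L (true ∷ y) (false ∷ b) y∈ b∈))
          (sub-singleton z b sz (cAB L (true ∷ z) (false ∷ b) z∈ b∈))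
      hits : Hits e A
      hits a a∈ = not-false λ f → contradiction (≤-trans b (few f)) λ { (s≤s (s≤s ())) }
        where
        few : meet a e ≡ false → ♯ B ≤ 2
        few f = +-cancelʳ-≤ (co (e ∪ a)) _ _ (begin
          ♯ B + co (e ∪ a)           ≡⟨ cong (♯ B +_) (bin-1 _) ⟨
          ♯ B + bin (co (e ∪ a)) 1   ≤⟨ ♯-contains-hits 1 {e} {a} {B} d
              (λ x x∈ → trans (uB L x x∈) (cong (_+ 1) (sym se))) contains
                                          (λ x x∈ → trans (meet-sym x a) (cAB L a x a∈ x∈)) ⟩
          bin (co e) 1               ≡⟨ bin-1 _ ⟩
          co e                       ≡⟨ +-cancelˡ-≡ 2 _ _ (trans (trans (cong (_+ co e) (sym se)) (trans (size+co e)
                                          (trans (sym (size+co (e ∪ a)))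
                                              (cong (_+ co (e ∪ a)) (trans (size-∪ e a d)
                                              (cong₂ _+_ se (uA L a a∈))))))) refl) ⟩
          2 + co (e ∪ a)             ∎)
          where
          open ≤-Reasoning
          d : meet e a ≡ false
          d = trans (meet-sym e a) f

-- The second alternative is unavoidable: for k = 3 the full family 𝓖₂ exceeds the bound as soon as
-- t > 1.
link-bound₃ : ∀ {t} {A B : Fam n} → n ≡ 3 + suc t → 1 ≤ t → Link 2 A B → 2 ≤ ♯ B →
              ♯ A + ♯ B + loss 1 t ≤ 2 + bin n 2 ⊎ Spanned 2 A B
link-bound₃ {n} {t} {A} {B} e le L b with m≤n⇒m<n∨m≡n le
... | inj₂ refl = inj₁ (linear (♯ A ∷ ♯ B ∷ bin n 2 ∷ [])
  ((x0 ⊕ x1 ≼ x2) ∷ []) (x0 ⊕ x1 ⊕ con 2) (con 2 ⊕ x2) (complement-bound A B e (uA L) (uB L) (cAB L) , tt))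
link-bound₃ {suc n} {suc t} {A} {B} e le L b | inj₁ (s≤s 1≤t) with search (B ⁺)
... | inj₁ (z , z∈) = inj₂ (LinkTwo.pair A B (suc-injective e) 1≤t L z z∈)
... | inj₂ none with link-bound₃ {A = A ⁻} {B ⁻} (suc-injective e) 1≤t (link⁻ L)
    (≤-trans b (≤-reflexive (♯-⁻ B none)))
...   | inj₂ w = inj₂ (LinkTwo.lift A B (suc-injective e) 1≤t L none w)
...   | inj₁ IH = inj₁ (subst (λ a → ♯ A + ♯ B + a ≤ 2 + bin (suc n) 2) (sym (Pascal 0 t))
    (linear (♯ (A ⁻) ∷ ♯ (A ⁺) ∷ ♯ (B ⁻) ∷ ♯ (B ⁺) ∷ loss 0 t ∷ loss 1 t ∷ bin n 1 ∷ bin n 2 ∷ [])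
      ((x0 ⊕ x2 ⊕ x5 ≼ con 2 ⊕ x7) ∷ (x1 ⊕ x4 ≼ x6) ∷ (x3 ≼ con 0) ∷ [])
      (x0 ⊕ x1 ⊕ (x2 ⊕ x3) ⊕ (x4 ⊕ x5)) (con 2 ⊕ (x6 ⊕ x7))
      (IH , LinkTwo.one-sided A B (suc-injective e) 1≤t L (≤-trans b (≤-reflexive (♯-⁻ B none))) , ≤-reflexive
          (♯-empty none) , tt)))

link-strict₃ : ∀ {t} {A B : Fam n} → n ≡ 3 + suc t → 1 < t → Link 2 A B → 3 ≤ ♯ B →
               suc (♯ A + ♯ B + loss 1 t) ≤ 2 + bin n 2 ⊎ Spanned 2 A B
link-strict₃ {suc n} {suc t} {A} {B} e (s≤s 1≤t) L b with search (B ⁺)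
... | inj₁ (z , z∈) = inj₂ (LinkTwo.pair A B (suc-injective e) 1≤t L z z∈)
... | inj₂ none with link-bound₃ {A = A ⁻} {B ⁻} (suc-injective e) 1≤t (link⁻ L)
    (≤-trans (<⇒≤ b) (≤-reflexive (♯-⁻ B none)))
                   | LinkTwo.last-step A B (suc-injective e) 1≤t L none b
...   | inj₂ w | _ = inj₂ (LinkTwo.lift A B (suc-injective e) 1≤t L none w)
...   | inj₁ _ | inj₂ w = inj₂ w
...   | inj₁ IH | inj₁ last = inj₁ (subst (λ a → suc (♯ A + ♯ B + a) ≤ 2 + bin (suc n) 2) (sym (Pascal 0 t))
    (linear (♯ (A ⁻) ∷ ♯ (A ⁺) ∷ ♯ (B ⁻) ∷ ♯ (B ⁺) ∷ loss 0 t ∷ loss 1 t ∷ bin n 1 ∷ bin n 2 ∷ [])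
      ((x0 ⊕ x2 ⊕ x5 ≼ con 2 ⊕ x7) ∷ (con 1 ⊕ (x1 ⊕ x4) ≼ x6) ∷ (x3 ≼ con 0) ∷ [])
      (con 1 ⊕ (x0 ⊕ x1 ⊕ (x2 ⊕ x3) ⊕ (x4 ⊕ x5))) (con 2 ⊕ (x6 ⊕ x7))
      (IH , last , ≤-reflexive (♯-empty none) , tt)))

-- Shifting

-- The operation acts separately on each pair of sets that differ only in the positions i and i + 1:
-- the preferred one is kept if either is a member, the other one if both are. Counting and crossing
-- thereby become local.
shift : Fin n → Fam (suc n) → Fam (suc n)
shift zero    F (true  ∷ false ∷ x) = F (true ∷ false ∷ x) ∧ F (false ∷ true ∷ x)
shift zero    F (false ∷ true  ∷ x) = F (true ∷ false ∷ x) ∨ F (false ∷ true ∷ x)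
shift zero    F (false ∷ false ∷ x) = F (false ∷ false ∷ x)
shift zero    F (true  ∷ true  ∷ x) = F (true ∷ true ∷ x)
shift (suc i) F (a ∷ x)             = shift i (λ y → F (a ∷ y)) x

♯-shift : (i : Fin n) (F : Fam (suc n)) → ♯ (shift i F) ≡ ♯ F
♯-shift zero F = trans (arrange (♯ (F ⁻ ⁻)) _ _ (♯ (F ⁺ ⁺))) (trans
  (cong (λ a → ♯ (F ⁻ ⁻) + ♯ (F ⁺ ⁺) + a) (♯-∪∩ (F ⁺ ⁻) (F ⁻ ⁺)))
  (trans (cong (♯ (F ⁻ ⁻) + ♯ (F ⁺ ⁺) +_) (+-comm (♯ (F ⁺ ⁻)) _)) (sym (arrange (♯ (F ⁻ ⁻)) _ _ _))))
  where
  arrange : ∀ a b c d → a + b + (c + d) ≡ a + d + (b + c)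
  arrange a b c d = trans (cong (a + b +_) (+-comm c d)) (swap-inner a b d c)
♯-shift (suc i) F = cong₂ _+_ (♯-shift i (F ⁻)) (♯-shift i (F ⁺))

-- An arbitrary predicate on sizes lets the recursion pass a point that is present, by composing
-- with `suc`.
shift-sizes : (C : ℕ → Set) (i : Fin n) {F : Fam (suc n)} → (∀ x → F ∋ x → C ∣ x ∣) → ∀ x → shift i F ∋ x → C ∣ x ∣
shift-sizes C zero u (true  ∷ false ∷ x) p = u (true ∷ false ∷ x) (proj₁ (∧-true p))
shift-sizes C zero {F} u (false ∷ true ∷ x) p with ∨-true {F (true ∷ false ∷ x)} p
... | inj₁ q = u (true ∷ false ∷ x) q
... | inj₂ q = u (false ∷ true ∷ x) q
shift-sizes C zero u (false ∷ false ∷ x) p = u _ p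
shift-sizes C zero u (true  ∷ true  ∷ x) p = u _ p
shift-sizes C (suc i) {F} u (false ∷ x) p = shift-sizes C i {F ⁻} (λ y → u (false ∷ y)) x p
shift-sizes C (suc i) {F} u (true ∷ x)  p = shift-sizes (C ∘ suc) i {F ⁺} (λ y → u (true ∷ y)) x p

unif-shift : ∀ {k} (i : Fin n) {F : Fam (suc n)} → Unif k F → Unif k (shift i F)
unif-shift {k = k} i {F} = shift-sizes (_≡ k) i {F}

-- A set that keeps the less preferred point had both of its versions in the family, so one of them
-- can be matched against whichever version of the opposite set was a member.
cross-shift : (i : Fin n) {P Q : Fam (suc n)} → Cross P Q → Cross (shift i P) (shift i Q)
cross-shift zero c (true  ∷ false ∷ x) (true  ∷ b     ∷ y) p q = refl
cross-shift zero c (true  ∷ false ∷ x) (false ∷ true  ∷ y) p q with ∨-true q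
... | inj₁ r = c (false ∷ true ∷ x) (true ∷ false ∷ y) (proj₂ (∧-true p)) r
... | inj₂ r = c (true ∷ false ∷ x) (false ∷ true ∷ y) (proj₁ (∧-true p)) r
cross-shift zero c (true  ∷ false ∷ x) (false ∷ false ∷ y) p q = c (true ∷ false ∷ x) _ (proj₁ (∧-true p)) q
cross-shift zero c (false ∷ true  ∷ x) (true  ∷ true  ∷ y) p q = refl
cross-shift zero c (false ∷ true  ∷ x) (false ∷ true  ∷ y) p q = refl
cross-shift zero c (false ∷ true  ∷ x) (true  ∷ false ∷ y) p q with ∨-true p
... | inj₁ r = c (true ∷ false ∷ x) (false ∷ true ∷ y) r (proj₂ (∧-true q))
... | inj₂ r = c (false ∷ true ∷ x) (true ∷ false ∷ y) r (proj₁ (∧-true q))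
cross-shift zero c (false ∷ true  ∷ x) (false ∷ false ∷ y) p q with ∨-true p
... | inj₁ r = c (true ∷ false ∷ x) (false ∷ false ∷ y) r q
... | inj₂ r = c (false ∷ true ∷ x) (false ∷ false ∷ y) r q
cross-shift zero c (true  ∷ true  ∷ x) (true  ∷ b     ∷ y) p q = refl
cross-shift zero c (true  ∷ true  ∷ x) (false ∷ true  ∷ y) p q = refl
cross-shift zero c (true  ∷ true  ∷ x) (false ∷ false ∷ y) p q = c _ _ p q
cross-shift zero c (false ∷ false ∷ x) (true  ∷ true  ∷ y) p q = c _ _ p q
cross-shift zero c (false ∷ false ∷ x) (false ∷ false ∷ y) p q = c _ _ p q
cross-shift zero c (false ∷ false ∷ x) (true  ∷ false ∷ y) p q = c (false ∷ false ∷ x) (true ∷ false ∷ y) p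
    (proj₁ (∧-true q))
cross-shift zero c (false ∷ false ∷ x) (false ∷ true  ∷ y) p q with ∨-true q
... | inj₁ r = c (false ∷ false ∷ x) (true ∷ false ∷ y) p r
... | inj₂ r = c (false ∷ false ∷ x) (false ∷ true ∷ y) p r
cross-shift (suc i)         c (true  ∷ x) (true  ∷ y) p q = refl
cross-shift (suc i) {P} {Q} c (true  ∷ x) (false ∷ y) p q = cross-shift i {P ⁺} {Q ⁻}
    (λ v w → c (true ∷ v) (false ∷ w)) x y p q
cross-shift (suc i) {P} {Q} c (false ∷ x) (true  ∷ y) p q = cross-shift i {P ⁻} {Q ⁺}
    (λ v w → c (false ∷ v) (true ∷ w)) x y p q
cross-shift (suc i) {P} {Q} c (false ∷ x) (false ∷ y) p q = cross-shift i {P ⁻} {Q ⁻}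
    (λ v w → c (false ∷ v) (false ∷ w)) x y p q

-- Each point of a member weighs the number of points after it, so a shift lowers the total by one
-- for every set it moves. This is the termination measure.
potential : Fam n → ℕ
potential {zero}  F = 0
potential {suc n} F = potential (F ⁻) + potential (F ⁺) + n * ♯ (F ⁺)

potential-∪∩ : (F G : Fam n) → potential (F ∪ᶠ G) + potential (F ∩ᶠ G) ≡ potential F + potential G
potential-∪∩ {zero}  F G = refl
potential-∪∩ {suc n} F G = begin
  potential (F ∪ᶠ G) + potential (F ∩ᶠ G)
    ≡⟨ trans (swap-inner (pu + pu′) _ (pi + pi′) _) (cong₂ _+_ (swap-inner pu _ pi _)
        (sym (*-distribˡ-+ n (♯ (F ⁺ ∪ᶠ G ⁺)) _))) ⟩
  pu + pi + (pu′ + pi′) + n * (♯ (F ⁺ ∪ᶠ G ⁺) + ♯ (F ⁺ ∩ᶠ G ⁺))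
    ≡⟨ cong₂ _+_ (cong₂ _+_ (potential-∪∩ (F ⁻) (G ⁻)) (potential-∪∩ (F ⁺) (G ⁺))) (cong (n *_) (♯-∪∩ (F ⁺) (G ⁺))) ⟩
  potential (F ⁻) + potential (G ⁻) + (potential (F ⁺) + potential (G ⁺)) + n * (♯ (F ⁺) + ♯ (G ⁺))
    ≡⟨ sym (trans (swap-inner (potential (F ⁻) + potential (F ⁺)) _ _ _)
        (cong₂ _+_ (swap-inner (potential (F ⁻)) _ _ _) (sym (*-distribˡ-+ n (♯ (F ⁺)) _)))) ⟩
  potential F + potential G ∎
  where
  open ≡-Reasoning
  pu pu′ pi pi′ : ℕ
  pu  = potential (F ⁻ ∪ᶠ G ⁻)
  pu′ = potential (F ⁺ ∪ᶠ G ⁺)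
  pi  = potential (F ⁻ ∩ᶠ G ⁻)
  pi′ = potential (F ⁺ ∩ᶠ G ⁺)

potential-shift₀ : (F : Fam (2 + n)) → potential (shift zero F) + ♯ (F ⁺ ⁻) ≡ potential F + ♯ (F ⁺ ⁻ ∩ᶠ F ⁻ ⁺)
potential-shift₀ {n} F = ≤-antisym
  (linear ρ ((x4 ⊕ x5 ≼ x2 ⊕ x3) ∷ (x10 ⊕ x11 ≼ x12 ⊕ x9) ∷ (x15 ≼ x11 ⊕ x13) ∷ (x12 ⊕ x13 ≼ x14) ∷ []) after before
    (≤-reflexive p , ≤-reflexive q , ≤-reflexive (*-distribˡ-+ n _ _) , ≤-reflexive (sym (*-distribˡ-+ n (♯ U) _)) ,
        tt))
  (linear ρ ((x2 ⊕ x3 ≼ x4 ⊕ x5) ∷ (x12 ⊕ x9 ≼ x10 ⊕ x11) ∷ (x11 ⊕ x13 ≼ x15) ∷ (x14 ≼ x12 ⊕ x13) ∷ []) before after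
    (≤-reflexive (sym p) , ≤-reflexive (sym q) , ≤-reflexive (sym (*-distribˡ-+ n _ _)) , ≤-reflexive
        (*-distribˡ-+ n (♯ U) _) , tt))
  where
  U V : Fam n
  U = F ⁺ ⁻
  V = F ⁻ ⁺
  ρ : Vec ℕ 16
  ρ = potential (F ⁻ ⁻) ∷ potential (F ⁺ ⁺) ∷ potential U ∷ potential V ∷ potential (U ∪ᶠ V) ∷ potential (U ∩ᶠ V)
    ∷ ♯ U ∷ ♯ (U ∩ᶠ V) ∷ ♯ (F ⁺ ⁺) ∷ n * ♯ V ∷ n * ♯ (U ∪ᶠ V) ∷ n * ♯ (U ∩ᶠ V) ∷ n * ♯ U ∷ n * ♯ (F ⁺ ⁺)
    ∷ n * (♯ U + ♯ (F ⁺ ⁺)) ∷ n * (♯ (U ∩ᶠ V) + ♯ (F ⁺ ⁺)) ∷ []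
  before after : Exp 16
  after  = (x0 ⊕ x4 ⊕ x10 ⊕ (x5 ⊕ x1 ⊕ x13) ⊕ ((x7 ⊕ x8) ⊕ x15)) ⊕ x6
  before = (x0 ⊕ x3 ⊕ x9 ⊕ (x2 ⊕ x1 ⊕ x13) ⊕ ((x6 ⊕ x8) ⊕ x14)) ⊕ x7
  p : potential (U ∪ᶠ V) + potential (U ∩ᶠ V) ≡ potential U + potential V
  p = potential-∪∩ U V
  q : n * ♯ (U ∪ᶠ V) + n * ♯ (U ∩ᶠ V) ≡ n * ♯ U + n * ♯ V
  q = trans (sym (*-distribˡ-+ n (♯ (U ∪ᶠ V)) _)) (trans (cong (n *_) (♯-∪∩ U V)) (*-distribˡ-+ n (♯ U) _))

potential-shift : (i : Fin n) (F : Fam (suc n)) → potential (shift i F) ≤ potential F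
potential-shift {suc n} zero F = +-cancelʳ-≤ (♯ (F ⁺ ⁻)) _ _ (≤-trans (≤-reflexive (potential-shift₀ F))
  (+-monoʳ-≤ (potential F) (♯-mono {F = F ⁺ ⁻ ∩ᶠ F ⁻ ⁺} {F ⁺ ⁻} λ x p → proj₁ (∧-true p))))
potential-shift {suc n} (suc i) F = +-mono-≤ (+-mono-≤ (potential-shift i (F ⁻)) (potential-shift i (F ⁺)))
  (≤-reflexive (cong (suc n *_) (♯-shift i (F ⁺))))

progress : (F : Fam (suc n)) → Shifted F ⊎ ∃[ i ] potential (shift i F) < potential F
progress {zero} F = inj₁ tt
progress {suc n} F with search (λ x → F (true ∷ false ∷ x) ∧ not (F (false ∷ true ∷ x))) | progress (F ⁻) | progress
    (F ⁺)
... | inj₁ (x , p) | _ | _ = inj₂ (zero , +-cancelʳ-≤ (♯ (F ⁺ ⁻)) _ _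
    (≤-trans (≤-reflexive (cong suc (potential-shift₀ F)))
      (≤-trans (≤-reflexive (sym (+-suc (potential F) _))) (+-monoʳ-≤ (potential F) fewer))))
  where
  fewer : suc (♯ (F ⁺ ⁻ ∩ᶠ F ⁻ ⁺)) ≤ ♯ (F ⁺ ⁻)
  fewer = ≤-trans (s≤s (♯-mono {F = F ⁺ ⁻ ∩ᶠ F ⁻ ⁺} {F ⁺ ⁻ ∖ x} λ y q → ∧-intro (proj₁ (∧-true q))
            (cong not (¬true λ e → true≢false (subst (F ⁻ ⁺ ∋_) (sym (==⇒≡ x y e))
                (proj₂ (∧-true {F (true ∷ false ∷ y)} q))) (not-true (proj₂ (∧-true {F (true ∷ false ∷ x)} p)))))))
          (≤-reflexive (sym (♯-remove (F ⁺ ⁻) x (proj₁ (∧-true p)))))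
... | inj₂ _ | inj₂ (i , p) | _ = inj₂ (suc i , +-mono-<-≤ (+-mono-<-≤ p (potential-shift i (F ⁺)))
    (≤-reflexive (cong (suc n *_) (♯-shift i (F ⁺)))))
... | inj₂ _ | inj₁ _ | inj₂ (i , p) = inj₂ (suc i , +-mono-<-≤ (+-mono-≤-< (potential-shift i (F ⁻)) p)
    (≤-reflexive (cong (suc n *_) (♯-shift i (F ⁺)))))
... | inj₂ none | inj₁ s | inj₁ s′ = inj₁ ((λ x p → not-false λ f → true≢false (∧-intro p (cong not f)) (none x)) , s
    , s′)

record ShiftedPair {n} (a b : ℕ) (P Q : Fam n) : Set where
  field
    P′ Q′ : Fam n
    sP    : Shifted P′
    sQ    : Shifted Q′
    uP    : Unif a P′
    uQ    : Unif b Q′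
    cross : Cross P′ Q′
    ♯P    : ♯ P′ ≡ ♯ P
    ♯Q    : ♯ Q′ ≡ ♯ Q

-- Both families undergo the same shifts, which keeps them crossing; `f` bounds the sum of their
-- potentials.
shift-pair : ∀ {a b} (P Q : Fam n) → Unif a P → Unif b Q → Cross P Q → ShiftedPair a b P Q
shift-pair {zero} P Q u v c = record { P′ = P ; Q′ = Q ; sP = tt ; sQ = tt ; uP = u ; uQ = v ; cross = c ; ♯P = refl
    ; ♯Q = refl }
shift-pair {suc n} {a} {b} P Q u v c = go _ P Q u v c ≤-refl
  where
  go : ∀ f (P Q : Fam (suc n)) → Unif a P → Unif b Q → Cross P Q → potential P + potential Q ≤ f → ShiftedPair a b P Q
  step : ∀ f (P Q : Fam (suc n)) → Unif a P → Unif b Q → Cross P Q → ∀ i → potential (shift i P) + potential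
      (shift i Q) < f → ShiftedPair a b P Q
  step (suc f) P Q u v c i (s≤s lt) =
    let R = go f (shift i P) (shift i Q) (unif-shift i {P} u) (unif-shift i {Q} v) (cross-shift i {P} {Q} c) lt
        open ShiftedPair R
    in record { P′ = P′ ; Q′ = Q′ ; sP = sP ; sQ = sQ ; uP = uP ; uQ = uQ ; cross = cross
              ; ♯P = trans ♯P (♯-shift i P) ; ♯Q = trans ♯Q (♯-shift i Q) }
  go f P Q u v c le with progress P | progress Q
  ... | inj₁ sP | inj₁ sQ = record { P′ = P ; Q′ = Q ; sP = sP ; sQ = sQ ; uP = u ; uQ = v ; cross = c ; ♯P = refl ;
      ♯Q = refl }
  ... | inj₂ (i , p) | _ = step f P Q u v c i (≤-trans (+-mono-<-≤ p (potential-shift i Q)) le)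
  ... | inj₁ _ | inj₂ (i , p) = step f P Q u v c i (≤-trans (+-mono-≤-< (potential-shift i P) p) le)

-- Relabelling the ground set

-- A permutation of the points, represented by its action on subsets together with the invariants
-- used below. Values are composed of adjacent swaps.
record Sym (n : ℕ) : Set where
  field
    to from : Subset n → Subset n
    to-from : ∀ x → to (from x) ≡ x
    meet-to : ∀ x y → meet (to x) (to y) ≡ meet x y
    sub-to  : ∀ x y → sub (to x) (to y) ≡ sub x y
    size-to : ∀ x → ∣ to x ∣ ≡ ∣ x ∣
    ♯-to    : ∀ F → ♯ (F ∘ to) ≡ ♯ F
open Sym public

idˢ : Sym n
idˢ = record { to = λ x → x ; from = λ x → x ; to-from = λ _ → refl ; meet-to = λ _ _ → refl
             ; sub-to = λ _ _ → refl ; size-to = λ _ → refl ; ♯-to = λ _ → refl }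

infixr 9 _∘ˢ_
_∘ˢ_ : Sym n → Sym n → Sym n
φ ∘ˢ ψ = record
  { to = to φ ∘ to ψ ; from = from ψ ∘ from φ
  ; to-from = λ x → trans (cong (to φ) (to-from ψ (from φ x))) (to-from φ x)
  ; meet-to = λ x y → trans (meet-to φ (to ψ x) (to ψ y)) (meet-to ψ x y)
  ; sub-to  = λ x y → trans (sub-to φ (to ψ x) (to ψ y)) (sub-to ψ x y)
  ; size-to = λ x → trans (size-to φ (to ψ x)) (size-to ψ x)
  ; ♯-to = λ F → trans (♯-to ψ (F ∘ to φ)) (♯-to φ F) }

liftˢ : Sym n → Sym (suc n)
liftˢ φ = record
  { to = λ { (b ∷ x) → b ∷ to φ x } ; from = λ { (b ∷ x) → b ∷ from φ x }
  ; to-from = λ { (b ∷ x) → cong (b ∷_) (to-from φ x) }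
  ; meet-to = λ { (a ∷ x) (b ∷ y) → cong ((a ∧ b) ∨_) (meet-to φ x y) }
  ; sub-to = λ { (a ∷ x) (b ∷ y) → cong ((not a ∨ b) ∧_) (sub-to φ x y) }
  ; size-to = λ { (true ∷ x) → cong suc (size-to φ x) ; (false ∷ x) → size-to φ x }
  ; ♯-to = λ F → cong₂ _+_ (♯-to φ (F ⁻)) (♯-to φ (F ⁺)) }

swapˢ : Sym (2 + n)
swapˢ {n} = record
  { to = λ { (a ∷ b ∷ x) → b ∷ a ∷ x } ; from = λ { (a ∷ b ∷ x) → b ∷ a ∷ x }
  ; to-from = λ { (a ∷ b ∷ x) → refl }
  ; meet-to = λ { (a ∷ b ∷ x) (c ∷ d ∷ y) → or (a ∧ c) (b ∧ d) (meet x y) }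
  ; sub-to = λ { (a ∷ b ∷ x) (c ∷ d ∷ y) → and (not a ∨ c) (not b ∨ d) (sub x y) }
  ; size-to = λ { (true ∷ true ∷ x) → refl ; (true ∷ false ∷ x) → refl ; (false ∷ true ∷ x) → refl ;
      (false ∷ false ∷ x) → refl }
  ; ♯-to = λ F → swap-inner (♯ (F ⁻ ⁻)) _ _ _ }
  where
  or : ∀ a b c → b ∨ (a ∨ c) ≡ a ∨ (b ∨ c)
  or true  true  c = refl
  or true  false c = refl
  or false true  c = refl
  or false false c = refl
  and : ∀ a b c → b ∧ (a ∧ c) ≡ a ∧ (b ∧ c)
  and true  true  c = refl
  and true  false c = refl
  and false true  c = refl
  and false false c = refl

extract : ∀ {s} (e : Subset (suc n)) → ∣ e ∣ ≡ suc s → ∃[ φ ] ∃[ e′ ] (to φ (true ∷ e′) ≡ e × ∣ e′ ∣ ≡ s)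
extract (true ∷ e) p = idˢ , e , refl , suc-injective p
extract {zero} (false ∷ []) ()
extract {suc n} (false ∷ e) p =
  let φ , e′ , q , s = extract e p in liftˢ φ ∘ˢ swapˢ , false ∷ e′ , cong (false ∷_) q , s

-- Brings the positions i and i + 1 to the front in their order, so that any shift becomes the shift
-- between the first two points.
front : Fin n → Sym (suc n)
front zero          = idˢ
front {suc (suc n)} (suc i) = liftˢ (front i) ∘ˢ swapˢ ∘ˢ liftˢ swapˢ

shift-front : (i : Fin (suc n)) (F : Fam (2 + n)) (x : Subset (2 + n)) →
              shift i F (to (front i) x) ≡ shift zero (F ∘ to (front i)) x
shift-front zero F (a ∷ b ∷ x) = refl
shift-front {suc n} (suc i) F (a ∷ b ∷ c ∷ x) =
  trans (shift-front i (λ y → F (c ∷ y)) (a ∷ b ∷ x)) (heads a b)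
  where
  heads : ∀ a b → shift zero (λ y → F (c ∷ to (front i) y)) (a ∷ b ∷ x) ≡ shift zero (F ∘ to (front (suc i)))
      (a ∷ b ∷ c ∷ x)
  heads true  true  = refl
  heads true  false = refl
  heads false true  = refl
  heads false false = refl

unif-to : ∀ {k} (φ : Sym n) {F : Fam n} → Unif k F → Unif k (F ∘ to φ)
unif-to φ u x p = trans (sym (size-to φ x)) (u (to φ x) p)

cross-to : (φ : Sym n) {P Q : Fam n} → Cross P Q → Cross (P ∘ to φ) (Q ∘ to φ)
cross-to φ c x y p q = trans (sym (meet-to φ x y)) (c (to φ x) (to φ y) p q)

hits-to : (φ : Sym n) {c : Subset n} {F : Fam n} → Hits (to φ c) F → Hits c (F ∘ to φ)
hits-to φ {c} h x p = trans (sym (meet-to φ x c)) (h (to φ x) p)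

-- The trace on the last point

snocs : (F : Fam (suc n)) → Bool → Fam n
snocs F b x = F (x ∷ʳ b)

♯-snoc : (F : Fam (suc n)) → ♯ F ≡ ♯ (snocs F true) + ♯ (snocs F false)
♯-snoc {zero}  F = +-comm (♯ (F ⁻)) _
♯-snoc {suc n} F = trans (cong₂ _+_ (♯-snoc (F ⁻)) (♯-snoc (F ⁺))) (swap-inner (♯ (snocs (F ⁻) true)) _ _ _)

size-snoc-true : (x : Subset n) → ∣ x ∷ʳ true ∣ ≡ suc ∣ x ∣
size-snoc-true []          = refl
size-snoc-true (true ∷ x)  = cong suc (size-snoc-true x)
size-snoc-true (false ∷ x) = size-snoc-true x

size-snoc-false : (x : Subset n) → ∣ x ∷ʳ false ∣ ≡ ∣ x ∣
size-snoc-false []          = refl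
size-snoc-false (true ∷ x)  = cong suc (size-snoc-false x)
size-snoc-false (false ∷ x) = size-snoc-false x

meet-snoc-false : (x y : Subset n) (b : Bool) → meet (x ∷ʳ false) (y ∷ʳ b) ≡ meet x y
meet-snoc-false []          []      b = refl
meet-snoc-false (a ∷ x) (c ∷ y) b = cong ((a ∧ c) ∨_) (meet-snoc-false x y b)

meet-snoc-true : (x y : Subset n) → meet (x ∷ʳ true) (y ∷ʳ true) ≡ true
meet-snoc-true []      []      = refl
meet-snoc-true (a ∷ x) (c ∷ y) = ∨-injʳ {a ∧ c} (meet-snoc-true x y)

sub-snoc-false : (x y : Subset n) (b : Bool) → sub (x ∷ʳ false) (y ∷ʳ b) ≡ sub x y
sub-snoc-false []      []      b = refl
sub-snoc-false (a ∷ x) (c ∷ y) b = cong ((not a ∨ c) ∧_) (sub-snoc-false x y b)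

shifted-snoc : {F : Fam (suc n)} (b : Bool) → Shifted F → Shifted (snocs F b)
shifted-snoc {zero}        b s = tt
shifted-snoc {suc zero}    b s = tt
shifted-snoc {suc (suc n)} {F} b (s , s⁻ , s⁺) =
  (λ x → s (x ∷ʳ b)) , shifted-snoc {F = F ⁻} b s⁻ , shifted-snoc {F = F ⁺} b s⁺

shift-to-last : {F : Fam (2 + n)} → Shifted F → ∀ x → F ∋ true ∷ (x ∷ʳ false) → F ∋ false ∷ (x ∷ʳ true)
shift-to-last (s , _ , _) []          p = s [] p
shift-to-last {F = F} (s , s⁻ , s⁺) (true ∷ x)  p = s (x ∷ʳ true) (shift-to-last {F = F ⁺} s⁺ x p)
shift-to-last {F = F} (s , s⁻ , s⁺) (false ∷ x) p = shift-to-last {F = F ⁻} s⁻ x (s (x ∷ʳ false) p)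

-- The last point is the most preferred, so it may replace any point of a member that avoids it;
-- this supplies the field `shadow`.
shadow-last : {F : Fam (suc n)} → Shifted F → ∀ x y → ∣ y ∣ ≡ 1 → meet x y ≡ false → F ∋ (x ∪ y) ∷ʳ false →
    F ∋ x ∷ʳ true
shadow-last {suc n} {F} s (false ∷ x) (true ∷ y) e d p =
  shift-to-last {F = F} s x (subst (λ v → F ∋ true ∷ (v ∷ʳ false))
      (trans (cong (x ∪_) (size-0 {x = y} {empty} (suc-injective e) (size-empty n))) (∪-∅ x)) p)
shadow-last {F = F} s (true ∷ x)  (false ∷ y) e d p = shadow-last {F = F ⁺} (shifted⁺ {F = F} s) x y e d p
shadow-last {F = F} s (false ∷ x) (false ∷ y) e d p = shadow-last {F = F ⁻} (shifted⁻ {F = F} s) x y e d p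

link-last : ∀ {l} {F : Fam (suc n)} → Shifted F → Unif (suc l) F → Cross F F → Link l (snocs F true) (snocs F false)
link-last {F = F} s u c = record
  { sA = shifted-snoc {F = F} true s ; sB = shifted-snoc {F = F} false s
  ; uA = λ x p → suc-injective (trans (sym (size-snoc-true x)) (u _ p))
  ; uB = λ x p → trans (sym (size-snoc-false x)) (u _ p)
  ; cAB = λ x y p q → trans (meet-sym x y) (trans (sym (meet-snoc-false y x true)) (c _ _ q p))
  ; cBB = λ x y p q → trans (sym (meet-snoc-false x y false)) (c _ _ p q)
  ; shadow = shadow-last {F = F} s }

lastPoint : Subset (suc n)
lastPoint {n} = empty {n} ∷ʳ true

size-lastPoint : ∣ lastPoint {n} ∣ ≡ 1
size-lastPoint {n} = trans (size-snoc-true (empty {n})) (cong suc (size-empty n))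

inG : Subset n → Subset n → Subset n → Bool
inG e v x = sub e x ∨ (meet v x ∧ meet x e)

-- H lies in a family of type 𝓖₂ (k = 3, 4) or 𝓖₃ (k = 4); here k = r + 2.
record Exc {n} (r : ℕ) (H : Fam n) : Set where
  constructor exc
  field
    core apex : Subset n
    size-apex : ∣ apex ∣ ≡ 1
    disjoint  : meet apex core ≡ false
    size-core : (∣ core ∣ ≡ 2 × r ≤ 2) ⊎ (∣ core ∣ ≡ 3 × r ≡ 2)
    inside-G  : ∀ x → H ∋ x → inG core apex x ≡ true

-- The threshold 3 excludes stars, Hilton-Milner families and 𝓙₂, each of which has a point missed
-- by at most two members.
Codegree : ℕ → Fam n → Set
Codegree s H = ∀ v → ∣ v ∣ ≡ 1 → s ≤ ♯ (H ∩ᶠ λ x → not (meet v x))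

Small : ℕ → ℕ → Fam (suc n) → Set
Small {n} r t H = suc (♯ H + loss r t) ≤ 2 + bin n (suc r)

spanned-exc : ∀ {s r} {H : Fam (suc n)} → (s ≡ 2 × r ≤ 2) ⊎ (s ≡ 3 × r ≡ 2) →
              Spanned s (snocs H true) (snocs H false) → Exc r H
spanned-exc {n} {s} {r} {H} size (e , se , hits , contains) =
  exc (e ∷ʳ false) lastPoint (size-lastPoint {n})
    (trans (meet-sym lastPoint (e ∷ʳ false)) (trans (meet-snoc-false e empty true) (meet-∅ e)))
    (subst (λ a → (a ≡ 2 × r ≤ 2) ⊎ (a ≡ 3 × r ≡ 2)) (trans (sym se) (sym (size-snoc-false e))) size) inside
  where
  inside : ∀ x → H ∋ x → inG (e ∷ʳ false) lastPoint x ≡ true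
  inside x p with initLast x
  ... | y , true  , refl = ∨-injʳ {sub (e ∷ʳ false) (y ∷ʳ true)} (∧-intro (meet-snoc-true empty y)
                            (trans (meet-sym (y ∷ʳ true) (e ∷ʳ false))
                                (trans (meet-snoc-false e y true) (trans (meet-sym e y) (hits y p)))))
  ... | y , false , refl = ∨-injˡ (trans (sub-snoc-false e y false) (contains y p))

shifted-main : ∀ r {t} {H : Fam (suc n)} → 1 ≤ r → n ≡ 2 + r + suc t → r < t → Shifted H →
               Unif (2 + r) H → Cross H H → Codegree 3 H → Small r t H ⊎ Exc r H
shifted-main {n} r {t} {H} 1≤r e r<t s u c g = go r refl 1≤r
  where
  L : Link (suc r) (snocs H true) (snocs H false)
  L = link-last {F = H} s u c
  -- The members missing the last point form B, so the codegree condition is applied at that point.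
  B≥3 : 3 ≤ ♯ (snocs H false)
  B≥3 = ≤-trans (g lastPoint (size-lastPoint {n}))
       (≤-trans (≤-reflexive (trans (♯-snoc K) (cong (_+ ♯ (snocs K false)) (♯-empty {F = snocs K true} none))))
           (♯-mono {F = snocs K false} {snocs H false} λ x p → proj₁ (∧-true p)))
    where
    K : Fam (suc n)
    K = H ∩ᶠ λ x → not (meet lastPoint x)
    none : ∀ x → snocs K true x ≡ false
    none x = ¬true λ p → true≢false (meet-snoc-true empty x) (not-true (proj₂ (∧-true {H (x ∷ʳ true)} p)))
  small : ∀ {b} → suc (♯ (snocs H true) + ♯ (snocs H false) + loss r t) ≤ b → suc (♯ H + loss r t) ≤ b
  small {b} = subst (λ a → suc (a + loss r t) ≤ b) (sym (♯-snoc H))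
  go : ∀ j → j ≡ r → 1 ≤ j → Small r t H ⊎ Exc r H
  go (suc zero) refl _ with link-strict₃ e r<t L B≥3
  ... | inj₁ h = inj₁ (small h)
  ... | inj₂ w = inj₂ (spanned-exc (inj₁ (refl , s≤s z≤n)) w)
  go (suc (suc k)) refl _ with link-strict k e r<t L B≥3
  ... | inj₁ h = inj₁ (small h)
  ... | inj₂ (refl , inj₁ w) = inj₂ (spanned-exc (inj₁ (refl , ≤-refl)) w)
  ... | inj₂ (refl , inj₂ w) = inj₂ (spanned-exc (inj₂ (refl , refl)) w)

-- The bounds for crossing pairs, without shiftedness

cross-sum₁ : ∀ l {t} {P Q : Fam n} → n ≡ suc l + t → suc l ≤ t → Unif (suc l) P → Unif (suc l) Q → Cross P Q →
             1 ≤ ♯ P → 1 ≤ ♯ Q → ♯ P + ♯ Q + bin t (suc l) ≤ suc (bin n (suc l))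
cross-sum₁ {n} l {t} {P} {Q} e le u v c p q =
  subst₂ (λ a b → a + b + bin t (suc l) ≤ suc (bin n (suc l))) ♯P ♯Q
    (cross-bound₁ l {P = P′} {Q′} e le sP sQ uP uQ cross (≤-trans p (≤-reflexive (sym ♯P)))
        (≤-trans q (≤-reflexive (sym ♯Q))))
  where open ShiftedPair (shift-pair P Q u v c)

cross-sum₂ : ∀ k {t} {P Q : Fam n} → n ≡ 3 + k + suc t → suc (suc k) ≤ t →
             Unif (3 + k) P → Unif (3 + k) Q → Cross P Q → 2 ≤ ♯ P → 2 ≤ ♯ Q →
             ♯ P + ♯ Q + loss (2 + k) t ≤ 2 + bin n (3 + k)
cross-sum₂ {n} k {t} {P} {Q} e le u v c p q =
  subst₂ (λ a b → a + b + loss (2 + k) t ≤ 2 + bin n (3 + k)) ♯P ♯Q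
    (cross-bound₂ k {P = P′} {Q′} e le sP sQ uP uQ cross (≤-trans p (≤-reflexive (sym ♯P)))
        (≤-trans q (≤-reflexive (sym ♯Q))))
  where open ShiftedPair (shift-pair P Q u v c)

-- Two-colourings forced by crossing

None : Fam n → Set
None F = ∀ x → F x ≡ false

♯-none : {F : Fam n} → None F → ♯ F ≤ 0
♯-none h = ≤-reflexive (♯-empty h)

full-♯ : ∀ {r} {F : Fam n} → (∀ x → ∣ x ∣ ≡ r → F ∋ x) → bin n r ≤ ♯ F
full-♯ {n} {r} {F} h = ≤-trans (≤-reflexive (sym (♯-size r n))) (♯-mono {F = λ x → ∣ x ∣ ≡ᵇ r} {F} λ x p → h x
    (≡ᵇ-true p))

disjoint-♯ : ∀ {r} {F G : Fam n} → Unif r F → Unif r G → (∀ x → F ∋ x → G ∋ x → ⊥) → ♯ F + ♯ G ≤ bin n r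
disjoint-♯ {n} {r} {F} {G} u v d = ≤-trans
  (♯-disjoint {F = F} {G} {λ x → ∣ x ∣ ≡ᵇ r} d (λ x p → ≡ᵇ-intro (u x p)) (λ x p → ≡ᵇ-intro (v x p)))
      (≤-reflexive (♯-size r n))

cover-♯ : ∀ {r} {F G : Fam n} → (∀ x → ∣ x ∣ ≡ r → F x ∨ G x ≡ true) → bin n r ≤ ♯ F + ♯ G
cover-♯ {F = F} {G} h = ≤-trans (full-♯ {F = F ∪ᶠ G} h) (≤-trans (m≤m+n _ _) (≤-reflexive (♯-∪∩ F G)))

-- Four families of r-sets: Pa, Qa (and Pb, Qb) are disjoint, and the crossing
-- conditions leave no room for both a P and a Q unless one side disappears.
module Four {n r} {Pa Pb Qa Qb : Fam n} (uPa : Unif r Pa) (uPb : Unif r Pb) (uQa : Unif r Qa) (uQb : Unif r Qb)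
            (ab : Cross Pa Qb) (ba : Cross Pb Qa)
            (da : ∀ x → Pa ∋ x → Qa ∋ x → ⊥) (db : ∀ x → Pb ∋ x → Qb ∋ x → ⊥) where

  Outcome : Set
  Outcome = (None Pa × None Pb) ⊎ (None Qa × None Qb)

  conclude : (1 ≤ ♯ Pa → 1 ≤ ♯ Qb → ⊥) → (1 ≤ ♯ Pb → 1 ≤ ♯ Qa → ⊥) →
             suc (bin n r) ≤ ♯ Pa + ♯ Qa + (♯ Pb + ♯ Qb) → Outcome
  conclude na nb big with search Pa | search Pb | search Qa | search Qb
  ... | inj₂ a | inj₂ b | _ | _ = inj₁ (a , b)
  ... | _ | _ | inj₂ a | inj₂ b = inj₂ (a , b)
  ... | inj₁ (x , p) | _ | _ | inj₁ (y , q) = ⊥-elim (na (♯-pos {F = Pa} p) (♯-pos {F = Qb} q))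
  ... | _ | inj₁ (x , p) | inj₁ (y , q) | _ = ⊥-elim (nb (♯-pos {F = Pb} p) (♯-pos {F = Qa} q))
  ... | inj₁ _ | inj₂ b | inj₁ _ | inj₂ d = contradiction (linear (♯ Pa ∷ ♯ Qa ∷ ♯ Pb ∷ ♯ Qb ∷ bin n r ∷ [])
        ((con 1 ⊕ x4 ≼ x0 ⊕ x1 ⊕ (x2 ⊕ x3)) ∷ (x0 ⊕ x1 ≼ x4) ∷ (x2 ≼ con 0) ∷ (x3 ≼ con 0) ∷ []) (con 1) (con 0)
        (big , disjoint-♯ uPa uQa da , ♯-none b , ♯-none d , tt)) λ ()
  ... | inj₂ a | inj₁ _ | inj₂ c | inj₁ _ = contradiction (linear (♯ Pa ∷ ♯ Qa ∷ ♯ Pb ∷ ♯ Qb ∷ bin n r ∷ [])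
        ((con 1 ⊕ x4 ≼ x0 ⊕ x1 ⊕ (x2 ⊕ x3)) ∷ (x2 ⊕ x3 ≼ x4) ∷ (x0 ≼ con 0) ∷ (x1 ≼ con 0) ∷ []) (con 1) (con 0)
        (big , disjoint-♯ uPb uQb db , ♯-none a , ♯-none c , tt)) λ ()

-- Crossing singletons coincide, so if Pa and Qb are both nonempty, each has one member. The total
-- is then at most n + 1, or 4 if the other two are nonempty as well; both lie below n + 2.
four-points : {Pa Pb Qa Qb : Fam n} → Unif 1 Pa → Unif 1 Pb → Unif 1 Qa → Unif 1 Qb → Cross Pa Qb → Cross Pb Qa →
              (∀ x → Pa ∋ x → Qa ∋ x → ⊥) → (∀ x → Pb ∋ x → Qb ∋ x → ⊥) → 3 ≤ n →
              2 + n ≤ ♯ Pa + ♯ Qa + (♯ Pb + ♯ Qb) → (None Pa × None Pb) ⊎ (None Qa × None Qb)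
four-points {n} {Pa} {Pb} {Qa} {Qb} uPa uPb uQa uQb ab ba da db 3≤n big =
  conclude (clash big uPa uPb uQa uQb ab ba da db)
           (clash (≤-trans big (≤-reflexive (+-comm (♯ Pa + ♯ Qa) _))) uPb uPa uQb uQa ba ab db da)
           (≤-trans (≤-trans (s≤s (≤-reflexive (bin-1 n))) (n≤1+n _)) big)
  where
  open Four uPa uPb uQa uQb ab ba da db
  clash : {Pa Pb Qa Qb : Fam n} → 2 + n ≤ ♯ Pa + ♯ Qa + (♯ Pb + ♯ Qb) → Unif 1 Pa → Unif 1 Pb → Unif 1 Qa → Unif 1 Qb
      →
          Cross Pa Qb → Cross Pb Qa → (∀ x → Pa ∋ x → Qa ∋ x → ⊥) → (∀ x → Pb ∋ x → Qb ∋ x → ⊥) →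
          1 ≤ ♯ Pa → 1 ≤ ♯ Qb → ⊥
  clash {Pa} {Pb} {Qa} {Qb} big uPa uPb uQa uQb ab ba da db p q = final (search Pb) (search Qa)
    where
    one : ∀ {F G : Fam n} → Unif 1 F → Unif 1 G → Cross F G → 1 ≤ ♯ G → ♯ F ≤ 1
    one {F} {G} u v c g = let x , x∈ = ♯-member G g in ≤-trans (♯-w1 {F = F} u λ y y∈ → c y x y∈ x∈) (≤-reflexive (v x x∈))
    Pa≤1 = one {Pa} {Qb} uPa uQb ab q
    Qb≤1 = one {Qb} {Pa} uQb uPa (Cross-sym {F = Pa} {Qb} ab) p
    a≤n : ♯ Pa + ♯ Qa ≤ n
    a≤n = ≤-trans (disjoint-♯ uPa uQa da) (≤-reflexive (bin-1 n))
    b≤n : ♯ Pb + ♯ Qb ≤ n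
    b≤n = ≤-trans (disjoint-♯ uPb uQb db) (≤-reflexive (bin-1 n))
    ρ : Vec ℕ 5
    ρ = ♯ Pa ∷ ♯ Qa ∷ ♯ Pb ∷ ♯ Qb ∷ n ∷ []
    final : (∃[ x ] Pb ∋ x) ⊎ None Pb → (∃[ x ] Qa ∋ x) ⊎ None Qa → ⊥
    final (inj₂ b) _ = contradiction (linear ρ ((con 2 ⊕ x4 ≼ x0 ⊕ x1 ⊕ (x2 ⊕ x3)) ∷ (x0 ⊕ x1 ≼ x4) ∷ (x3 ≼ con 1) ∷
        (x2 ≼ con 0) ∷ []) (con 1) (con 0)
      (big , a≤n , Qb≤1 , ♯-none b , tt)) λ ()
    final (inj₁ _) (inj₂ a) = contradiction (linear ρ ((con 2 ⊕ x4 ≼ x0 ⊕ x1 ⊕ (x2 ⊕ x3)) ∷ (x2 ⊕ x3 ≼ x4) ∷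
        (x0 ≼ con 1) ∷ (x1 ≼ con 0) ∷ []) (con 1) (con 0)
      (big , b≤n , Pa≤1 , ♯-none a , tt)) λ ()
    final (inj₁ (x , x∈)) (inj₁ (y , y∈)) = contradiction
      (linear ρ ((con 2 ⊕ x4 ≼ x0 ⊕ x1 ⊕ (x2 ⊕ x3)) ∷ (x0 ≼ con 1) ∷ (x3 ≼ con 1) ∷ (x1 ≼ con 1) ∷ (x2 ≼ con 1) ∷
          (con 3 ≼ x4) ∷ []) (con 1) (con 0)
        (big , Pa≤1 , Qb≤1 , one {Qa} {Pb} uQa uPb (Cross-sym {F = Pb} {Qa} ba) (♯-pos {F = Pb} x∈) , one {Pb} {Qa}
            uPb uQa ba (♯-pos {F = Qa} y∈) , 3≤n , tt)) λ ()

-- A crossing pair has at most C(n, 2) edges in total, and strictly fewer if both graphs are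
-- nonempty, since `cross-sum₁` then deducts at least 2 against its summand 1.
four-edges : ∀ {t} {Pa Pb Qa Qb : Fam n} → Unif 2 Pa → Unif 2 Pb → Unif 2 Qa → Unif 2 Qb → Cross Pa Qb → Cross Pb Qa →
              (∀ x → Pa ∋ x → Qa ∋ x → ⊥) → (∀ x → Pb ∋ x → Qb ∋ x → ⊥) → n ≡ 2 + t → 3 ≤ t →
              bin n 2 + bin n 2 ≤ ♯ Pa + ♯ Qa + (♯ Pb + ♯ Qb) → (None Pa × None Pb) ⊎ (None Qa × None Qb)
four-edges {n} {t} {Pa} {Pb} {Qa} {Qb} uPa uPb uQa uQb ab ba da db e 3≤t big =
  conclude (λ p q → contradiction (linear (♯ Pa ∷ ♯ Qa ∷ ♯ Pb ∷ ♯ Qb ∷ bin n 2 ∷ [])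
               ((x4 ⊕ x4 ≼ x0 ⊕ x1 ⊕ (x2 ⊕ x3)) ∷ (con 1 ⊕ (x0 ⊕ x3) ≼ x4) ∷ (x2 ⊕ x1 ≼ x4) ∷ []) (con 1) (con 0)
               (big , strict uPa uQb ab p q , weak uPb uQa ba , tt)) λ ())
           (λ p q → contradiction (linear (♯ Pa ∷ ♯ Qa ∷ ♯ Pb ∷ ♯ Qb ∷ bin n 2 ∷ [])
               ((x4 ⊕ x4 ≼ x0 ⊕ x1 ⊕ (x2 ⊕ x3)) ∷ (con 1 ⊕ (x2 ⊕ x1) ≼ x4) ∷ (x0 ⊕ x3 ≼ x4) ∷ []) (con 1) (con 0)
               (big , strict uPb uQa ba p q , weak uPa uQb ab , tt)) λ ())
           (≤-trans (+-monoˡ-≤ (bin n 2) (bin-pos (≤-trans (m≤m+n 2 t) (≤-reflexive (sym e))))) big)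
  where
  open Four uPa uPb uQa uQb ab ba da db
  strict : ∀ {F G : Fam n} → Unif 2 F → Unif 2 G → Cross F G → 1 ≤ ♯ F → 1 ≤ ♯ G → suc (♯ F + ♯ G) ≤ bin n 2
  strict {F} {G} u v c f g = linear (♯ F ∷ ♯ G ∷ bin t 2 ∷ bin n 2 ∷ [])
    ((x0 ⊕ x1 ⊕ x2 ≼ con 1 ⊕ x3) ∷ (con 2 ≼ x2) ∷ []) (con 1 ⊕ (x0 ⊕ x1)) x3
    (cross-sum₁ 1 e (≤-trans (n≤1+n 2) 3≤t) u v c f g , bin-≥2 3≤t , tt)
  weak : ∀ {F G : Fam n} → Unif 2 F → Unif 2 G → Cross F G → ♯ F + ♯ G ≤ bin n 2
  weak {F} {G} u v c with search F | search G
  ... | inj₂ f | _ = ≤-trans (+-mono-≤ (♯-none f) (♯-unif G v)) ≤-refl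
  ... | inj₁ _ | inj₂ g = ≤-trans (+-mono-≤ (♯-unif F u) (♯-none g)) (≤-reflexive (+-identityʳ _))
  ... | inj₁ (x , x∈) | inj₁ (y , y∈) = <⇒≤ (strict u v c (♯-pos {F = F} x∈) (♯-pos {F = G} y∈))

extract₂ : ∀ {s} (e : Subset (2 + n)) → ∣ e ∣ ≡ 2 + s → ∃[ φ ] ∃[ e′ ] (to φ (true ∷ true ∷ e′) ≡ e × ∣ e′ ∣ ≡ s)
extract₂ e p =
  let φ , e₁ , q , s₁ = extract e p
      ψ , e₂ , q′ , s₂ = extract e₁ s₁
  in φ ∘ˢ liftˢ ψ , e₂ , trans (cong (λ v → to φ (true ∷ v)) q′) q , s₂

extract₃ : ∀ {s} (e : Subset (3 + n)) → ∣ e ∣ ≡ 3 + s →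
           ∃[ φ ] ∃[ e′ ] (to φ (true ∷ true ∷ true ∷ e′) ≡ e × ∣ e′ ∣ ≡ s)
extract₃ e p =
  let φ , e₁ , q , s₁ = extract e p
      ψ , e₂ , q′ , s₂ = extract₂ e₁ s₁
  in φ ∘ˢ liftˢ ψ , e₂ , trans (cong (λ v → to φ (true ∷ v)) q′) q , s₂

contains-to : (φ : Sym n) {c : Subset n} {F : Fam n} → Contains c (F ∘ to φ) → Contains (to φ c) F
contains-to φ {c} {F} h x p = trans (cong (sub (to φ c)) (sym (to-from φ x)))
  (trans (sub-to φ c (from φ x)) (h (from φ x) (subst (F ∋_) (sym (to-from φ x)) p)))

module Pair {n r} {P Q : Fam (2 + n)} {z : Subset n} (z0 : ∣ z ∣ ≡ 0) (uP : Unif (suc r) P) (uQ : Unif (suc r) Q)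
    (c : Cross P Q)
            (hP : Hits (true ∷ true ∷ z) P) (hQ : Hits (true ∷ true ∷ z) Q)
            (excl : ∀ x → P ∋ x → Q ∋ x → sub (true ∷ true ∷ z) x ≡ true) where

  Four⇒ : Set
  Four⇒ = (None (P ⁺ ⁻) × None (P ⁻ ⁺)) ⊎ (None (Q ⁺ ⁻) × None (Q ⁻ ⁺))

  contains : ∀ {F : Fam (2 + n)} → Hits (true ∷ true ∷ z) F → None (F ⁺ ⁻) × None (F ⁻ ⁺) → Contains
      (true ∷ true ∷ z) F
  contains h (a , b) (true ∷ true ∷ x)   p = sub-∅ z x z0
  contains h (a , b) (true ∷ false ∷ x)  p = ⊥-elim (true≢false p (a x))
  contains h (a , b) (false ∷ true ∷ x)  p = ⊥-elim (true≢false p (b x))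
  contains h (a , b) (false ∷ false ∷ x) p = ⊥-elim (true≢false (h (false ∷ false ∷ x) p)
      (trans (meet-sym x z) (meet-empty z x z0)))

  done : Four⇒ → Contains (true ∷ true ∷ z) Q ⊎ Contains (true ∷ true ∷ z) P
  done (inj₁ w) = inj₂ (contains {P} hP w)
  done (inj₂ w) = inj₁ (contains {Q} hQ w)

  none : ∀ {F : Fam (2 + n)} → Hits (true ∷ true ∷ z) F → None (F ⁻ ⁻)
  none h x = ¬true λ p → true≢false (h (false ∷ false ∷ x) p) (trans (meet-sym x z) (meet-empty z x z0))

  ab : Cross (P ⁺ ⁻) (Q ⁻ ⁺)
  ab x y = c (true ∷ false ∷ x) (false ∷ true ∷ y)
  ba : Cross (P ⁻ ⁺) (Q ⁺ ⁻)
  ba x y = c (false ∷ true ∷ x) (true ∷ false ∷ y)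
  da : ∀ x → (P ⁺ ⁻) ∋ x → (Q ⁺ ⁻) ∋ x → ⊥
  da x p q = case excl (true ∷ false ∷ x) p q of λ ()
  db : ∀ x → (P ⁻ ⁺) ∋ x → (Q ⁻ ⁺) ∋ x → ⊥
  db x p q = case excl (false ∷ true ∷ x) p q of λ ()

  slices : ∀ {b l} → 2 + b ≤ ♯ P + ♯ Q + l → 2 + b ≤ ♯ (P ⁺ ⁻) + ♯ (Q ⁺ ⁻) + (♯ (P ⁻ ⁺) + ♯ (Q ⁻ ⁺)) +
      (♯ (P ⁺ ⁺) + ♯ (Q ⁺ ⁺)) + l
  slices {b} {l} big = linear (♯ (P ⁻ ⁻) ∷ ♯ (P ⁻ ⁺) ∷ ♯ (P ⁺ ⁻) ∷ ♯ (P ⁺ ⁺) ∷ ♯ (Q ⁻ ⁻) ∷ ♯ (Q ⁻ ⁺) ∷ ♯ (Q ⁺ ⁻) ∷ ♯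
      (Q ⁺ ⁺) ∷ b ∷ l ∷ [])
    ((con 2 ⊕ x8 ≼ x0 ⊕ x1 ⊕ (x2 ⊕ x3) ⊕ (x4 ⊕ x5 ⊕ (x6 ⊕ x7)) ⊕ x9) ∷ (x0 ≼ con 0) ∷ (x4 ≼ con 0) ∷ [])
    (con 2 ⊕ x8) (x2 ⊕ x6 ⊕ (x1 ⊕ x5) ⊕ (x3 ⊕ x7) ⊕ x9) (big , ♯-none (none {P} hP) , ♯-none (none {Q} hQ) , tt)

-- Colour a set of size r + 1 meeting e in one point according to whether it lies in P or in Q:
-- the size of P and Q forces a single colour.
pair-colours : ∀ r {t} {P Q : Fam (2 + n)} {e : Subset (2 + n)} → 1 ≤ r → r ≤ 2 → n ≡ r + t → r < t → ∣ e ∣ ≡ 2 →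
               Unif (suc r) P → Unif (suc r) Q → Cross P Q → Hits e P → Hits e Q →
               (∀ x → P ∋ x → Q ∋ x → sub e x ≡ true) → 2 + bin (2 + n) (suc r) ≤ ♯ P + ♯ Q + loss r t →
               Contains e Q ⊎ Contains e P
pair-colours {n} r {t} {P} {Q} {e} 1≤r r≤2 n≡ r<t se uP uQ c hP hQ excl big =
  let φ , z , e≡ , z0 = extract₂ e se in conclude φ z e≡ z0
  where
  conclude : ∀ φ z → to φ (true ∷ true ∷ z) ≡ e → ∣ z ∣ ≡ 0 → Contains e Q ⊎ Contains e P
  conclude φ z refl z0 = back (go r refl 1≤r r≤2 n≡)
    where
    P′ Q′ : Fam (2 + n)
    P′ = P ∘ to φ
    Q′ = Q ∘ to φ
    uP′ : Unif (suc r) P′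
    uP′ = unif-to φ uP
    uQ′ : Unif (suc r) Q′
    uQ′ = unif-to φ uQ
    open Pair {r = r} {P = P′} {Q′} z0 uP′ uQ′ (cross-to φ {P} {Q} c)
      (hits-to φ {F = P} hP) (hits-to φ {F = Q} hQ) (λ x p q → trans (sym (sub-to φ _ x)) (excl (to φ x) p q))
    back : Four⇒ → Contains e Q ⊎ Contains e P
    back w with done w
    ... | inj₁ h = inj₁ (contains-to φ {F = Q} h)
    ... | inj₂ h = inj₂ (contains-to φ {F = P} h)
    big′ : 2 + bin (2 + n) (suc r) ≤ ♯ P′ + ♯ Q′ + loss r t
    big′ = subst₂ (λ a b → 2 + bin (2 + n) (suc r) ≤ a + b + loss r t) (sym (♯-to φ P)) (sym (♯-to φ Q)) big
    S₄ : ℕ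
    S₄ = ♯ (P′ ⁺ ⁻) + ♯ (Q′ ⁺ ⁻) + (♯ (P′ ⁻ ⁺) + ♯ (Q′ ⁻ ⁺))
    go : ∀ j → j ≡ r → 1 ≤ j → j ≤ 2 → n ≡ j + t → Four⇒
    go (suc zero) refl _ _ refl = four-points {Pa = P′ ⁺ ⁻} {P′ ⁻ ⁺} {Q′ ⁺ ⁻} {Q′ ⁻ ⁺}
      (unif⁻ (unif⁺ uP′)) (unif⁺ (unif⁻ uP′)) (unif⁻ (unif⁺ uQ′)) (unif⁺ (unif⁻ uQ′)) ab ba da db (s≤s r<t)
      (linear (S₄ ∷ ♯ (P′ ⁺ ⁺) ∷ ♯ (Q′ ⁺ ⁺) ∷ bin t 1 ∷ bin (suc t) 2 ∷ n ∷ [])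
        ( (con 2 ⊕ (con 1 ⊕ (con 1 ⊕ x3) ⊕ (con 1 ⊕ x3 ⊕ x4)) ≼ x0 ⊕ (x1 ⊕ x2) ⊕ (x4 ⊕ x3)) ∷ (x1 ≼ con 1) ∷
            (x2 ≼ con 1)
        ∷ (x5 ≼ con 1 ⊕ x3) ∷ [])
        (con 2 ⊕ x5) x0
        ( slices big′ , ♯-unif (P′ ⁺ ⁺) (unif⁺ (unif⁺ uP′)) , ♯-unif (Q′ ⁺ ⁺) (unif⁺ (unif⁺ uQ′)) , ≤-reflexive
            (sym (bin-1 n)) , tt))
    go (suc (suc zero)) refl _ _ refl = four-edges {Pa = P′ ⁺ ⁻} {P′ ⁻ ⁺} {Q′ ⁺ ⁻} {Q′ ⁻ ⁺}
      (unif⁻ (unif⁺ uP′)) (unif⁺ (unif⁻ uP′)) (unif⁻ (unif⁺ uQ′)) (unif⁺ (unif⁻ uQ′)) ab ba da db refl r<t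
      (linear (S₄ ∷ ♯ (P′ ⁺ ⁺) ∷ ♯ (Q′ ⁺ ⁺) ∷ bin t 1 ∷ bin t 2 ∷ bin (suc t) 3 ∷ bin n 2 ∷ [])
        ( (con 2 ⊕ (con 2 ⊕ x3 ⊕ x6 ⊕ (x6 ⊕ (x3 ⊕ x4 ⊕ x5))) ≼ x0 ⊕ (x1 ⊕ x2) ⊕ (x5 ⊕ x4))
        ∷ (x1 ≼ con 2 ⊕ x3) ∷ (x2 ≼ con 2 ⊕ x3) ∷ [])
        (x6 ⊕ x6) x0
        ( slices big′ , ♯-unif (P′ ⁺ ⁺) (unif⁺ (unif⁺ uP′)) , ♯-unif (Q′ ⁺ ⁺) (unif⁺ (unif⁺ uQ′)) , tt))
    go (suc (suc (suc j))) refl _ (s≤s (s≤s ())) _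

-- Points and edges are coloured p or q, and crossing means that a point and
-- an edge avoiding it get the same colour.
colour : {p₁ q₁ p₂ q₂ : Fam n} → 4 ≤ n → Unif 1 p₁ → Unif 1 q₁ → Unif 2 p₂ → Unif 2 q₂ →
         (∀ x → ∣ x ∣ ≡ 1 → p₁ x ∨ q₁ x ≡ true) → (∀ x → ∣ x ∣ ≡ 2 → p₂ x ∨ q₂ x ≡ true) →
         Cross p₁ q₂ → Cross q₁ p₂ → (None q₁ × None q₂) ⊎ (None p₁ × None p₂)
colour {n} {p₁} {q₁} {p₂} {q₂} 4≤n u₁ v₁ u₂ v₂ f₁ f₂ pq qp = main (search q₂) (search p₂)
  where
  no-points : ∀ {a b c : Fam n} → Unif 1 a → Unif 2 b → None c → (∀ x → ∣ x ∣ ≡ 2 → b x ∨ c x ≡ true) → Cross a b →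
      None a
  no-points {a} {b} {c} u v none f cr x = ¬true λ x∈ → contradiction
    (linear (♯ b ∷ bin (co x) 2 ∷ bin n 2 ∷ [])
      ((x2 ≼ x0) ∷ (x0 ⊕ x1 ≼ x2) ∷ (con 2 ≼ x1) ∷ []) (con 1) (con 0)
      ( full-♯ (λ y s → case ∨-true {b y} (f y s) of λ { (inj₁ q) → q ; (inj₂ q) → ⊥-elim (true≢false q (none y)) })
      , ♯-hits {R = b} {x} v (λ y y∈ → trans (meet-sym y x) (cr x y x∈ y∈))
      , bin-≥2 (s≤s⁻¹ (≤-trans 4≤n (≤-reflexive (trans (sym (size+co x)) (cong (_+ co x) (u x x∈))))))
      , tt)) λ ()
  main : (∃[ x ] q₂ ∋ x) ⊎ None q₂ → (∃[ x ] p₂ ∋ x) ⊎ None p₂ → (None q₁ × None q₂) ⊎ (None p₁ × None p₂)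
  main (inj₂ none) _ = inj₁ (no-points {q₁} {p₂} {q₂} v₁ u₂ none f₂ qp , none)
  main (inj₁ _) (inj₂ none) = inj₂ (no-points {p₁} {q₂} {p₂} u₁ v₂ none
      (λ x s → trans (∨-comm (q₂ x) (p₂ x)) (f₂ x s)) pq , none)
  main (inj₁ (x , x∈)) (inj₁ (y , y∈)) = contradiction
    (linear (♯ p₂ ∷ ♯ q₂ ∷ bin n 2 ∷ [])
      ((x2 ≼ x0 ⊕ x1) ∷ (x0 ≼ con 1) ∷ (x1 ≼ con 1) ∷ (con 6 ≼ x2) ∷ []) (con 1) (con 0)
      ( cover-♯ f₂
      , few v₁ u₂ qp (linear (♯ p₁ ∷ ♯ q₁ ∷ n ∷ []) ((x2 ≼ x0 ⊕ x1) ∷ (x0 ≼ con 2) ∷ (con 4 ≼ x2) ∷ []) (con 2) x1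
          (all , p≤2 , 4≤n , tt))
      , few u₁ v₂ pq (linear (♯ p₁ ∷ ♯ q₁ ∷ n ∷ []) ((x2 ≼ x0 ⊕ x1) ∷ (x1 ≼ con 2) ∷ (con 4 ≼ x2) ∷ []) (con 2) x0
          (all , q≤2 , 4≤n , tt))
      , bin-mono 2 4≤n , tt)) λ ()
    where
    p≤2 : ♯ p₁ ≤ 2
    p≤2 = ≤-trans (♯-w1 {F = p₁} {x} u₁ λ z z∈ → pq z x z∈ x∈) (≤-reflexive (v₂ x x∈))
    q≤2 : ♯ q₁ ≤ 2
    q≤2 = ≤-trans (♯-w1 {F = q₁} {y} v₁ λ z z∈ → qp z y z∈ y∈) (≤-reflexive (u₂ y y∈))
    all : n ≤ ♯ p₁ + ♯ q₁
    all = ≤-trans (≤-reflexive (sym (bin-1 n))) (cover-♯ f₁)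
    few : ∀ {a b : Fam n} → Unif 1 a → Unif 2 b → Cross a b → 2 ≤ ♯ a → ♯ b ≤ 1
    few {a} {b} u v cr two =
      let x , y , x∈ , y∈ , x≢y = ♯-two a two
      in ≤-trans (♯-w2 {F = b} {x} {y} (¬true λ m → x≢y (meet-singletons x y (u x x∈) (u y y∈) m)) v
                    (λ z z∈ → trans (meet-sym z x) (cr x z x∈ z∈)) (λ z z∈ → trans (meet-sym z y) (cr y z y∈ z∈)))
           (≤-reflexive (cong₂ _*_ (u x x∈) (u y y∈)))

clash : {p q : Fam n} → 4 ≤ n → Unif 2 q → (∀ x → ∣ x ∣ ≡ 2 → p ∋ x) → (∀ x → ∣ x ∣ ≡ 2 → q ∋ x) → Cross p q → ⊥
clash {n} {p} {q} 4≤n v f g c =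
  let x , x∈ = ♯-member (λ z → ∣ z ∣ ≡ᵇ 2) (≤-trans (bin-pos (≤-trans (s≤s (s≤s z≤n)) 4≤n))
          (≤-reflexive (sym (♯-size 2 n))))
      sx = ≡ᵇ-true {∣ x ∣} x∈
  in contradiction (linear (♯ q ∷ bin (co x) 2 ∷ bin n 2 ∷ []) ((x2 ≼ x0) ∷ (x0 ⊕ x1 ≼ x2) ∷ (con 1 ≼ x1) ∷ [])
      (con 1) (con 0)
       ( full-♯ g , ♯-hits {R = q} {x} v (λ y y∈ → trans (meet-sym y x) (c x y (f x sx) y∈))
       , bin-pos (s≤s⁻¹ (s≤s⁻¹ (≤-trans 4≤n (≤-reflexive (trans (sym (size+co x)) (cong (_+ co x) sx)))))) , tt)) λ ()

inG-to : (φ : Sym n) (e v x : Subset n) → inG (to φ e) (to φ v) (to φ x) ≡ inG e v x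
inG-to φ e v x = cong₂ _∨_ (sub-to φ e x) (cong₂ _∧_ (meet-to φ v x) (meet-to φ x e))

exc-to : ∀ {r} (φ : Sym n) {H : Fam n} → Exc r (H ∘ to φ) → Exc r H
exc-to {r = r} φ {H} (exc e v sv d se inside) = exc (to φ e) (to φ v) (trans (size-to φ v) sv)
    (trans (meet-to φ v e) d)
  (subst (λ a → (a ≡ 2 × r ≤ 2) ⊎ (a ≡ 3 × r ≡ 2)) (sym (size-to φ e)) se)
  λ x x∈ → subst (λ y → inG (to φ e) (to φ v) y ≡ true) (to-from φ x)
    (trans (inG-to φ e v (from φ x)) (inside (from φ x) (subst (H ∋_) (sym (to-from φ x)) x∈)))

sub⇒meet : (e x : Subset n) → 1 ≤ ∣ e ∣ → sub e x ≡ true → meet x e ≡ true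
sub⇒meet (true ∷ e)  (true ∷ x) p q = refl
sub⇒meet (false ∷ e) (b ∷ x)    p q = ∨-injʳ {b ∧ false} (sub⇒meet e x p q)

-- Members through v must hit e, the others must contain e. For 4-sets both sizes of e give the same
-- bound, because C(t+3, 3) - C(t+3, 2) = C(t+2, 3) - C(t+2, 1), and this number is `loss 2 t` minus
-- 2.
count-G : ∀ {t} {F : Fam (suc n)} {e v : Subset (suc n)} → n ≡ 4 + suc t → ∣ v ∣ ≡ 1 → meet v e ≡ false →
          ∣ e ∣ ≡ 2 ⊎ ∣ e ∣ ≡ 3 → Unif 4 F → (∀ x → F ∋ x → inG e v x ≡ true) → ♯ F + loss 2 t ≤ 2 + bin n 3
count-G {n} {t} {F} {e} {v} n≡ sv d se u inside =
  let φ , z , v≡ , z0 = extract v sv in go φ z v≡ z0 (from φ e) (to-from φ e)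
  where
  Goal : Set
  Goal = ♯ F + loss 2 t ≤ 2 + bin n 3
  go : ∀ φ z → to φ (true ∷ z) ≡ v → ∣ z ∣ ≡ 0 → ∀ e′ → to φ e′ ≡ e → Goal
  go φ z refl z0 (true ∷ e′) refl = ⊥-elim (true≢false refl (trans (sym (meet-to φ (true ∷ z) (true ∷ e′))) d))
  go φ z refl z0 (false ∷ e′) refl = subst (λ a → a + loss 2 t ≤ 2 + bin n 3) (♯-to φ F) (size se)
    where
    G : Fam (suc n)
    G = F ∘ to φ
    uG : Unif 4 G
    uG = unif-to φ u
    in′ : ∀ x → G ∋ x → inG (false ∷ e′) (true ∷ z) x ≡ true
    in′ x p = trans (sym (inG-to φ (false ∷ e′) (true ∷ z) x)) (inside (to φ x) p)
    hits : 1 ≤ ∣ e′ ∣ → Hits e′ (G ⁺)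
    hits l x p with ∨-true (in′ (true ∷ x) p)
    ... | inj₁ q = sub⇒meet e′ x l q
    ... | inj₂ q = q
    contains : Contains e′ (G ⁻)
    contains x p with ∨-true (in′ (false ∷ x) p)
    ... | inj₁ q = q
    ... | inj₂ q = ⊥-elim (true≢false (proj₁ (∧-true q)) (meet-empty z x z0))
    size : ∣ to φ (false ∷ e′) ∣ ≡ 2 ⊎ ∣ to φ (false ∷ e′) ∣ ≡ 3 → ♯ G + loss 2 t ≤ 2 + bin n 3
    size (inj₁ s) = linear (♯ (G ⁻) ∷ ♯ (G ⁺) ∷ bin n 3 ∷ bin (suc t) 3 ∷ bin t 2 ∷ bin t 1 ∷ [])
      ((x1 ⊕ (con 1 ⊕ x5 ⊕ (x5 ⊕ x4) ⊕ ((x5 ⊕ x4) ⊕ x3)) ≼ x2) ∷ (x0 ≼ con 2 ⊕ x5 ⊕ (con 1 ⊕ x5 ⊕ (x5 ⊕ x4))) ∷ [])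
      (x0 ⊕ x1 ⊕ (x3 ⊕ x4)) (con 2 ⊕ x2)
      ( subst (λ a → ♯ (G ⁺) + bin a 3 ≤ bin n 3) c (♯-hits {R = G ⁺} {e′} (unif⁺ uG)
          (hits (≤-trans (s≤s z≤n) (≤-reflexive (sym s′)))))
      , subst (λ a → ♯ (G ⁻) ≤ bin a 2) c (♯-contains 2 {e′} {G ⁻} (λ x p → trans (uG _ p) (cong (_+ 2) (sym s′)))
          contains) , tt)
      where
      s′ : ∣ e′ ∣ ≡ 2
      s′ = trans (sym (size-to φ (false ∷ e′))) s
      c : co e′ ≡ 3 + t
      c = co-size e′ n≡ s′
    size (inj₂ s) = linear (♯ (G ⁻) ∷ ♯ (G ⁺) ∷ bin n 3 ∷ bin (suc t) 3 ∷ bin t 2 ∷ bin t 1 ∷ [])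
      ((x1 ⊕ ((x5 ⊕ x4) ⊕ x3) ≼ x2) ∷ (x0 ≼ con 2 ⊕ x5) ∷ [])
      (x0 ⊕ x1 ⊕ (x3 ⊕ x4)) (con 2 ⊕ x2)
      ( subst (λ a → ♯ (G ⁺) + bin a 3 ≤ bin n 3) c (♯-hits {R = G ⁺} {e′} (unif⁺ uG)
          (hits (≤-trans (s≤s z≤n) (≤-reflexive (sym s′)))))
      , subst (λ a → ♯ (G ⁻) ≤ bin a 1) c (♯-contains 1 {e′} {G ⁻} (λ x p → trans (uG _ p) (cong (_+ 1) (sym s′)))
          contains) , tt)
      where
      s′ : ∣ e′ ∣ ≡ 3
      s′ = trans (sym (size-to φ (false ∷ e′))) s
      c : co e′ ≡ 2 + t
      c = co-size e′ n≡ s′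

-- Members are sorted by their trace on the three core points. A trace of two points and its
-- complementary trace leave one and two outer points respectively, which is the situation of
-- `colour`.
module Triple {n} {P Q : Fam (3 + n)} {z : Subset n} (4≤n : 4 ≤ n) (z0 : ∣ z ∣ ≡ 0)
              (uP : Unif 3 P) (uQ : Unif 3 Q) (c : Cross P Q)
              (hP : Hits (true ∷ true ∷ true ∷ z) P) (hQ : Hits (true ∷ true ∷ true ∷ z) Q)
              (full : ∀ x → ∣ x ∣ ≡ 3 → meet x (true ∷ true ∷ true ∷ z) ≡ true → P x ∨ Q x ≡ true) where

  slice : Fam (3 + n) → Bool → Bool → Bool → Fam n
  slice F a b c x = F (a ∷ b ∷ c ∷ x)

  Absent : Fam (3 + n) → Bool → Bool → Bool → Set
  Absent F a b c = None (slice F (not a) (not b) (not c)) × None (slice F a b c)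

  Side : Bool → Bool → Bool → Set
  Side a b c = Absent Q a b c ⊎ Absent P a b c

  side₁ : Side true false false
  side₁ = colour 4≤n (λ x p → +-cancelˡ-≡ 2 _ _ (uP _ p)) (λ x p → +-cancelˡ-≡ 2 _ _ (uQ _ p))
      (λ x p → +-cancelˡ-≡ 1 _ _ (uP _ p)) (λ x p → +-cancelˡ-≡ 1 _ _ (uQ _ p))
    (λ x s → full (false ∷ true ∷ true ∷ x) (cong (2 +_) s) refl) (λ x s → full (true ∷ false ∷ false ∷ x)
        (cong (1 +_) s) refl)
    (λ x y → c (false ∷ true ∷ true ∷ x) (true ∷ false ∷ false ∷ y))
        (λ x y p q → Cross-sym {F = P} {Q} c (false ∷ true ∷ true ∷ x) (true ∷ false ∷ false ∷ y) p q)

  side₂ : Side false true false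
  side₂ = colour 4≤n (λ x p → +-cancelˡ-≡ 2 _ _ (uP _ p)) (λ x p → +-cancelˡ-≡ 2 _ _ (uQ _ p))
      (λ x p → +-cancelˡ-≡ 1 _ _ (uP _ p)) (λ x p → +-cancelˡ-≡ 1 _ _ (uQ _ p))
    (λ x s → full (true ∷ false ∷ true ∷ x) (cong (2 +_) s) refl) (λ x s → full (false ∷ true ∷ false ∷ x)
        (cong (1 +_) s) refl)
    (λ x y → c (true ∷ false ∷ true ∷ x) (false ∷ true ∷ false ∷ y))
        (λ x y p q → Cross-sym {F = P} {Q} c (true ∷ false ∷ true ∷ x) (false ∷ true ∷ false ∷ y) p q)

  side₃ : Side false false true
  side₃ = colour 4≤n (λ x p → +-cancelˡ-≡ 2 _ _ (uP _ p)) (λ x p → +-cancelˡ-≡ 2 _ _ (uQ _ p))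
      (λ x p → +-cancelˡ-≡ 1 _ _ (uP _ p)) (λ x p → +-cancelˡ-≡ 1 _ _ (uQ _ p))
    (λ x s → full (true ∷ true ∷ false ∷ x) (cong (2 +_) s) refl) (λ x s → full (false ∷ false ∷ true ∷ x)
        (cong (1 +_) s) refl)
    (λ x y → c (true ∷ true ∷ false ∷ x) (false ∷ false ∷ true ∷ y))
        (λ x y p q → Cross-sym {F = P} {Q} c (true ∷ true ∷ false ∷ x) (false ∷ false ∷ true ∷ y) p q)

  -- If two single core points had different colours, all outer edges would occur with each of them,
  -- and two disjoint edges would violate crossing. So the three colours agree.
  both : {p q p′ q′ : Fam n} → Unif 2 p → Unif 2 q → Unif 2 q′ → (∀ x → ∣ x ∣ ≡ 2 → p x ∨ q x ≡ true) →
      (∀ x → ∣ x ∣ ≡ 2 → p′ x ∨ q′ x ≡ true) →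
         Cross p q′ → None q → None p′ → ⊥
  both {p} {q} {p′} {q′} u v w f g cr noq nop = clash {p = p} {q′} 4≤n w
    (λ x s → case ∨-true {p x} (f x s) of λ { (inj₁ h) → h ; (inj₂ h) → ⊥-elim (true≢false h (noq x)) })
    (λ x s → case ∨-true {p′ x} (g x s) of λ { (inj₁ h) → ⊥-elim (true≢false h (nop x)) ; (inj₂ h) → h }) cr

  size₁ : ∀ {F : Fam (3 + n)} → Unif 3 F → Unif 2 (slice F true false false)
  size₁ u x p = +-cancelˡ-≡ 1 _ _ (u _ p)
  size₂ : ∀ {F : Fam (3 + n)} → Unif 3 F → Unif 2 (slice F false true false)
  size₂ u x p = +-cancelˡ-≡ 1 _ _ (u _ p)
  size₃ : ∀ {F : Fam (3 + n)} → Unif 3 F → Unif 2 (slice F false false true)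
  size₃ u x p = +-cancelˡ-≡ 1 _ _ (u _ p)

  full₁ : ∀ x → ∣ x ∣ ≡ 2 → P (true ∷ false ∷ false ∷ x) ∨ Q (true ∷ false ∷ false ∷ x) ≡ true
  full₁ x s = full (true ∷ false ∷ false ∷ x) (cong suc s) refl
  full₂ : ∀ x → ∣ x ∣ ≡ 2 → P (false ∷ true ∷ false ∷ x) ∨ Q (false ∷ true ∷ false ∷ x) ≡ true
  full₂ x s = full (false ∷ true ∷ false ∷ x) (cong suc s) refl
  full₃ : ∀ x → ∣ x ∣ ≡ 2 → P (false ∷ false ∷ true ∷ x) ∨ Q (false ∷ false ∷ true ∷ x) ≡ true
  full₃ x s = full (false ∷ false ∷ true ∷ x) (cong suc s) refl

  contains : ∀ {F : Fam (3 + n)} → Hits (true ∷ true ∷ true ∷ z) F →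
             Absent F true false false → Absent F false true false → Absent F false false true → Contains
                 (true ∷ true ∷ true ∷ z) F
  contains h (a , a′) (b , b′) (c , c′) (true  ∷ true  ∷ true  ∷ x) p = sub-∅ z x z0
  contains h (a , a′) (b , b′) (c , c′) (true  ∷ true  ∷ false ∷ x) p = ⊥-elim (true≢false p (c x))
  contains h (a , a′) (b , b′) (c , c′) (true  ∷ false ∷ true  ∷ x) p = ⊥-elim (true≢false p (b x))
  contains h (a , a′) (b , b′) (c , c′) (true  ∷ false ∷ false ∷ x) p = ⊥-elim (true≢false p (a′ x))
  contains h (a , a′) (b , b′) (c , c′) (false ∷ true  ∷ true  ∷ x) p = ⊥-elim (true≢false p (a x))
  contains h (a , a′) (b , b′) (c , c′) (false ∷ true  ∷ false ∷ x) p = ⊥-elim (true≢false p (b′ x))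
  contains h (a , a′) (b , b′) (c , c′) (false ∷ false ∷ true  ∷ x) p = ⊥-elim (true≢false p (c′ x))
  contains h (a , a′) (b , b′) (c , c′) (false ∷ false ∷ false ∷ x) p =
    ⊥-elim (true≢false (h (false ∷ false ∷ false ∷ x) p) (trans (meet-sym x z) (meet-empty z x z0)))

  conclusion : Contains (true ∷ true ∷ true ∷ z) Q ⊎ Contains (true ∷ true ∷ true ∷ z) P
  conclusion with side₁ | side₂ | side₃
  ... | inj₁ a | inj₁ b | inj₁ d = inj₁ (contains {Q} hQ a b d)
  ... | inj₂ a | inj₂ b | inj₂ d = inj₂ (contains {P} hP a b d)
  ... | inj₁ (_ , a) | inj₂ (_ , b) | _ = ⊥-elim (both (size₁ {P} uP) (size₁ {Q} uQ) (size₂ {Q} uQ) full₁ full₂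
      (λ x y → c (true ∷ false ∷ false ∷ x) (false ∷ true ∷ false ∷ y)) a b)
  ... | inj₂ (_ , a) | inj₁ (_ , b) | _ = ⊥-elim (both (size₂ {P} uP) (size₂ {Q} uQ) (size₁ {Q} uQ) full₂ full₁
      (λ x y → c (false ∷ true ∷ false ∷ x) (true ∷ false ∷ false ∷ y)) b a)
  ... | inj₁ (_ , a) | inj₁ _ | inj₂ (_ , b) = ⊥-elim (both (size₁ {P} uP) (size₁ {Q} uQ) (size₃ {Q} uQ) full₁ full₃
      (λ x y → c (true ∷ false ∷ false ∷ x) (false ∷ false ∷ true ∷ y)) a b)
  ... | inj₂ (_ , a) | inj₂ _ | inj₁ (_ , b) = ⊥-elim (both (size₃ {P} uP) (size₃ {Q} uQ) (size₁ {Q} uQ) full₃ full₁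
      (λ x y → c (false ∷ false ∷ true ∷ x) (true ∷ false ∷ false ∷ y)) b a)

triple-colours : {P Q : Fam (3 + n)} {e : Subset (3 + n)} → 4 ≤ n → ∣ e ∣ ≡ 3 → Unif 3 P → Unif 3 Q → Cross P Q →
                 Hits e P → Hits e Q → (∀ x → ∣ x ∣ ≡ 3 → meet x e ≡ true → P x ∨ Q x ≡ true) →
                     Contains e Q ⊎ Contains e P
triple-colours {n} {P} {Q} {e} 4≤n se uP uQ c hP hQ full = let φ , z , e≡ , z0 = extract₃ e se in go φ z e≡ z0
  where
  go : ∀ φ z → to φ (true ∷ true ∷ true ∷ z) ≡ e → ∣ z ∣ ≡ 0 → Contains e Q ⊎ Contains e P
  go φ z refl z0 with Triple.conclusion {P = P ∘ to φ} {Q ∘ to φ} {z} 4≤n z0 (unif-to φ uP) (unif-to φ uQ)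
      (cross-to φ {P} {Q} c)
                        (hits-to φ {F = P} hP) (hits-to φ {F = Q} hQ)
                            (λ x s m → full (to φ x) (trans (size-to φ x) s) (trans (meet-to φ x _) m))
  ... | inj₁ h = inj₁ (contains-to φ {F = Q} h)
  ... | inj₂ h = inj₂ (contains-to φ {F = P} h)

-- Two kinds of members violate `Both`: those that contain e and avoid v, with one outer point, and
-- those through v that avoid e, with two. `colour` gives them a common colour.
module Mixed {n} {P Q : Fam (3 + n)} {z : Subset (2 + n)} {w : Subset n} (4≤n : 4 ≤ n) (z0 : ∣ z ∣ ≡ 0)
    (w0 : ∣ w ∣ ≡ 0)
             (uP : Unif 3 P) (uQ : Unif 3 Q) (c : Cross P Q) where

  e v : Subset (3 + n)
  e = false ∷ true ∷ true ∷ w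
  v = true ∷ z

  Inside : Fam (3 + n) → Set
  Inside F = ∀ x → F ∋ x → sub e x ∨ meet v x ≡ true

  Absent : Fam (3 + n) → Set
  Absent F = None (λ x → F (false ∷ true ∷ true ∷ x)) × None (λ x → F (true ∷ false ∷ false ∷ x))

  Both : Fam (3 + n) → Set
  Both F = ∀ x → F ∋ x → meet v x ∧ meet x e ≡ true

  both : ∀ {F} → Inside F → Absent F → Both F
  both i (a , b) (false ∷ true  ∷ true  ∷ x) p = ⊥-elim (true≢false p (a x))
  both i (a , b) (false ∷ true  ∷ false ∷ x) p = ⊥-elim (true≢false (i (false ∷ true ∷ false ∷ x) p)
      (meet-empty z (true ∷ false ∷ x) z0))
  both i (a , b) (false ∷ false ∷ d     ∷ x) p = ⊥-elim (true≢false (i (false ∷ false ∷ d ∷ x) p)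
      (meet-empty z (false ∷ d ∷ x) z0))
  both i (a , b) (true  ∷ false ∷ false ∷ x) p = ⊥-elim (true≢false p (b x))
  both i (a , b) (true  ∷ false ∷ true  ∷ x) p = refl
  both i (a , b) (true  ∷ true  ∷ d     ∷ x) p = refl

  conclusion : Inside P → Inside Q → (∀ x → ∣ x ∣ ≡ 3 → sub e x ∨ meet v x ≡ true → P x ∨ Q x ≡ true) →
      Both Q ⊎ Both P
  conclusion iP iQ full with colour {p₁ = λ x → P (false ∷ true ∷ true ∷ x)} {λ x → Q (false ∷ true ∷ true ∷ x)}
      {λ x → P (true ∷ false ∷ false ∷ x)} {λ x → Q (true ∷ false ∷ false ∷ x)} 4≤n
      (λ x p → +-cancelˡ-≡ 2 _ _ (uP _ p)) (λ x p → +-cancelˡ-≡ 2 _ _ (uQ _ p)) (λ x p → +-cancelˡ-≡ 1 _ _ (uP _ p))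
          (λ x p → +-cancelˡ-≡ 1 _ _ (uQ _ p))
      (λ x s → full (false ∷ true ∷ true ∷ x) (cong (2 +_) s) (∨-injˡ (sub-∅ w x w0)))
      (λ x s → full (true ∷ false ∷ false ∷ x) (cong suc s) refl)
      (λ x y → c (false ∷ true ∷ true ∷ x) (true ∷ false ∷ false ∷ y))
      (λ x y p q → Cross-sym {F = P} {Q} c (false ∷ true ∷ true ∷ x) (true ∷ false ∷ false ∷ y) p q)
  ... | inj₁ a = inj₁ (both iQ a)
  ... | inj₂ a = inj₂ (both iP a)

mixed-colours : {P Q : Fam (3 + n)} {e v : Subset (3 + n)} → 4 ≤ n → ∣ e ∣ ≡ 2 → ∣ v ∣ ≡ 1 → meet v e ≡ false →
                Unif 3 P → Unif 3 Q → Cross P Q →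
                (∀ x → P ∋ x → sub e x ∨ meet v x ≡ true) → (∀ x → Q ∋ x → sub e x ∨ meet v x ≡ true) →
                (∀ x → ∣ x ∣ ≡ 3 → sub e x ∨ meet v x ≡ true → P x ∨ Q x ≡ true) →
                (∀ x → Q ∋ x → meet v x ∧ meet x e ≡ true) ⊎ (∀ x → P ∋ x → meet v x ∧ meet x e ≡ true)
mixed-colours {n} {P} {Q} {e} {v} 4≤n se sv d uP uQ c iP iQ full =
  let φ , z , v≡ , z0 = extract v sv in first φ z v≡ z0 (from φ e) (to-from φ e)
  where
  Goal : Set
  Goal = (∀ x → Q ∋ x → meet v x ∧ meet x e ≡ true) ⊎ (∀ x → P ∋ x → meet v x ∧ meet x e ≡ true)
  standard : ∀ φ z w → to φ (true ∷ z) ≡ v → to φ (false ∷ true ∷ true ∷ w) ≡ e → ∣ z ∣ ≡ 0 → ∣ w ∣ ≡ 0 → Goal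
  standard φ z w refl refl z0 w0 = finish (M.conclusion (λ x p → trans (sym (or x)) (iP (to φ x) p))
      (λ x p → trans (sym (or x)) (iQ (to φ x) p))
      (λ x s m → full (to φ x) (trans (size-to φ x) s) (trans (or x) m)))
    where
    module M = Mixed {P = P ∘ to φ} {Q ∘ to φ} {z} {w} 4≤n z0 w0 (unif-to φ uP) (unif-to φ uQ) (cross-to φ {P} {Q} c)
    or : ∀ x → sub e (to φ x) ∨ meet v (to φ x) ≡ sub M.e x ∨ meet M.v x
    or x = cong₂ _∨_ (sub-to φ M.e x) (meet-to φ M.v x)
    move : ∀ {F : Fam (3 + n)} → M.Both (F ∘ to φ) → ∀ x → F ∋ x → meet v x ∧ meet x e ≡ true
    move {F} h x p = subst (λ y → meet v y ∧ meet y e ≡ true) (to-from φ x)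
      (trans (cong₂ _∧_ (meet-to φ M.v (from φ x)) (meet-to φ (from φ x) M.e))
          (h (from φ x) (subst (F ∋_) (sym (to-from φ x)) p)))
    finish : M.Both (Q ∘ to φ) ⊎ M.Both (P ∘ to φ) → Goal
    finish (inj₁ h) = inj₁ (move {Q} h)
    finish (inj₂ h) = inj₂ (move {P} h)
  first : ∀ φ z → to φ (true ∷ z) ≡ v → ∣ z ∣ ≡ 0 → ∀ e′ → to φ e′ ≡ e → Goal
  first φ z v≡ z0 (true ∷ e′) e≡ = ⊥-elim (true≢false refl (trans (sym (meet-to φ (true ∷ z) (true ∷ e′)))
      (trans (cong₂ meet v≡ e≡) d)))
  first φ z v≡ z0 (false ∷ e′) e≡ =
    let ψ , w , q , w0 = extract₂ e′ (trans (sym (size-to φ (false ∷ e′))) (trans (cong ∣_∣ e≡) se))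
    in standard (φ ∘ˢ liftˢ ψ) (from ψ z) w (trans (cong (λ a → to φ (true ∷ a)) (to-from ψ z)) v≡)
         (trans (cong (λ a → to φ (false ∷ a)) q) e≡) (trans
             (trans (sym (size-to ψ (from ψ z))) (cong ∣_∣ (to-from ψ z))) z0) w0

-- Tracing 𝓖₂ and 𝓖₃ back through a shift

module Unshift {n} (r : ℕ) {t} (H : Fam (4 + n)) (1≤r : 1 ≤ r) (n≡ : n ≡ r + t) (r<t : r < t)
               (u : Unif (2 + r) H) (c : Cross H H)
               (big : 2 + bin (3 + n) (suc r) ≤ ♯ H + loss r t) where

  S : Fam (4 + n)
  S = shift zero H

  -- With j and i the first two points, P collects the sets through i only and Q those through j
  -- only. In S their union stands at i and their intersection at j, while R and C are unchanged.
  P Q R C : Fam (2 + n)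
  P = H ⁻ ⁺
  Q = H ⁺ ⁻
  R = H ⁺ ⁺
  C = H ⁻ ⁻

  uP : Unif (suc r) P
  uP = unif⁺ (unif⁻ u)
  uQ : Unif (suc r) Q
  uQ = unif⁻ (unif⁺ u)
  cPQ : Cross P Q
  cPQ x y = c (false ∷ true ∷ x) (true ∷ false ∷ y)

  exc-when : ∀ {e v : Subset (4 + n)} → ∣ v ∣ ≡ 1 → meet v e ≡ false → (∣ e ∣ ≡ 2 × r ≤ 2) ⊎ (∣ e ∣ ≡ 3 × r ≡ 2) →
             (∀ x → C ∋ x → inG e v (false ∷ false ∷ x) ≡ true) → (∀ x → P ∋ x → inG e v (false ∷ true ∷ x) ≡ true) →
             (∀ x → Q ∋ x → inG e v (true ∷ false ∷ x) ≡ true) → (∀ x → R ∋ x → inG e v (true ∷ true ∷ x) ≡ true) →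
                 Exc r H
  exc-when {e} {v} sv d se hC hP hQ hR = exc e v sv d se λ
    { (false ∷ false ∷ x) → hC x ; (false ∷ true ∷ x) → hP x ; (true ∷ false ∷ x) → hQ x ; (true ∷ true ∷ x) → hR x }

  module Cases {ej ei xj xi : Bool} {e v : Subset (2 + n)}
               (sv : ∣ xj ∷ xi ∷ v ∣ ≡ 1) (d : meet (xj ∷ xi ∷ v) (ej ∷ ei ∷ e) ≡ false)
               (se : (∣ ej ∷ ei ∷ e ∣ ≡ 2 × r ≤ 2) ⊎ (∣ ej ∷ ei ∷ e ∣ ≡ 3 × r ≡ 2))
               (inside : ∀ x → S ∋ x → inG (ej ∷ ei ∷ e) (xj ∷ xi ∷ v) x ≡ true) where

    inP : ∀ x → P ∋ x → inG (ej ∷ ei ∷ e) (xj ∷ xi ∷ v) (false ∷ true ∷ x) ≡ true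
    inP x p = inside (false ∷ true ∷ x) (∨-injʳ {H (true ∷ false ∷ x)} p)
    inQ : ∀ x → Q ∋ x → inG (ej ∷ ei ∷ e) (xj ∷ xi ∷ v) (false ∷ true ∷ x) ≡ true
    inQ x p = inside (false ∷ true ∷ x) (∨-injˡ p)
    inPQ : ∀ x → P ∋ x → Q ∋ x → inG (ej ∷ ei ∷ e) (xj ∷ xi ∷ v) (true ∷ false ∷ x) ≡ true
    inPQ x p q = inside (true ∷ false ∷ x) (∧-intro q p)
    inR : ∀ x → R ∋ x → inG (ej ∷ ei ∷ e) (xj ∷ xi ∷ v) (true ∷ true ∷ x) ≡ true
    inR x = inside (true ∷ true ∷ x)
    inC : ∀ x → C ∋ x → inG (ej ∷ ei ∷ e) (xj ∷ xi ∷ v) (false ∷ false ∷ x) ≡ true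
    inC x = inside (false ∷ false ∷ x)

    -- If the condition at i implies the condition at j, the members that the shift moved satisfied
    -- it before moving.
    direct : (∀ x → inG (ej ∷ ei ∷ e) (xj ∷ xi ∷ v) (false ∷ true ∷ x) ≡ true → inG (ej ∷ ei ∷ e) (xj ∷ xi ∷ v)
        (true ∷ false ∷ x) ≡ true) → Exc r H
    direct h = exc-when {e = ej ∷ ei ∷ e} {xj ∷ xi ∷ v} sv d se inC inP (λ x q → h x (inQ x q)) inR

  -- When R and C together stay within the number of r-sets, P and Q must account for the rest of H;
  -- this is the largeness that `pair-colours` needs.
  pair-big : ♯ R + ♯ C ≤ bin (2 + n) r → 2 + bin (2 + n) (suc r) ≤ ♯ P + ♯ Q + loss r t
  pair-big rest = linear (♯ C ∷ ♯ P ∷ ♯ Q ∷ ♯ R ∷ loss r t ∷ bin (2 + n) r ∷ bin (2 + n) (suc r) ∷ [])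
    ((con 2 ⊕ (x5 ⊕ x6) ≼ x0 ⊕ x1 ⊕ (x2 ⊕ x3) ⊕ x4) ∷ (x3 ⊕ x0 ≼ x5) ∷ []) (con 2 ⊕ x6) (x1 ⊕ x2 ⊕ x4)
        (big , rest , tt)

  no-v : ∀ {v : Subset (2 + n)} {a : Bool} (x : Subset (2 + n)) → ∣ v ∣ ≡ 0 → meet v x ∧ a ≡ true → ⊥
  no-v {v} x z p = true≢false (proj₁ (∧-true p)) (meet-empty v x z)

  -- The first two points j and i are such that shifting moves j to i. Only three situations are
  -- not symmetric or monotone in j and i: i is the apex and j lies outside the core (apex-pair, apex-triple);
  -- i is the apex and j is in the core (apex-in); i is in the core and j is outside (core-pair).
  apex-pair : ∀ {e v} → ∣ v ∣ ≡ 0 → ∣ e ∣ ≡ 2 → r ≤ 2 → (∀ x → S ∋ x → inG (false ∷ false ∷ e) (false ∷ true ∷ v) x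
      ≡ true) → Exc r H
  apex-pair {e} {v} v0 se r≤2 inside = swap (pair-colours r 1≤r r≤2 n≡ r<t se uP uQ cPQ (hits inP) (hits inQ)
      (λ x p q → only x (inPQ x p q)) (pair-big rest))
    where
    open Cases {false} {false} {false} {true} {e} {v} (cong suc v0) (meet-empty v e v0) (inj₁ (se , r≤2)) inside
    hits : ∀ {F : Fam (2 + n)} → (∀ x → F ∋ x → sub e x ∨ meet x e ≡ true) → Hits e F
    hits h x p = case ∨-true {sub e x} (h x p) of λ { (inj₁ q) → sub⇒meet e x
        (≤-trans (s≤s z≤n) (≤-reflexive (sym se))) q ; (inj₂ q) → q }
    only : ∀ x {a} → sub e x ∨ (meet v x ∧ a) ≡ true → sub e x ≡ true
    only x h = case ∨-true h of λ { (inj₁ q) → q ; (inj₂ q) → ⊥-elim (no-v {v} x v0 q) }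
    -- All members of C contain e, so C is at most as large as the collection of r-sets avoiding e,
    -- and R hits e and lacks all of those.
    rest : ♯ R + ♯ C ≤ bin (2 + n) r
    rest = ≤-trans (+-monoʳ-≤ (♯ R) (♯-contains r {e} {C} (λ x p → trans (u (false ∷ false ∷ x) p)
        (trans (+-comm 2 r) (trans (+-comm r 2) (cong (_+ r) (sym se))))) (λ x p → only x (inC x p))))
      (♯-hits {R = R} {e} (unif⁺ (unif⁺ u)) (hits inR))
    swap : Contains e Q ⊎ Contains e P → Exc r H
    swap (inj₁ q) = exc-when {e = false ∷ false ∷ e} {false ∷ true ∷ v} (cong suc v0) (meet-empty v e v0)
        (inj₁ (se , r≤2)) inC inP (λ x p → ∨-injˡ (q x p)) inR
    swap (inj₂ q) = exc-when {e = false ∷ false ∷ e} {true ∷ false ∷ v} (cong suc v0) (meet-empty v e v0)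
        (inj₁ (se , r≤2)) inC (λ x p → ∨-injˡ (q x p)) inQ inR

  apex-in : ∀ {e v} → ∣ v ∣ ≡ 0 → ∣ e ∣ ≡ 2 → r ≡ 2 → (∀ x → S ∋ x → inG (true ∷ false ∷ e) (false ∷ true ∷ v) x
      ≡ true) → Exc r H
  apex-in {e} {v} v0 se r≡2 inside = swap (pair-colours r 1≤r (≤-reflexive r≡2) n≡ r<t se uP uQ cPQ inP inQ
      (λ x p q → only x (inPQ x p q)) (pair-big rest))
    where
    open Cases {true} {false} {false} {true} {e} {v} (cong suc v0) (meet-empty v e v0) (inj₂ (cong suc se , r≡2)) inside
    only : ∀ x {a} → sub e x ∨ (meet v x ∧ a) ≡ true → sub e x ≡ true
    only x h = case ∨-true h of λ { (inj₁ q) → q ; (inj₂ q) → ⊥-elim (no-v {v} x v0 q) }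
    noC : None C
    noC x = ¬true λ p → no-v {v} x v0 (inC x p)
    rest : ♯ R + ♯ C ≤ bin (2 + n) r
    rest = ≤-trans (+-mono-≤ (♯-unif R (unif⁺ (unif⁺ u))) (♯-none noC)) (≤-reflexive (+-identityʳ _))
    swap : Contains e Q ⊎ Contains e P → Exc r H
    swap (inj₁ q) = exc-when {e = true ∷ false ∷ e} {false ∷ true ∷ v} (cong suc v0) (meet-empty v e v0)
        (inj₂ (cong suc se , r≡2)) inC inP (λ x p → ∨-injˡ (q x p)) inR
    swap (inj₂ q) = exc-when {e = false ∷ true ∷ e} {true ∷ false ∷ v} (cong suc v0) (meet-empty v e v0)
        (inj₂ (cong suc se , r≡2))
      (λ x p → ⊥-elim (true≢false p (noC x))) (λ x p → ∨-injˡ (q x p)) inQ (λ x p → ∨-injʳ {sub e x} refl)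

  -- S is as large as H and so attains the maximum in `count-G`; it is the complete 𝓖₃. The
  -- colourings below need every set of the type to be coloured.
  exact : ∀ {e v} → ∣ v ∣ ≡ 1 → meet v e ≡ false → ∣ e ∣ ≡ 3 → r ≡ 2 → (∀ x → S ∋ x → inG e v x ≡ true) →
          ∀ x → ∣ x ∣ ≡ 4 → inG e v x ≡ true → S ∋ x
  exact {e} {v} sv d se refl inside x sx gx = ♯-equal {F = S} {G}
      (λ y p → ∧-intro (≡ᵇ-intro (unif-shift zero {H} u y p)) (inside y p))
      (+-cancelʳ-≤ (loss 2 t) _ _ (≤-trans
        (count-G {F = G} {e} {v} (cong suc (cong suc (cong suc (trans n≡ (cong suc (+-suc 0 t)))))) sv d (inj₂ se)
            (λ y p → ≡ᵇ-true {∣ y ∣} (proj₁ (∧-true p))) (λ y p → proj₂ (∧-true {∣ y ∣ ≡ᵇ 4} p)))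
        (≤-trans big (≤-reflexive (cong (_+ loss 2 t) (sym (♯-shift zero H)))))))
      x (∧-intro (≡ᵇ-intro sx) gx)
    where
    G : Fam (4 + n)
    G y = (∣ y ∣ ≡ᵇ 4) ∧ inG e v y

  hits-core : ∀ {e : Subset (2 + n)} {F : Fam (2 + n)} → 1 ≤ ∣ e ∣ → (∀ x → F ∋ x → sub e x ∨ meet x e ≡ true) →
      Hits e F
  hits-core {e} l h x p = case ∨-true {sub e x} (h x p) of λ { (inj₁ q) → sub⇒meet e x l q ; (inj₂ q) → q }

  apex-triple : ∀ {e v} → ∣ v ∣ ≡ 0 → ∣ e ∣ ≡ 3 → r ≡ 2 → (∀ x → S ∋ x → inG (false ∷ false ∷ e) (false ∷ true ∷ v) x
      ≡ true) → Exc r H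
  apex-triple {e} {v} v0 se r≡2 inside = swap (colours r≡2 n≡)
    where
    open Cases {false} {false} {false} {true} {e} {v} (cong suc v0) (meet-empty v e v0) (inj₂ (se , r≡2)) inside
    full : ∀ x → ∣ x ∣ ≡ 3 → meet x e ≡ true → P x ∨ Q x ≡ true
    full x s m = trans (∨-comm (P x) (Q x))
      (exact {false ∷ false ∷ e} {false ∷ true ∷ v} (cong suc v0) (meet-empty v e v0) se r≡2 inside
          (false ∷ true ∷ x) (cong suc s) (∨-injʳ {sub e x} m))
    1≤e : 1 ≤ ∣ e ∣
    1≤e = ≤-trans (s≤s z≤n) (≤-reflexive (sym se))
    colours : r ≡ 2 → n ≡ r + t → Contains e Q ⊎ Contains e P
    colours refl refl = triple-colours (s≤s r<t) se uP uQ cPQ (hits-core {F = P} 1≤e inP) (hits-core {F = Q} 1≤e inQ)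
        full
    swap : Contains e Q ⊎ Contains e P → Exc r H
    swap (inj₁ q) = exc-when {e = false ∷ false ∷ e} {false ∷ true ∷ v} (cong suc v0) (meet-empty v e v0)
        (inj₂ (se , r≡2)) inC inP (λ x p → ∨-injˡ (q x p)) inR
    swap (inj₂ q) = exc-when {e = false ∷ false ∷ e} {true ∷ false ∷ v} (cong suc v0) (meet-empty v e v0)
        (inj₂ (se , r≡2)) inC (λ x p → ∨-injˡ (q x p)) inQ inR

  core-pair : ∀ {e v} → ∣ v ∣ ≡ 1 → meet v e ≡ false → ∣ e ∣ ≡ 2 → r ≡ 2 →
      (∀ x → S ∋ x → inG (false ∷ true ∷ e) (false ∷ false ∷ v) x ≡ true) → Exc r H
  core-pair {e} {v} sv d se r≡2 inside = swap (colours r≡2 n≡)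
    where
    open Cases {false} {true} {false} {false} {e} {v} sv d (inj₂ (cong suc se , r≡2)) inside
    or : ∀ x → sub e x ∨ meet v x ∧ true ≡ true → sub e x ∨ meet v x ≡ true
    or x = subst (λ b → sub e x ∨ b ≡ true) (∧-identityʳ (meet v x))
    full : ∀ x → ∣ x ∣ ≡ 3 → sub e x ∨ meet v x ≡ true → P x ∨ Q x ≡ true
    full x s m = trans (∨-comm (P x) (Q x))
      (exact {false ∷ true ∷ e} {false ∷ false ∷ v} sv d (cong suc se) r≡2 inside (false ∷ true ∷ x) (cong suc s)
        (subst (λ b → sub e x ∨ b ≡ true) (sym (∧-identityʳ (meet v x))) m))
    colours : r ≡ 2 → n ≡ r + t → (∀ x → Q ∋ x → meet v x ∧ meet x e ≡ true) ⊎
        (∀ x → P ∋ x → meet v x ∧ meet x e ≡ true)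
    colours refl refl = mixed-colours {e = e} {v} (s≤s r<t) se sv d uP uQ cPQ (λ x p → or x (inP x p))
        (λ x p → or x (inQ x p)) full
    swap : (∀ x → Q ∋ x → meet v x ∧ meet x e ≡ true) ⊎ (∀ x → P ∋ x → meet v x ∧ meet x e ≡ true) → Exc r H
    swap (inj₁ q) = exc-when {e = false ∷ true ∷ e} {false ∷ false ∷ v} sv d (inj₂ (cong suc se , r≡2)) inC inP q inR
    swap (inj₂ q) = exc-when {e = true ∷ false ∷ e} {false ∷ false ∷ v} sv d (inj₂ (cong suc se , r≡2)) inC q inQ inR

  -- 𝓖₂ is symmetric in the three points of its kernel
  kernel : ∀ {e v : Subset (2 + n)} → ∣ e ∣ ≡ 1 → ∣ v ∣ ≡ 1 → ∀ x → inG (false ∷ true ∷ e) (false ∷ false ∷ v) x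
      ≡ true →
           inG (false ∷ false ∷ (e ∪ v)) (false ∷ true ∷ empty) x ≡ true
  kernel {e} {v} se sv (a ∷ true ∷ x) h = ∨-injʳ {sub (e ∪ v) x}
      (∧-intro refl (∨-injʳ {a ∧ false} (trans (meet-∪ x e v) (hit (∨-true h)))))
    where
    hit : ∀ {b} → sub e x ≡ true ⊎ meet v x ∧ b ≡ true → meet x e ∨ meet x v ≡ true
    hit (inj₁ q) = ∨-injˡ (sub⇒meet e x (≤-reflexive (sym se)) q)
    hit (inj₂ q) = ∨-injʳ {meet x e} (trans (meet-sym x v) (proj₁ (∧-true q)))
  kernel {e} {v} se sv (true ∷ false ∷ x) h =
    ∨-injˡ (sub-∪ e v x (sub-singleton e x se (trans (meet-sym e x) (proj₂ (∧-true {meet v x} h))))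
        (sub-singleton v x sv (proj₁ (∧-true h))))
  kernel {e} {v} se sv (false ∷ false ∷ x) h =
    ∨-injˡ (sub-∪ e v x (sub-singleton e x se (trans (meet-sym e x) (proj₂ (∧-true {meet v x} h))))
        (sub-singleton v x sv (proj₁ (∧-true h))))

  unshift : Exc r S → Exc r H
  unshift (exc (ej ∷ ei ∷ e) (xj ∷ xi ∷ v) sv d se inside) = cases ej ei xj xi sv d se inside
    where
    cases : ∀ ej ei xj xi → ∣ xj ∷ xi ∷ v ∣ ≡ 1 → meet (xj ∷ xi ∷ v) (ej ∷ ei ∷ e) ≡ false →
            (∣ ej ∷ ei ∷ e ∣ ≡ 2 × r ≤ 2) ⊎ (∣ ej ∷ ei ∷ e ∣ ≡ 3 × r ≡ 2) →
            (∀ x → S ∋ x → inG (ej ∷ ei ∷ e) (xj ∷ xi ∷ v) x ≡ true) → Exc r H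
    cases false false false false sv d se h = Cases.direct {false} {false} {false} {false} {e} {v} sv d se h λ x p → p
    cases false false true  false sv d se h = Cases.direct {false} {false} {true} {false} {e} {v} sv d se h λ x p →
        case ∨-true {sub e x} p of λ
      { (inj₁ q) → ∨-injˡ q ; (inj₂ q) → ⊥-elim (no-v {v} x (suc-injective sv) q) }
    cases true  false false false sv d se h = Cases.direct {true} {false} {false} {false} {e} {v} sv d se h λ x p →
        ∨-injʳ {sub e x} (∧-intro (proj₁ (∧-true p)) refl)
    cases true  false true  false sv () se h
    cases true  true  false false sv d se h = Cases.direct {true} {true} {false} {false} {e} {v} sv d se h λ x p → p
    cases true  true  true  false sv () se h
    cases false true  true  false sv d se h = Cases.direct {false} {true} {true} {false} {e} {v} sv d se h λ x p →
        case ∨-true {sub e x} p of λ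
      { (inj₁ q) → sub⇒meet e x (positive se) q ; (inj₂ q) → ⊥-elim (no-v {v} x (suc-injective sv) q) }
      where
      positive : (suc ∣ e ∣ ≡ 2 × r ≤ 2) ⊎ (suc ∣ e ∣ ≡ 3 × r ≡ 2) → 1 ≤ ∣ e ∣
      positive (inj₁ (s , _)) = ≤-reflexive (sym (suc-injective s))
      positive (inj₂ (s , _)) = ≤-trans (s≤s z≤n) (≤-reflexive (sym (suc-injective s)))
    -- The kernel of 𝓖₂ can be renamed so that i becomes the apex.
    cases false true  false false sv d (inj₁ (s , r≤2)) h = apex-pair {e ∪ v} {empty} (size-empty (2 + n))
      (trans (size-∪ e v (trans (meet-sym e v) d)) (cong₂ _+_ (suc-injective s) sv)) r≤2
          (λ x p → kernel {e} {v} (suc-injective s) sv x (h x p))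
    cases false true  false false sv d (inj₂ (s , r≡2)) h = core-pair {e} {v} sv d (suc-injective s) r≡2 h
    cases ej    ei    true  true  () d se h
    cases true  true  false true  sv () se h
    cases false true  false true  sv () se h
    cases false false false true  sv d (inj₁ (s , r≤2)) h = apex-pair {e} {v} (suc-injective sv) s r≤2 h
    cases false false false true  sv d (inj₂ (s , r≡2)) h = apex-triple {e} {v} (suc-injective sv) s r≡2 h
    cases true  false false true  sv d (inj₁ (s , r≤2)) h = Cases.direct {true} {false} {false} {true} {e} {v} sv d
        (inj₁ (s , r≤2)) h λ x p →
      ∨-injˡ (sub-singleton e x (suc-injective s) (trans (meet-sym e x) p))
    cases true  false false true  sv d (inj₂ (s , r≡2)) h = apex-in {e} {v} (suc-injective sv) (suc-injective s) r≡2 h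

-- Shifts that would destroy the codegree condition

module Edges {n} {Pu Pv Qu Qv Q₀ : Fam n} (3≤n : 3 ≤ n)
             (uPu : Unif 1 Pu) (uPv : Unif 1 Pv) (uQu : Unif 1 Qu) (uQv : Unif 1 Qv) (uQ₀ : Unif 2 Q₀)
             (uv : Cross Pu Qv) (vu : Cross Pv Qu) (0u : Cross Q₀ Pu) (0v : Cross Q₀ Pv) where

  one : ∀ {F G : Fam n} → Unif 1 F → Unif 1 G → Cross F G → 1 ≤ ♯ G → ♯ F ≤ 1
  one {F} {G} u v c g = let x , x∈ = ♯-member G g in ≤-trans (♯-w1 {F = F} u λ y y∈ → c y x y∈ x∈) (≤-reflexive (v x x∈))

  points : ∀ {F : Fam n} → Unif 1 F → ♯ F ≤ n
  points {F} u = ≤-trans (♯-unif F u) (≤-reflexive (bin-1 n))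

  pair-sum : ∀ {F G : Fam n} → Unif 1 F → Unif 1 G → Cross F G → ♯ F + ♯ G ≤ n
  pair-sum {F} {G} u v c with search F | search G
  ... | inj₂ f | _ = ≤-trans (+-monoˡ-≤ (♯ G) (♯-none f)) (points v)
  ... | inj₁ _ | inj₂ g = ≤-trans (+-mono-≤ (points u) (♯-none g)) (≤-reflexive (+-identityʳ n))
  ... | inj₁ (x , x∈) | inj₁ (y , y∈) = ≤-trans (+-mono-≤ (one {F} {G} u v c (♯-pos {F = G} y∈))
      (one {G} {F} v u (Cross-sym {F = F} {G} c) (♯-pos {F = F} x∈)))
      (≤-trans (n≤1+n 2) 3≤n)

  few-edges : ∀ {F : Fam n} → Unif 1 F → Cross Q₀ F → 1 ≤ ♯ F → suc (♯ Q₀) ≤ n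
  few-edges {F} u c f =
    let x , x∈ = ♯-member F f
        n≡ = trans (cong (_+ co x) (sym (u x x∈))) (size+co x)
    in linear (♯ Q₀ ∷ bin (co x) 2 ∷ bin (co x) 1 ∷ n ∷ co x ∷ [])
         ((x0 ⊕ x1 ≼ x2 ⊕ x1) ∷ (x2 ≼ x4) ∷ (con 1 ⊕ x4 ≼ x3) ∷ []) (con 1 ⊕ x0) x3
         ( subst (λ a → ♯ Q₀ + bin (co x) 2 ≤ bin a 2) (sym n≡) (♯-hits {R = Q₀} {x} uQ₀ (λ y y∈ → c y x y∈ x∈))
         , ≤-reflexive (bin-1 (co x)) , ≤-reflexive n≡ , tt)

  one-edge : ∀ {F : Fam n} → Unif 1 F → Cross Q₀ F → 2 ≤ ♯ F → ♯ Q₀ ≤ 1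
  one-edge {F} u c f =
    let x , y , x∈ , y∈ , x≢y = ♯-two F f
    in ≤-trans (♯-w2 {F = Q₀} {x} {y} (¬true λ m → x≢y (meet-singletons x y (u x x∈) (u y y∈) m)) uQ₀
        (λ z z∈ → c z x z∈ x∈) (λ z z∈ → c z y z∈ y∈))
         (≤-reflexive (cong₂ _*_ (u x x∈) (u y y∈)))

  two-points : ∀ {F : Fam n} → Unif 1 F → Cross Q₀ F → 1 ≤ ♯ Q₀ → ♯ F ≤ 2
  two-points {F} u c q = let x , x∈ = ♯-member Q₀ q in ≤-trans (♯-w1 {F = F} {x} u λ y y∈ → trans (meet-sym y x) (c x y x∈ y∈)) (≤-reflexive (uQ₀ x x∈))

  small-sum : ∀ {F G : Fam n} → Unif 1 F → Unif 1 G → Cross F G → Cross Q₀ F → 1 ≤ ♯ Q₀ → 1 ≤ ♯ F → ♯ F + ♯ G ≤ 2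
  small-sum {F} {G} u v c d q f with search G
  ... | inj₂ g = ≤-trans (+-mono-≤ (two-points {F} u d q) (♯-none g)) ≤-refl
  ... | inj₁ (y , y∈) = +-mono-≤ (one {F} {G} u v c (♯-pos {F = G} y∈)) (one {G} {F} v u (Cross-sym {F = F} {G} c) f)

-- The links of the ends u, v of an edge of Q that is not in P; Q₀ consists of
-- the edges of Q that avoid u and v.
edges-bound : ∀ {n} {Pu Pv Qu Qv Q₀ : Fam n} → 3 ≤ n → Unif 1 Pu → Unif 1 Pv → Unif 1 Qu → Unif 1 Qv → Unif 2 Q₀ →
              Cross Pu Qv → Cross Pv Qu → Cross Q₀ Pu → Cross Q₀ Pv → 1 ≤ ♯ Pu + ♯ Pv →
              (♯ Pu + ♯ Pv ≤ 1 → (∀ x → Pu ∋ x → Qu ∋ x → ⊥) × (∀ x → Pv ∋ x → Qv ∋ x → ⊥)) →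
              ♯ Pu + ♯ Pv + (♯ Qu + ♯ Qv + ♯ Q₀) ≤ n + n
edges-bound {n} {Pu} {Pv} {Qu} {Qv} {Q₀} 3≤n uPu uPv uQu uQv uQ₀ uv vu 0u 0v nonempty disj = main (search Q₀)
    (search Pu) (search Pv)
  where
  module E = Edges 3≤n uPu uPv uQu uQv uQ₀ uv vu 0u 0v
  ρ : Vec ℕ 6
  ρ = ♯ Pu ∷ ♯ Pv ∷ ♯ Qu ∷ ♯ Qv ∷ ♯ Q₀ ∷ n ∷ []
  goal : Exp 6
  goal = x0 ⊕ x1 ⊕ (x2 ⊕ x3 ⊕ x4)
  Goal : Set
  Goal = eval goal ρ ≤ n + n
  main : (∃[ x ] Q₀ ∋ x) ⊎ None Q₀ → (∃[ x ] Pu ∋ x) ⊎ None Pu → (∃[ x ] Pv ∋ x) ⊎ None Pv → Goal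
  main (inj₂ q) _ _ = linear ρ ((x4 ≼ con 0) ∷ (x0 ⊕ x3 ≼ x5) ∷ (x1 ⊕ x2 ≼ x5) ∷ []) goal (x5 ⊕ x5)
    (♯-none q , E.pair-sum uPu uQv uv , E.pair-sum uPv uQu vu , tt)
  main (inj₁ _) (inj₂ a) (inj₂ b) = contradiction (≤-trans nonempty (+-mono-≤ (♯-none a) (♯-none b))) λ ()
  main (inj₁ (x , x∈)) (inj₁ (y , y∈)) (inj₁ (z , z∈)) = linear ρ
    ((x0 ⊕ x3 ≼ con 2) ∷ (x1 ⊕ x2 ≼ con 2) ∷ (con 1 ⊕ x4 ≼ x5) ∷ (con 3 ≼ x5) ∷ []) goal (x5 ⊕ x5)
    ( E.small-sum {Pu} {Qv} uPu uQv uv 0u (♯-pos {F = Q₀} x∈) (♯-pos {F = Pu} y∈) , E.small-sum {Pv} {Qu} uPv uQu vu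
        0v (♯-pos {F = Q₀} x∈) (♯-pos {F = Pv} z∈)
    , E.few-edges {Pu} uPu 0u (♯-pos {F = Pu} y∈) , 3≤n , tt)
  main (inj₁ (x , x∈)) (inj₁ (y , y∈)) (inj₂ b) with ♯ Pu ≤? 1
  ... | no two = linear ρ ((x0 ⊕ x3 ≼ con 2) ∷ (x1 ≼ con 0) ∷ (x2 ≼ x5) ∷ (x4 ≼ con 1) ∷ (con 3 ≼ x5) ∷ []) goal
      (x5 ⊕ x5)
    (E.small-sum {Pu} {Qv} uPu uQv uv 0u (♯-pos {F = Q₀} x∈) (♯-pos {F = Pu} y∈) , ♯-none b , E.points uQu ,
        E.one-edge {Pu} uPu 0u (≰⇒> two) , 3≤n , tt)
  ... | yes single = linear ρ ((x0 ⊕ x3 ≼ con 2) ∷ (x1 ≼ con 0) ∷ (x0 ⊕ x2 ≼ x5) ∷ (con 1 ≼ x0) ∷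
      (con 1 ⊕ x4 ≼ x5) ∷ []) goal (x5 ⊕ x5)
    ( E.small-sum {Pu} {Qv} uPu uQv uv 0u (♯-pos {F = Q₀} x∈) (♯-pos {F = Pu} y∈) , ♯-none b
    , ≤-trans (disjoint-♯ uPu uQu (proj₁ (disj (≤-trans (+-mono-≤ single (♯-none b)) ≤-refl))))
        (≤-reflexive (bin-1 n))
    , ♯-pos {F = Pu} y∈ , E.few-edges {Pu} uPu 0u (♯-pos {F = Pu} y∈) , tt)
  main (inj₁ (x , x∈)) (inj₂ a) (inj₁ (y , y∈)) with ♯ Pv ≤? 1
  ... | no two = linear ρ ((x1 ⊕ x2 ≼ con 2) ∷ (x0 ≼ con 0) ∷ (x3 ≼ x5) ∷ (x4 ≼ con 1) ∷ (con 3 ≼ x5) ∷ []) goal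
      (x5 ⊕ x5)
    (E.small-sum {Pv} {Qu} uPv uQu vu 0v (♯-pos {F = Q₀} x∈) (♯-pos {F = Pv} y∈) , ♯-none a , E.points uQv ,
        E.one-edge {Pv} uPv 0v (≰⇒> two) , 3≤n , tt)
  ... | yes single = linear ρ ((x1 ⊕ x2 ≼ con 2) ∷ (x0 ≼ con 0) ∷ (x1 ⊕ x3 ≼ x5) ∷ (con 1 ≼ x1) ∷
      (con 1 ⊕ x4 ≼ x5) ∷ []) goal (x5 ⊕ x5)
    ( E.small-sum {Pv} {Qu} uPv uQu vu 0v (♯-pos {F = Q₀} x∈) (♯-pos {F = Pv} y∈) , ♯-none a
    , ≤-trans (disjoint-♯ uPv uQv (proj₂ (disj (+-mono-≤ (♯-none a) single)))) (≤-reflexive (bin-1 n))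
    , ♯-pos {F = Pv} y∈ , E.few-edges {Pv} uPv 0v (♯-pos {F = Pv} y∈) , tt)

-- For an edge e of Q outside P, every edge of P has exactly one end in e. `edges-bound` counts
-- everything except e itself, which is the added 1.
graphs-bound : {P Q : Fam (2 + n)} → 3 ≤ n → Unif 2 P → Unif 2 Q → Cross P Q → 1 ≤ ♯ P → ♯ (P ∩ᶠ Q) < ♯ Q →
               (♯ P ≤ 1 → ♯ (P ∩ᶠ Q) ≤ 0) → ♯ P + ♯ Q ≤ suc (n + n)
graphs-bound {n} {P} {Q} 3≤n uP uQ c p fewer single with search (λ x → Q x ∧ not (P x))
... | inj₂ none = contradiction (≤-trans fewer (♯-mono {F = Q} {P ∩ᶠ Q} λ x x∈ → ∧-intro
    (not-false λ f → true≢false (∧-intro x∈ (cong not f)) (none x)) x∈)) 1+n≰n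
... | inj₁ (e , w) = let q∈ , p∉ = ∧-true {Q e} w
                         φ , z , e≡ , z0 = extract₂ e (uQ e q∈)
                     in go φ z e≡ z0 q∈ (not-true p∉)
  where
  go : ∀ φ z → to φ (true ∷ true ∷ z) ≡ e → ∣ z ∣ ≡ 0 → Q e ≡ true → P e ≡ false → ♯ P + ♯ Q ≤ suc (n + n)
  go φ z refl z0 q∈ p∉ = subst₂ (λ a b → a + b ≤ suc (n + n)) (♯-to φ P) (♯-to φ Q)
    (linear (♯ (P′ ⁻ ⁻) ∷ ♯ (P′ ⁻ ⁺) ∷ ♯ (P′ ⁺ ⁻) ∷ ♯ (P′ ⁺ ⁺) ∷ ♯ (Q′ ⁻ ⁻) ∷ ♯ (Q′ ⁻ ⁺) ∷ ♯ (Q′ ⁺ ⁻) ∷ ♯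
        (Q′ ⁺ ⁺) ∷ n ∷ [])
      ((x2 ⊕ x1 ⊕ (x6 ⊕ x5 ⊕ x4) ≼ x8 ⊕ x8) ∷ (x0 ≼ con 0) ∷ (x3 ≼ con 0) ∷ (x7 ≼ con 1) ∷ [])
      (x0 ⊕ x1 ⊕ (x2 ⊕ x3) ⊕ (x4 ⊕ x5 ⊕ (x6 ⊕ x7))) (con 1 ⊕ (x8 ⊕ x8))
      ( edges-bound {Pu = P′ ⁺ ⁻} {P′ ⁻ ⁺} {Q′ ⁺ ⁻} {Q′ ⁻ ⁺} {Q′ ⁻ ⁻} 3≤n
          (unif⁻ (unif⁺ uP′)) (unif⁺ (unif⁻ uP′)) (unif⁻ (unif⁺ uQ′)) (unif⁺ (unif⁻ uQ′)) (unif⁻ (unif⁻ uQ′))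
          (λ x y → c′ (true ∷ false ∷ x) (false ∷ true ∷ y)) (λ x y → c′ (false ∷ true ∷ x) (true ∷ false ∷ y))
          (λ x y x∈ y∈ → trans (meet-sym x y) (c′ (true ∷ false ∷ y) (false ∷ false ∷ x) y∈ x∈))
          (λ x y x∈ y∈ → trans (meet-sym x y) (c′ (false ∷ true ∷ y) (false ∷ false ∷ x) y∈ x∈))
          (≤-trans p (≤-trans (≤-reflexive ♯P) split)) (λ s → let none = single (≤-trans (≤-reflexive ♯P) (≤-trans split s)) in
            disjoint none (λ x → true ∷ false ∷ x) , disjoint none (λ x → false ∷ true ∷ x))
      , ♯-none none₀ , ♯-none none₂ , ♯-unif (Q′ ⁺ ⁺) (unif⁺ (unif⁺ uQ′)) , tt))
    where
    P′ Q′ : Fam (2 + n)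
    P′ = P ∘ to φ
    Q′ = Q ∘ to φ
    uP′ : Unif 2 P′
    uP′ = unif-to φ uP
    uQ′ : Unif 2 Q′
    uQ′ = unif-to φ uQ
    c′ : Cross P′ Q′
    c′ = cross-to φ {P} {Q} c
    ♯P : ♯ P ≡ ♯ P′
    ♯P = sym (♯-to φ P)
    none₀ : None (P′ ⁻ ⁻)
    none₀ x = ¬true λ x∈ → true≢false (c′ (false ∷ false ∷ x) (true ∷ true ∷ z) x∈ q∈)
        (trans (meet-sym x z) (meet-empty z x z0))
    none₂ : None (P′ ⁺ ⁺)
    none₂ x = ¬true λ x∈ → true≢false (subst (λ y → P′ (true ∷ true ∷ y) ≡ true)
        (size-0 (suc-injective (suc-injective (uP′ _ x∈))) z0) x∈) p∉
    split : ♯ P′ ≤ ♯ (P′ ⁺ ⁻) + ♯ (P′ ⁻ ⁺)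
    split = linear (♯ (P′ ⁻ ⁻) ∷ ♯ (P′ ⁻ ⁺) ∷ ♯ (P′ ⁺ ⁻) ∷ ♯ (P′ ⁺ ⁺) ∷ []) ((x0 ≼ con 0) ∷ (x3 ≼ con 0) ∷ [])
        (x0 ⊕ x1 ⊕ (x2 ⊕ x3)) (x2 ⊕ x1)
      (♯-none none₀ , ♯-none none₂ , tt)
    disjoint : ♯ (P ∩ᶠ Q) ≤ 0 → (f : Subset n → Subset (2 + n)) → ∀ x → P′ ∋ f x → Q′ ∋ f x → ⊥
    disjoint none f x p q = contradiction (≤-trans (♯-pos {F = P ∩ᶠ Q} {to φ (f x)} (∧-intro p q)) none) λ ()

exc-cong : ∀ {r} {H G : Fam n} → (∀ x → G x ≡ H x) → Exc r H → Exc r G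
exc-cong g (exc e v sv d se h) = exc e v sv d se λ x x∈ → h x (trans (sym (g x)) x∈)

exc-from : ∀ {r} (φ : Sym n) {H : Fam n} → Exc r H → Exc r (H ∘ to φ)
exc-from {r = r} φ {H} (exc e v sv d se h) = exc (from φ e) (from φ v)
  (trans (size-from v) sv) (trans (trans (sym (meet-to φ (from φ v) (from φ e)))
      (cong₂ meet (to-from φ v) (to-from φ e))) d)
  (subst (λ a → (a ≡ 2 × r ≤ 2) ⊎ (a ≡ 3 × r ≡ 2)) (sym (size-from e)) se)
  λ x x∈ → trans (trans (sym (inG-to φ (from φ e) (from φ v) x)) (cong₂ (λ a b → inG a b (to φ x)) (to-from φ e)
      (to-from φ v))) (h (to φ x) x∈)
  where
  size-from : ∀ y → ∣ from φ y ∣ ≡ ∣ y ∣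
  size-from y = trans (sym (size-to φ (from φ y))) (cong ∣_∣ (to-from φ y))

small-or-big : ∀ r t (H : Fam (suc n)) → Small r t H ⊎ 2 + bin n (suc r) ≤ ♯ H + loss r t
small-or-big {n} r t H with suc (♯ H + loss r t) ≤? 2 + bin n (suc r)
... | yes p = inj₁ p
... | no p  = inj₂ (s≤s⁻¹ (≰⇒> p))

small-cong : ∀ {r t} {H G : Fam (suc n)} → ♯ H ≡ ♯ G → Small r t H → Small r t G
small-cong {n} {r} {t} e = subst (λ a → suc (a + loss r t) ≤ 2 + bin n (suc r)) e

unshift-at : ∀ r {t} (H : Fam (4 + n)) → 1 ≤ r → n ≡ r + t → r < t → Unif (2 + r) H → Cross H H →
             ∀ i → Exc r (shift i H) → Small r t H ⊎ Exc r H
unshift-at {n} r {t} H 1≤r n≡ r<t u c i w with small-or-big r t H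
... | inj₁ s = inj₁ s
... | inj₂ big = inj₂ (exc-to (front i) (Unshift.unshift r (H ∘ to (front i)) 1≤r n≡ r<t (unif-to (front i) u)
    (cross-to (front i) {H} {H} c)
    (≤-trans big (≤-reflexive (cong (_+ loss r t) (sym (♯-to (front i) H)))))
    (exc-cong (λ x → sym (shift-front i H x)) (exc-from (front i) w))))

-- As no member avoids both j and i, exceptions for P and Q extend to H: a common point is the apex
-- over the core {j, i}, and a common pair joins j or i to form a core of three points with the
-- other as apex.
module Covered {n} (r : ℕ) {t} (H : Fam (4 + n)) (1≤r : 1 ≤ r) (n≡ : n ≡ r + t) (r<t : r < t)
               (u : Unif (2 + r) H) (c : Cross H H) (noC : None (H ⁻ ⁻)) (p : 3 ≤ ♯ (H ⁻ ⁺)) (q : 3 ≤ ♯ (H ⁺ ⁻))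
               (sP : Shifted (H ⁻ ⁺)) (sQ : Shifted (H ⁺ ⁻)) where

  P Q R : Fam (2 + n)
  P = H ⁻ ⁺
  Q = H ⁺ ⁻
  R = H ⁺ ⁺

  cPQ : Cross P Q
  cPQ x y = c (false ∷ true ∷ x) (true ∷ false ∷ y)

  common-point : r ≤ 2 → CommonPoint P Q → Exc r H
  common-point r≤2 (y , sy , hP , hQ) = exc (true ∷ true ∷ empty) (false ∷ false ∷ y) sy
      (trans (meet-sym y empty) (∅-meet y))
    (inj₁ (cong (2 +_) (size-empty (2 + n)) , r≤2)) λ
    { (false ∷ false ∷ x) x∈ → ⊥-elim (true≢false x∈ (noC x))
    ; (false ∷ true ∷ x) x∈ → ∧-intro (trans (meet-sym y x) (hP x x∈)) refl
    ; (true ∷ false ∷ x) x∈ → ∧-intro (trans (meet-sym y x) (hQ x x∈)) refl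
    ; (true ∷ true ∷ x) x∈ → ∨-injˡ (sub-∅ empty x (size-empty (2 + n))) }

  common-pair : r ≡ 2 → CommonPair P Q → Exc r H
  common-pair r≡2 (e , se , hP , hQ) = exc (true ∷ false ∷ e) (false ∷ true ∷ empty) (cong suc (size-empty (2 + n)))
      (∅-meet e)
    (inj₂ (cong suc se , r≡2)) λ
    { (false ∷ false ∷ x) x∈ → ⊥-elim (true≢false x∈ (noC x))
    ; (false ∷ true ∷ x) x∈ → hP x x∈
    ; (true ∷ false ∷ x) x∈ → ∨-injˡ (hQ x x∈)
    ; (true ∷ true ∷ x) x∈ → ∨-injʳ {sub e x} refl }

  common-pair′ : r ≡ 2 → CommonPair Q P → Exc r H
  common-pair′ r≡2 (e , se , hQ , hP) = exc (false ∷ true ∷ e) (true ∷ false ∷ empty) (cong suc (size-empty (2 + n)))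
      (∅-meet e)
    (inj₂ (cong suc se , r≡2)) λ
    { (false ∷ false ∷ x) x∈ → ⊥-elim (true≢false x∈ (noC x))
    ; (false ∷ true ∷ x) x∈ → ∨-injˡ (hP x x∈)
    ; (true ∷ false ∷ x) x∈ → hQ x x∈
    ; (true ∷ true ∷ x) x∈ → ∨-injʳ {sub e x} refl }

  result : Small r t H ⊎ Exc r H
  result = go r refl 1≤r n≡
    where
    go : ∀ j → j ≡ r → 1 ≤ j → n ≡ j + t → Small r t H ⊎ Exc r H
    -- Here t ≥ 2, and the t + 3 points outside j and i number 4 + `pred t`.
    go (suc zero) refl _ refl with cross-graphs (pred t) {P} {Q}
        (cong (3 +_) (sym (suc-pred t {{>-nonZero (<⇒≤ r<t)}}))) sP sQ (unif⁺ (unif⁻ u)) (unif⁻ (unif⁺ u)) cPQ p q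
    ... | inj₂ w = inj₂ (common-point (s≤s z≤n) w)
    ... | inj₁ few = inj₁ (linear (♯ (H ⁻ ⁻) ∷ ♯ P ∷ ♯ Q ∷ ♯ R ∷ bin t 1 ∷ bin (suc t) 2 ∷ t ∷ [])
      ((x0 ≼ con 0) ∷ (x1 ⊕ x2 ≼ con 6) ∷ (x3 ≼ con 3 ⊕ x4) ∷ (con 2 ≼ x6) ∷ (x6 ≼ x4) ∷ [])
      (con 1 ⊕ (x0 ⊕ x1 ⊕ (x2 ⊕ x3) ⊕ (x5 ⊕ x4))) (con 2 ⊕ (con 3 ⊕ x4 ⊕ (con 2 ⊕ x4 ⊕ (con 1 ⊕ x4 ⊕ x5))))
      (♯-none noC , few , ♯-unif R (unif⁺ (unif⁺ u)) , r<t , ≤-reflexive (sym (bin-1 t)) , tt))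
    go (suc (suc k)) refl _ refl with cross-strict k {t} {P} {Q} (cong (3 +_) (sym (+-suc k t))) r<t sP sQ
        (unif⁺ (unif⁻ u)) (unif⁻ (unif⁺ u)) cPQ p q
    ... | inj₁ s = inj₁ (linear (♯ (H ⁻ ⁻) ∷ ♯ P ∷ ♯ Q ∷ ♯ R ∷ loss r t ∷ bin (2 + n) r ∷ bin (2 + n) (suc r) ∷ [])
      ((x0 ≼ con 0) ∷ (con 1 ⊕ (x1 ⊕ x2 ⊕ x4) ≼ con 2 ⊕ x6) ∷ (x3 ≼ x5) ∷ [])
      (con 1 ⊕ (x0 ⊕ x1 ⊕ (x2 ⊕ x3) ⊕ x4)) (con 2 ⊕ (x5 ⊕ x6))
      (♯-none noC , s , ♯-unif R (unif⁺ (unif⁺ u)) , tt))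
    ... | inj₂ (refl , inj₁ w) = inj₂ (common-point ≤-refl w)
    ... | inj₂ (refl , inj₂ (inj₁ w)) = inj₂ (common-pair refl w)
    ... | inj₂ (refl , inj₂ (inj₂ w)) = inj₂ (common-pair′ refl w)

shift-none : (i : Fin n) {F : Fam (suc n)} → None F → None (shift i F)
shift-none i {F} h x = ¬true λ p → contradiction (≤-trans (♯-pos {F = shift i F} {x} p)
    (≤-trans (≤-reflexive (♯-shift i F)) (♯-none h))) λ ()

-- Only points beyond the first two are shifted, so the traces on those two keep their sizes and
-- `H ⁻ ⁻` stays empty.
covered : ∀ r {t} (H : Fam (4 + n)) → 1 ≤ r → n ≡ r + t → r < t → Unif (2 + r) H → Cross H H →
          None (H ⁻ ⁻) → 3 ≤ ♯ (H ⁻ ⁺) → 3 ≤ ♯ (H ⁺ ⁻) → Small r t H ⊎ Exc r H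
covered {n} r {t} H 1≤r n≡ r<t u c noC p q = go _ H u c noC p q ≤-refl
  where
  go : ∀ f (H : Fam (4 + n)) → Unif (2 + r) H → Cross H H → None (H ⁻ ⁻) → 3 ≤ ♯ (H ⁻ ⁺) → 3 ≤ ♯ (H ⁺ ⁻) →
       potential (H ⁻ ⁺) + potential (H ⁺ ⁻) ≤ f → Small r t H ⊎ Exc r H
  step : ∀ f (H : Fam (4 + n)) → Unif (2 + r) H → Cross H H → None (H ⁻ ⁻) → 3 ≤ ♯ (H ⁻ ⁺) → 3 ≤ ♯ (H ⁺ ⁻) →
         ∀ i → potential (shift i (H ⁻ ⁺)) + potential (shift i (H ⁺ ⁻)) < f → Small r t H ⊎ Exc r H
  step (suc f) H u c noC p q i (s≤s lt)
    with go f (shift (suc (suc i)) H) (unif-shift (suc (suc i)) {H} u) (cross-shift (suc (suc i)) {H} {H} c)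
        (shift-none i noC)
           (≤-trans p (≤-reflexive (sym (♯-shift i (H ⁻ ⁺))))) (≤-trans q (≤-reflexive (sym (♯-shift i (H ⁺ ⁻))))) lt
  ... | inj₁ s = inj₁ (small-cong {r = r} {t} {shift (suc (suc i)) H} {H} (♯-shift (suc (suc i)) H) s)
  ... | inj₂ w = unshift-at r H 1≤r n≡ r<t u c (suc (suc i)) w
  go f H u c noC p q le with progress (H ⁻ ⁺) | progress (H ⁺ ⁻)
  ... | inj₁ sP | inj₁ sQ = Covered.result r H 1≤r n≡ r<t u c noC p q sP sQ
  ... | inj₂ (i , lt) | _ = step f H u c noC p q i (≤-trans (+-mono-<-≤ lt (potential-shift i (H ⁺ ⁻))) le)
  ... | inj₁ _ | inj₂ (i , lt) = step f H u c noC p q i (≤-trans (+-mono-≤-< (potential-shift i (H ⁻ ⁺)) lt) le)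

-- The hypotheses say that shifting the first point to the second one leaves the
-- second point missed by at most two members.
stuck : ∀ r {t} (H : Fam (4 + n)) → 1 ≤ r → n ≡ r + t → r < t → Unif (2 + r) H → Cross H H →
        ♯ (H ⁻ ⁻) + ♯ (H ⁻ ⁺ ∩ᶠ H ⁺ ⁻) ≤ 2 → 3 ≤ ♯ (H ⁻ ⁻) + ♯ (H ⁻ ⁺) → 3 ≤ ♯ (H ⁻ ⁻) + ♯ (H ⁺ ⁻) →
            Small r t H ⊎ Exc r H
stuck {n} r {t} H 1≤r n≡ r<t u c few p q = cases (♯ C) refl
  where
  P Q R C : Fam (2 + n)
  P = H ⁻ ⁺
  Q = H ⁺ ⁻
  R = H ⁺ ⁺
  C = H ⁻ ⁻
  uP : Unif (suc r) P
  uP = unif⁺ (unif⁻ u)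
  uQ : Unif (suc r) Q
  uQ = unif⁻ (unif⁺ u)
  uR : Unif r R
  uR = unif⁺ (unif⁺ u)
  cPQ : Cross P Q
  cPQ x y = c (false ∷ true ∷ x) (true ∷ false ∷ y)
  cRC : Cross R C
  cRC x y = c (true ∷ true ∷ x) (false ∷ false ∷ y)
  co-C : ∀ {x} → C ∋ x → co x ≡ t
  co-C {x} x∈ = co-size x (cong (2 +_) n≡) (u _ x∈)
  n+2 : ∀ {k} → r ≡ 2 + k → 2 + n ≡ 3 + k + suc t
  n+2 {k} e = trans (cong (2 +_) n≡) (trans (cong (λ a → suc (suc (a + t))) e) (cong (3 +_) (sym (+-suc k t))))
  meetsC₁ : 1 ≤ ♯ C → ♯ R + bin t r ≤ bin (2 + n) r
  meetsC₁ one = let x , x∈ = ♯-member C one in subst (λ a → ♯ R + bin a r ≤ bin (2 + n) r) (co-C x∈) (♯-hits {R = R} {x} uR (λ y y∈ → cRC y x y∈ x∈))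
  meetsC₂ : ∀ {r′ t′} → r ≡ suc r′ → t ≡ suc t′ → 2 ≤ ♯ C → ♯ R + loss r′ t′ ≤ bin (2 + n) r
  meetsC₂ refl refl two = let x , y , x∈ , y∈ , x≢y = ♯-two C two
    in ♯-hits₂ {R = R} x≢y (co-C x∈) (co-C y∈) uR (λ z z∈ → cRC z x z∈ x∈) (λ z z∈ → cRC z y z∈ y∈)
  ρ : Vec ℕ 4
  ρ = ♯ C ∷ ♯ P ∷ ♯ Q ∷ ♯ R ∷ []
  graphs : r ≡ 1 → 1 ≤ ♯ C → ♯ C + ♯ R ≤ 4 → Small r t H ⊎ Exc r H
  graphs refl one four = inj₁ (go n≡)
    where
    go : n ≡ suc t → Small 1 t H
    go refl = linear (♯ C ∷ ♯ P ∷ ♯ Q ∷ ♯ R ∷ bin t 1 ∷ bin (suc t) 2 ∷ t ∷ [])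
      ((x0 ⊕ x3 ≼ con 4) ∷ (x1 ⊕ x2 ≼ con 1 ⊕ ((con 1 ⊕ x6) ⊕ (con 1 ⊕ x6))) ∷ (x6 ≼ x4) ∷ (x6 ≼ x4) ∷ [])
      (con 1 ⊕ (x0 ⊕ x1 ⊕ (x2 ⊕ x3) ⊕ (x5 ⊕ x4))) (con 2 ⊕ (con 3 ⊕ x4 ⊕ (con 2 ⊕ x4 ⊕ (con 1 ⊕ x4 ⊕ x5))))
      ( four
      , graphs-bound {P = P} {Q} (s≤s r<t) uP uQ cPQ (linear (♯ C ∷ ♯ P ∷ ♯ (P ∩ᶠ Q) ∷ [])
          ((con 3 ≼ x0 ⊕ x1) ∷ (x0 ⊕ x2 ≼ con 2) ∷ []) (con 1) x1 (p , few , tt))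
          (linear (♯ C ∷ ♯ Q ∷ ♯ (P ∩ᶠ Q) ∷ []) ((con 3 ≼ x0 ⊕ x1) ∷ (x0 ⊕ x2 ≼ con 2) ∷ []) (con 1 ⊕ x2) x1
              (q , few , tt))
          (λ s → linear (♯ C ∷ ♯ P ∷ ♯ (P ∩ᶠ Q) ∷ []) ((con 3 ≼ x0 ⊕ x1) ∷ (x0 ⊕ x2 ≼ con 2) ∷ (x1 ≼ con 1) ∷ []) x2
              (con 0) (p , few , s , tt))
      , ≤-reflexive (sym (bin-1 t)) , ≤-reflexive (sym (bin-1 t)) , tt)
  -- For r ≥ 2, P and Q still have two members each, and hitting the member of C costs R at least
  -- two sets, one more than C contributes.
  one : ♯ C ≡ 1 → ∀ j → j ≡ r → 1 ≤ j → Small r t H ⊎ Exc r H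
  one e (suc zero) refl _ = graphs refl (≤-reflexive (sym e))
      (linear (♯ C ∷ ♯ R ∷ bin t 1 ∷ []) ((x0 ≼ con 1) ∷ (x1 ⊕ x2 ≼ con 3 ⊕ x2) ∷ []) (x0 ⊕ x1) (con 4)
    (≤-reflexive e , subst (λ a → ♯ R + bin t 1 ≤ bin (2 + a) 1) n≡ (meetsC₁ (≤-reflexive (sym e))) , tt))
  one e (suc (suc k)) refl _ = inj₁ (linear (♯ C ∷ ♯ P ∷ ♯ Q ∷ ♯ R ∷ loss r t ∷ bin (2 + n) r ∷ bin (2 + n)
      (suc r) ∷ bin t r ∷ [])
    ((x0 ≼ con 1) ∷ (x1 ⊕ x2 ⊕ x4 ≼ con 2 ⊕ x6) ∷ (x3 ⊕ x7 ≼ x5) ∷ (con 2 ≼ x7) ∷ [])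
    (con 1 ⊕ (x0 ⊕ x1 ⊕ (x2 ⊕ x3) ⊕ x4)) (con 2 ⊕ (x5 ⊕ x6))
    ( ≤-reflexive e
    , cross-sum₂ k {t} {P} {Q} (n+2 refl) (<⇒≤ r<t) uP uQ cPQ (s≤s⁻¹ (≤-trans p (≤-reflexive (cong (_+ ♯ P) e))))
        (s≤s⁻¹ (≤-trans q (≤-reflexive (cong (_+ ♯ Q) e))))
    , meetsC₁ (≤-reflexive (sym e)) , bin-≥2 r<t , tt))
  -- For r ≥ 2, P and Q are only known to be nonempty, so they are charged `bin (suc t) (suc r)`
  -- with summand 1. R hits both members of C, which yields the remaining `bin t r` and at least 2
  -- more.
  two : ♯ C ≡ 2 → ∀ j s → j ≡ r → s ≡ t → 1 ≤ j → j < s → Small r t H ⊎ Exc r H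
  two e (suc zero) (suc s) refl refl _ _ = graphs refl (≤-trans (s≤s z≤n) (≤-reflexive (sym e)))
    (linear (♯ C ∷ ♯ R ∷ bin s 1 ∷ []) ((x0 ≼ con 2) ∷ (x1 ⊕ (con 1 ⊕ x2 ⊕ con 1) ≼ con 4 ⊕ x2) ∷ []) (x0 ⊕ x1)
        (con 4)
    (≤-reflexive e , subst (λ a → ♯ R + (1 + bin s 1 + 1) ≤ bin (2 + a) 1) n≡
        (meetsC₂ refl refl (≤-reflexive (sym e))) , tt))
  two e (suc (suc k)) (suc s) refl refl _ (s≤s k<s) = inj₁
      (linear (♯ C ∷ ♯ P ∷ ♯ Q ∷ ♯ R ∷ bin (suc t) (suc r) ∷ bin t r ∷ bin (2 + n) r ∷ bin (2 + n) (suc r) ∷ bin s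
      (suc k) ∷ [])
    ((x0 ≼ con 2) ∷ (x1 ⊕ x2 ⊕ x4 ≼ con 1 ⊕ x7) ∷ (x3 ⊕ (x5 ⊕ x8) ≼ x6) ∷ (con 2 ≼ x8) ∷ [])
    (con 1 ⊕ (x0 ⊕ x1 ⊕ (x2 ⊕ x3) ⊕ (x4 ⊕ x5))) (con 2 ⊕ (x6 ⊕ x7))
    ( ≤-reflexive e
    , cross-sum₁ r {suc t} {P} {Q} (n+2 refl) (≤-trans r<t (n≤1+n t)) uP uQ cPQ
        (s≤s⁻¹ (s≤s⁻¹ (≤-trans p (≤-reflexive (cong (_+ ♯ P) e)))))
        (s≤s⁻¹ (s≤s⁻¹ (≤-trans q (≤-reflexive (cong (_+ ♯ Q) e)))))
    , meetsC₂ refl refl (≤-reflexive (sym e)) , bin-≥2 k<s , tt))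
  cases : ∀ a → a ≡ ♯ C → Small r t H ⊎ Exc r H
  cases zero e = covered r H 1≤r n≡ r<t u c (λ x → ¬true λ x∈ → contradiction
      (≤-trans (♯-pos {F = C} x∈) (≤-reflexive (sym e))) λ ())
    (≤-trans p (≤-reflexive (cong (_+ ♯ P) (sym e)))) (≤-trans q (≤-reflexive (cong (_+ ♯ Q) (sym e))))
  cases (suc zero) e = one (sym e) r refl 1≤r
  cases (suc (suc zero)) e = two (sym e) r t refl refl 1≤r r<t
  cases (suc (suc (suc a))) e = contradiction (≤-trans (≤-trans (s≤s (s≤s (s≤s z≤n))) (≤-reflexive e))
      (≤-trans (m≤m+n (♯ C) _) few)) λ { (s≤s (s≤s ())) }

-- Families in which every point is missed by three members

codegree-to : ∀ {s} (φ : Sym n) {H : Fam n} → Codegree s H → Codegree s (H ∘ to φ)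
codegree-to {s = s} φ {H} g v sv = ≤-trans (g (to φ v) (trans (size-to φ v) sv))
  (≤-reflexive (trans (sym (♯-to φ (H ∩ᶠ λ x → not (meet (to φ v) x)))) (♯-cong λ x → cong (λ b → H (to φ x) ∧ not b)
      (meet-to φ v x))))

codegree? : ∀ s (H : Fam n) → Codegree (suc s) H ⊎ ∃[ v ] (∣ v ∣ ≡ 1 × ♯ (H ∩ᶠ λ x → not (meet v x)) ≤ s)
codegree? s H with search (λ v → (∣ v ∣ ≡ᵇ 1) ∧ (♯ (H ∩ᶠ λ x → not (meet v x)) ≤ᵇ s))
... | inj₁ (v , p) = inj₂ (v , ≡ᵇ-true (proj₁ (∧-true p)) , ≤ᵇ⇒≤ _ _
    (subst T (sym (proj₂ (∧-true {∣ v ∣ ≡ᵇ 1} p))) tt))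
... | inj₂ none = inj₁ λ v sv → ≰⇒> λ le → true≢false (∧-intro (≡ᵇ-intro sv) (T-true (≤⇒≤ᵇ le))) (none v)
  where
  T-true : ∀ {b} → T b → b ≡ true
  T-true {true} _ = refl

missed-by : Fam n → Subset n → ℕ
missed-by H v = ♯ (H ∩ᶠ λ x → not (meet v x))

missed-by-none : (F : Fam n) {v : Subset n} → ∣ v ∣ ≡ 0 → missed-by F v ≡ ♯ F
missed-by-none F {v} z = ♯-cong λ x → trans (cong (λ b → F x ∧ not b) (meet-empty v x z)) (∧-identityʳ (F x))

missed-by-first : (F : Fam (2 + n)) {v : Subset n} → ∣ v ∣ ≡ 0 → missed-by F (true ∷ false ∷ v) ≡ ♯ (F ⁻ ⁻) + ♯
    (F ⁻ ⁺)
missed-by-first F {v} z = trans (cong₂ _+_ (cong₂ _+_ (missed-by-none (F ⁻ ⁻) {v} z) (missed-by-none (F ⁻ ⁺) {v} z))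
  (cong₂ _+_ (♯-empty λ x → ∧-zeroʳ ((F ⁺ ⁻) x)) (♯-empty λ x → ∧-zeroʳ ((F ⁺ ⁺) x)))) (+-identityʳ _)

missed-by-second : (F : Fam (2 + n)) {v : Subset n} → ∣ v ∣ ≡ 0 → missed-by F (false ∷ true ∷ v) ≡ ♯ (F ⁻ ⁻) + ♯
    (F ⁺ ⁻)
missed-by-second F {v} z = trans (cong₂ _+_ (cong₂ _+_ (missed-by-none (F ⁻ ⁻) {v} z)
    (♯-empty λ x → ∧-zeroʳ ((F ⁻ ⁺) x)))
  (cong₂ _+_ (missed-by-none (F ⁺ ⁻) {v} z) (♯-empty λ x → ∧-zeroʳ ((F ⁺ ⁺) x))))
      (cong₂ _+_ (+-identityʳ (♯ (F ⁻ ⁻))) (+-identityʳ (♯ (F ⁺ ⁻))))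

missed-by-rest : (F : Fam (2 + n)) (v : Subset n) → missed-by (shift zero F) (false ∷ false ∷ v) ≡ missed-by F
    (false ∷ false ∷ v)
missed-by-rest {n} F v = trans (♯-cong agree) (♯-shift zero (F ∩ᶠ λ x → not (meet (false ∷ false ∷ v) x)))
  where
  and : ∀ a b c → (a ∧ b) ∧ c ≡ (a ∧ c) ∧ (b ∧ c)
  and true  true  true  = refl
  and true  true  false = refl
  and true  false true  = refl
  and true  false false = refl
  and false b     c     = refl
  agree : ∀ x → (shift zero F ∩ᶠ λ y → not (meet (false ∷ false ∷ v) y)) x ≡ shift zero
      (F ∩ᶠ λ y → not (meet (false ∷ false ∷ v) y)) x
  agree (true  ∷ false ∷ x) = and (F (true ∷ false ∷ x)) (F (false ∷ true ∷ x)) (not (meet v x))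
  agree (false ∷ true  ∷ x) = ∧-distribʳ-∨ (not (meet v x)) (F (true ∷ false ∷ x)) (F (false ∷ true ∷ x))
  agree (true  ∷ true  ∷ x) = refl
  agree (false ∷ false ∷ x) = refl

-- Shifting keeps the number of members missing any later point and cannot lower it for the first
-- point. The condition can fail only at the second point, which is the case of `stuck`.
stuck-shift : ∀ r {t} (H : Fam (4 + n)) → 1 ≤ r → n ≡ r + t → r < t → Unif (2 + r) H → Cross H H → Codegree 3 H →
              ∀ v → ∣ v ∣ ≡ 1 → missed-by (shift zero H) v ≤ 2 → Small r t H ⊎ Exc r H
stuck-shift r H 1≤r n≡ r<t u c g (true ∷ true ∷ v) () few
stuck-shift r H 1≤r n≡ r<t u c g (false ∷ false ∷ v) sv few =
  contradiction (≤-trans (g (false ∷ false ∷ v) sv) (≤-trans (≤-reflexive (sym (missed-by-rest H v))) few)) λ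
      { (s≤s (s≤s ())) }
stuck-shift r H 1≤r n≡ r<t u c g (true ∷ false ∷ v) sv few =
  contradiction (≤-trans (g (true ∷ false ∷ v) sv) (≤-trans (≤-reflexive (missed-by-first H {v} (suc-injective sv)))
    (≤-trans (+-monoʳ-≤ (♯ (H ⁻ ⁻)) (♯-mono {F = H ⁻ ⁺} {shift zero H ⁻ ⁺} λ x p → ∨-injʳ {H (true ∷ false ∷ x)} p))
    (≤-trans (≤-reflexive (sym (missed-by-first (shift zero H) {v} (suc-injective sv)))) few)))) λ { (s≤s (s≤s ())) }
stuck-shift r H 1≤r n≡ r<t u c g (false ∷ true ∷ v) sv few = stuck r H 1≤r n≡ r<t u c
  (≤-trans (+-monoʳ-≤ (♯ (H ⁻ ⁻)) (♯-mono {F = H ⁻ ⁺ ∩ᶠ H ⁺ ⁻} {shift zero H ⁺ ⁻} λ x p → ∧-intro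
      (proj₂ (∧-true {(H ⁻ ⁺) x} p)) (proj₁ (∧-true p))))
    (≤-trans (≤-reflexive (sym (missed-by-second (shift zero H) {v} (suc-injective sv)))) few))
  (≤-trans (g (true ∷ false ∷ v) sv) (≤-reflexive (missed-by-first H {v} (suc-injective sv))))
  (≤-trans (g (false ∷ true ∷ v) sv) (≤-reflexive (missed-by-second H {v} (suc-injective sv))))

codegree-three : ∀ r {t} (H : Fam (4 + n)) → 1 ≤ r → n ≡ r + t → r < t → Unif (2 + r) H → Cross H H → Codegree 3 H →
                 Small r t H ⊎ Exc r H
codegree-three {n} r {t} H 1≤r n≡ r<t u c g = go _ H u c g ≤-refl
  where
  go : ∀ f (H : Fam (4 + n)) → Unif (2 + r) H → Cross H H → Codegree 3 H → potential H ≤ f → Small r t H ⊎ Exc r H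
  step : ∀ f (H : Fam (4 + n)) → Unif (2 + r) H → Cross H H → Codegree 3 H → ∀ i → potential (shift i H) < f →
      Small r t H ⊎ Exc r H
  step (suc f) H u c g i (s≤s lt) with codegree? 2 (shift i H)
  ... | inj₁ g′ with go f (shift i H) (unif-shift i {H} u) (cross-shift i {H} {H} c) g′ lt
  ...   | inj₁ s = inj₁ (small-cong {r = r} {t} {shift i H} {H} (♯-shift i H) s)
  ...   | inj₂ w = unshift-at r H 1≤r n≡ r<t u c i w
  step (suc f) H u c g i (s≤s lt) | inj₂ (v , sv , few)
    with stuck-shift r (H ∘ to φ) 1≤r n≡ r<t (unif-to φ u) (cross-to φ {H} {H} c) (codegree-to φ {H} g) (from φ v)
           (trans (sym (size-to φ (from φ v))) (trans (cong ∣_∣ (to-from φ v)) sv)) (≤-trans (≤-reflexive same) few)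
    where
    φ : Sym (4 + n)
    φ = front i
    same : missed-by (shift zero (H ∘ to φ)) (from φ v) ≡ missed-by (shift i H) v
    same = trans (♯-cong λ x → cong₂ (λ a b → a ∧ not b) (sym (shift-front i H x))
                   (trans (sym (meet-to φ (from φ v) x)) (cong (λ a → meet a (to φ x)) (to-from φ v))))
                 (♯-to φ (shift i H ∩ᶠ λ x → not (meet v x)))
  ... | inj₁ s = inj₁ (small-cong {r = r} {t} {H ∘ to (front i)} {H} (♯-to (front i) H) s)
  ... | inj₂ w = inj₂ (exc-to (front i) w)
  go f H u c g le with progress H
  ... | inj₁ s = shifted-main r 1≤r (trans (cong (3 +_) n≡) (cong (2 +_) (sym (+-suc r t)))) r<t s u c g
  ... | inj₂ (i , lt) = step f H u c g i (≤-trans lt le)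

-- Sets differing by one exchange, and the models of 𝓙₂, 𝓖₂ and 𝓖₃

record Exchange {n} (c d : Subset n) : Set where
  constructor exchange
  field
    common left right : Subset n
    c≡ : c ≡ common ∪ left
    d≡ : d ≡ common ∪ right
    size-left  : ∣ left ∣ ≡ 1
    size-right : ∣ right ∣ ≡ 1
    disj-left  : meet common left ≡ false
    disj-right : meet common right ≡ false
    disj       : meet left right ≡ false

add-one : ∀ {t} (c d : Subset n) → co c ≡ suc t → co d ≡ t → co (c ∪ d) ≡ t → ∃[ y ]
    (d ≡ c ∪ y × ∣ y ∣ ≡ 1 × meet c y ≡ false)
add-one []          []          () q r
add-one (true ∷ c)  (true ∷ d)  p q r = let y , e , s , m = add-one c d p q r in false ∷ y , cong (true ∷_) e , s , m
add-one (true ∷ c)  (false ∷ d) p q r = contradiction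
  (≤-trans (≤-reflexive (trans q (sym (trans (cong co (∪-comm d c)) r)))) (co-∪ d c)) 1+n≰n
add-one {suc n} (false ∷ c) (true ∷ d) p q r with co-∪-≡ c d (trans r (sym (suc-injective p)))
    (trans (suc-injective p) (sym q))
... | refl = true ∷ empty , cong (true ∷_) (sym (∪-∅ c)) , cong suc (size-empty n) , meet-∅ c
add-one {t = zero}  (false ∷ c) (false ∷ d) p () r
add-one {t = suc t} (false ∷ c) (false ∷ d) p q r =
  let y , e , s , m = add-one c d (suc-injective p) (suc-injective q) (suc-injective r) in false ∷ y , cong
          (false ∷_) e , s , m

to-exchange : ∀ {t} (c d : Subset n) → co c ≡ suc t → co d ≡ suc t → co (c ∪ d) ≡ t → Exchange c d
to-exchange [] [] () q r
to-exchange (true ∷ c) (true ∷ d) p q r =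
  let exchange e y z a b sy sz m k l = to-exchange c d p q r
  in exchange (true ∷ e) (false ∷ y) (false ∷ z) (cong (true ∷_) a) (cong (true ∷_) b) sy sz m k l
to-exchange {suc n} (true ∷ c) (false ∷ d) p q r =
  let y , e , s , m = add-one c d p (suc-injective q) r
  in exchange (false ∷ c) (true ∷ empty) (false ∷ y) (cong (true ∷_) (sym (∪-∅ c))) (cong (false ∷_) e)
       (cong suc (size-empty n)) s (meet-∅ c) m (∅-meet y)
to-exchange {suc n} (false ∷ c) (true ∷ d) p q r =
  let y , e , s , m = add-one d c q (suc-injective p) (trans (cong co (∪-comm d c)) r)
  in exchange (false ∷ d) (false ∷ y) (true ∷ empty) (cong (false ∷_) e) (cong (true ∷_) (sym (∪-∅ d)))
       s (cong suc (size-empty n)) m (meet-∅ d) (meet-∅ y)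
to-exchange {t = zero} (false ∷ c) (false ∷ d) p q ()
to-exchange {t = suc t} (false ∷ c) (false ∷ d) p q r =
  let exchange e y z a b sy sz m k l = to-exchange c d (suc-injective p) (suc-injective q) (suc-injective r)
  in exchange (false ∷ e) (false ∷ y) (false ∷ z) (cong (false ∷_) a) (cong (false ∷_) b) sy sz m k l

sub-equal : (c x : Subset n) → sub c x ≡ true → ∣ c ∣ ≡ ∣ x ∣ → c ≡ x
sub-equal []          []          p q = refl
sub-equal (true ∷ c)  (true ∷ x)  p q = cong (true ∷_) (sub-equal c x p (suc-injective q))
sub-equal (false ∷ c) (true ∷ x)  p q = contradiction (≤-trans (≤-reflexive (sym q)) (sub-size c x p)) 1+n≰n
sub-equal (false ∷ c) (false ∷ x) p q = cong (false ∷_) (sub-equal c x p q)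

sub-∪ˡ : (x y : Subset n) → sub x (x ∪ y) ≡ true
sub-∪ˡ []          []      = refl
sub-∪ˡ (true ∷ x)  (b ∷ y) = sub-∪ˡ x y
sub-∪ˡ (false ∷ x) (b ∷ y) = sub-∪ˡ x y

-- v is the singleton of x₀
inJ : Subset n → Subset n → Subset n → Subset n → Bool
inJ e j v x = (sub e x ∧ meet x j) ∨ (sub j x ∨ (meet v x ∧ meet x e))

jFam : ℕ → Subset n → Subset n → Subset n → Fam n
jFam k e j v x = (∣ x ∣ ≡ᵇ k) ∧ inJ e j v x

gFam : ℕ → Subset n → Subset n → Fam n
gFam k e v x = (∣ x ∣ ≡ᵇ k) ∧ inG e v x

Within : ℕ → ℕ → Fam (suc n) → Set
Within {n} r t H = ♯ H + loss r t ≤ 2 + bin n (suc r)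

few-missing : ∀ {r t} {H : Fam (suc n)} {c d : Subset n} → n ≡ 2 + r + suc t → Unif (suc r) (H ⁺) → c ≢ d →
              ∣ c ∣ ≡ 2 + r → ∣ d ∣ ≡ 2 + r → Hits c (H ⁺) → Hits d (H ⁺) → ♯ (H ⁻) ≤ 2 → Within r t H
few-missing {n} {r} {t} {H} {c} {d} n≡ u c≢d sc sd hc hd few =
  linear (♯ (H ⁻) ∷ ♯ (H ⁺) ∷ loss r t ∷ bin n (suc r) ∷ []) ((x0 ≼ con 2) ∷ (x1 ⊕ x2 ≼ x3) ∷ []) (x0 ⊕ x1 ⊕ x2)
      (con 2 ⊕ x3)
    (few , ♯-hits₂ {R = H ⁺} c≢d (co-size c n≡ sc) (co-size d n≡ sd) u hc hd , tt)

-- If c and d differed in more than one exchange, fewer points would remain outside their union, and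
-- inclusion-exclusion would deduct at least one more set.
few-missing-tight : ∀ {r t} {H : Fam (suc n)} {c d : Subset n} → n ≡ 2 + r + suc t → r < t → Unif (suc r) (H ⁺) →
    c ≢ d →
              ∣ c ∣ ≡ 2 + r → ∣ d ∣ ≡ 2 + r → Hits c (H ⁺) → Hits d (H ⁺) → ♯ (H ⁻) ≤ 2 →
              2 + bin n (suc r) ≤ ♯ H + loss r t → Exchange c d
few-missing-tight {n} {r} {suc t} {H} {c} {d} n≡ (s≤s r≤t) u c≢d sc sd hc hd few tight with m≤n⇒m<n∨m≡n smaller
  where
  smaller : co (c ∪ d) ≤ suc t
  smaller = s≤s⁻¹ (≤-trans (≤∧≢⇒< (co-∪ c d) λ q → c≢d (co-∪-≡ c d q
      (trans (co-size c n≡ sc) (sym (co-size d n≡ sd))))) (≤-reflexive (co-size c n≡ sc)))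
... | inj₂ eq = to-exchange c d (co-size c n≡ sc) (co-size d n≡ sd) eq
... | inj₁ (s≤s lt) = contradiction
  (linear (♯ (H ⁻) ∷ ♯ (H ⁺) ∷ ♯ (meeting (suc r) c d) ∷ bin (suc t) (suc r) ∷ bin t r ∷ bin t (suc r) ∷ bin n
      (suc r) ∷ bin (co (c ∪ d)) (suc r) ∷ bin (suc t) r ∷ [])
    ((x0 ≼ con 2) ∷ (x1 ≼ x2) ∷ (x2 ⊕ (x8 ⊕ x3 ⊕ (x8 ⊕ x3)) ≼ x6 ⊕ x7) ∷ (x7 ≼ x5) ∷ (con 1 ≼ x4) ∷ (x4 ⊕ x5 ≼ x3)
      ∷ (con 2 ⊕ x6 ≼ x0 ⊕ x1 ⊕ (x8 ⊕ x3 ⊕ x8)) ∷ []) (con 1) (con 0)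
    ( few , ♯-mono {F = H ⁺} {meeting (suc r) c d} (λ x p → ∧-intro (≡ᵇ-intro (u x p)) (∧-intro (hc x p) (hd x p)))
    , ≤-reflexive (subst₂ (λ a b → ♯ (meeting (suc r) c d) + (bin a (suc r) + bin b (suc r)) ≡ bin n (suc r) + bin
        (co (c ∪ d)) (suc r))
        (co-size c n≡ sc) (co-size d n≡ sd) (♯-meeting (suc r) c d))
    , bin-mono (suc r) lt , bin-pos r≤t , ≤-refl , tight , tt)) λ ()

♯-within-two : {F : Fam n} {c d : Subset n} → (∀ x → F ∋ x → c ≡ x ⊎ d ≡ x) → ♯ F ≤ 2
♯-within-two {F = F} {c} {d} h = ≤-trans (♯-mono {F = F} {(c ==_) ∪ᶠ (d ==_)} λ x p → case h x p of λ
    { (inj₁ refl) → ∨-injˡ (==-refl x) ; (inj₂ refl) → ∨-injʳ {c == x} (==-refl x) })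
  (≤-trans (m≤m+n _ (♯ ((c ==_) ∩ᶠ (d ==_)))) (≤-reflexive
      (trans (♯-∪∩ (c ==_) (d ==_)) (cong₂ _+_ (♯-== c) (♯-== d)))))

sub-refl : (x : Subset n) → sub x x ≡ true
sub-refl []          = refl
sub-refl (true ∷ x)  = sub-refl x
sub-refl (false ∷ x) = sub-refl x

sub-∪⁻ : (x y z : Subset n) → sub (x ∪ y) z ≡ true → sub x z ≡ true × sub y z ≡ true
sub-∪⁻ []          []          []         p = refl , refl
sub-∪⁻ (true ∷ x)  (true ∷ y)  (true ∷ z) p = sub-∪⁻ x y z p
sub-∪⁻ (true ∷ x)  (false ∷ y) (true ∷ z) p = sub-∪⁻ x y z p
sub-∪⁻ (false ∷ x) (true ∷ y)  (true ∷ z) p = sub-∪⁻ x y z p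
sub-∪⁻ (false ∷ x) (false ∷ y) (c ∷ z)    p = sub-∪⁻ x y z p

co-∪-≥ : (x y : Subset n) → co x ≤ co (x ∪ y) + ∣ y ∣
co-∪-≥ []          []          = z≤n
co-∪-≥ (true ∷ x)  (true ∷ y)  = ≤-trans (co-∪-≥ x y) (+-monoʳ-≤ (co (x ∪ y)) (n≤1+n ∣ y ∣))
co-∪-≥ (true ∷ x)  (false ∷ y) = co-∪-≥ x y
co-∪-≥ (false ∷ x) (true ∷ y)  = ≤-trans (s≤s (co-∪-≥ x y)) (≤-reflexive (sym (+-suc (co (x ∪ y)) ∣ y ∣)))
co-∪-≥ (false ∷ x) (false ∷ y) = s≤s (co-∪-≥ x y)

-- x₀ is the first point, E the common part of c and d, and J consists of x₀ and the two exchanged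
-- points. Then c and d are the only members missing x₀, and the members through x₀ are the k-sets
-- that hit both.
module JModel {n r t} {c d : Subset n} (n≡ : n ≡ 2 + r + suc t) (sc : ∣ c ∣ ≡ 2 + r) (sd : ∣ d ∣ ≡ 2 + r)
              (X : Exchange c d) {z : Subset n} (z0 : ∣ z ∣ ≡ 0) where
  open Exchange X

  j : Subset n
  j = left ∪ right

  size-common : ∣ common ∣ ≡ suc r
  size-common = suc-injective (trans (+-comm 1 ∣ common ∣) (trans (cong (∣ common ∣ +_) (sym size-left))
    (trans (sym (size-∪ common left disj-left)) (trans (cong ∣_∣ (sym c≡)) sc))))

  size-j : ∣ j ∣ ≡ 2
  size-j = trans (size-∪ left right disj) (cong₂ _+_ size-left size-right)

  disj-j : meet common j ≡ false
  disj-j = trans (meet-∪ common left right) (cong₂ _∨_ disj-left disj-right)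

  𝓙ᶠ : Fam (suc n)
  𝓙ᶠ = jFam (2 + r) (false ∷ common) (true ∷ j) (true ∷ z)

  uniform : Unif (2 + r) 𝓙ᶠ
  uniform x p = ≡ᵇ-true {∣ x ∣} (proj₁ (∧-true p))

  meet-c : ∀ x → meet x c ≡ meet x common ∨ meet x left
  meet-c x = trans (cong (meet x) c≡) (meet-∪ x common left)

  meet-d : ∀ x → meet x d ≡ meet x common ∨ meet x right
  meet-d x = trans (cong (meet x) d≡) (meet-∪ x common right)

  meet-self : (x : Subset n) → ∣ x ∣ ≡ 1 → meet x x ≡ true
  meet-self x s = sub⇒meet x x (≤-reflexive (sym s)) (sub-refl x)

  c≢d : c ≢ d
  c≢d eq = true≢false (trans (sym (cong (meet left) eq))
      (trans (meet-c left) (∨-injʳ {meet left common} (meet-self left size-left))))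
    (trans (meet-d left) (cong₂ _∨_ (trans (meet-sym left common) disj-left) disj))

  split-j : ∀ {x} → sub j x ≡ true → meet x left ≡ true × meet x right ≡ true
  split-j {x} p = let a , b = sub-∪⁻ left right x p
    in sub⇒meet left x (≤-reflexive (sym size-left)) a , sub⇒meet right x (≤-reflexive (sym size-right)) b

  join-j : ∀ {x} → meet x left ≡ true → meet x right ≡ true → sub j x ≡ true
  join-j {x} a b = sub-∪ left right x (sub-singleton left x size-left (trans (meet-sym left x) a))
      (sub-singleton right x size-right (trans (meet-sym right x) b))

  hits : ∀ x → 𝓙ᶠ ∋ true ∷ x → meet x c ≡ true × meet x d ≡ true
  hits x p with ∨-true {sub common x ∧ true} (proj₂ (∧-true {suc ∣ x ∣ ≡ᵇ suc (suc r)} p))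
  ... | inj₁ q = let m = sub⇒meet common x (≤-trans (s≤s z≤n) (≤-reflexive (sym size-common))) (proj₁ (∧-true q))
                 in trans (meet-c x) (∨-injˡ m) , trans (meet-d x) (∨-injˡ m)
  ... | inj₂ q with ∨-true {sub j x} q
  ...   | inj₁ s = let a , b = split-j s in trans (meet-c x) (∨-injʳ {meet x common} a) , trans (meet-d x) (∨-injʳ {meet x common} b)
  ...   | inj₂ m = trans (meet-c x) (∨-injˡ m) , trans (meet-d x) (∨-injˡ m)

  avoid : ∀ x → 𝓙ᶠ ∋ false ∷ x → c ≡ x ⊎ d ≡ x
  avoid x p with ∨-true {sub common x ∧ meet x j} (proj₂ (∧-true {∣ x ∣ ≡ᵇ suc (suc r)} p))
  ... | inj₂ q = ⊥-elim (true≢false (proj₁ (∧-true q)) (meet-empty z x z0))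
  ... | inj₁ q with ∨-true (trans (sym (meet-∪ x left right)) (proj₂ (∧-true {sub common x} q)))
  ...   | inj₁ m = inj₁ (trans c≡ (sub-equal (common ∪ left) x
      (sub-∪ common left x (proj₁ (∧-true q)) (sub-singleton left x size-left (trans (meet-sym left x) m)))
                    (trans (cong ∣_∣ (sym c≡)) (trans sc (sym (uniform (false ∷ x) p))))))
  ...   | inj₂ m = inj₂ (trans d≡ (sub-equal (common ∪ right) x (sub-∪ common right x (proj₁ (∧-true q))
      (sub-singleton right x size-right (trans (meet-sym right x) m)))
                    (trans (cong ∣_∣ (sym d≡)) (trans sd (sym (uniform (false ∷ x) p))))))

  upper : Within r t 𝓙ᶠ
  upper = few-missing {r = r} {H = 𝓙ᶠ} {c} {d} n≡ (unif⁺ uniform) c≢d sc sd (λ x p → proj₁ (hits x p))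
      (λ x p → proj₂ (hits x p)) (♯-within-two {F = 𝓙ᶠ ⁻} avoid)

  into : ∀ x → meet x c ≡ true → meet x d ≡ true → ∣ x ∣ ≡ suc r → 𝓙ᶠ ∋ true ∷ x
  into x p q s = ∧-intro (≡ᵇ-intro (cong suc s)) (∨-injʳ {sub common x ∧ true}
      (go (∨-true {meet x common} (trans (sym (meet-c x)) p)) (∨-true {meet x common} (trans (sym (meet-d x)) q))))
    where
    go : meet x common ≡ true ⊎ meet x left ≡ true → meet x common ≡ true ⊎ meet x right ≡ true → sub j x ∨
        (true ∧ meet x common) ≡ true
    go (inj₁ m) _        = ∨-injʳ {sub j x} m
    go (inj₂ _) (inj₁ m) = ∨-injʳ {sub j x} m
    go (inj₂ a) (inj₂ b) = ∨-injˡ (join-j {x} a b)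

  into-c : 𝓙ᶠ ∋ false ∷ c
  into-c = ∧-intro (≡ᵇ-intro sc) (∨-injˡ (∧-intro (trans (cong (sub common) c≡) (sub-∪ˡ common left))
    (trans (meet-∪ c left right) (∨-injˡ (trans (meet-sym c left)
        (trans (meet-c left) (∨-injʳ {meet left common} (meet-self left size-left))))))))

  into-d : 𝓙ᶠ ∋ false ∷ d
  into-d = ∧-intro (≡ᵇ-intro sd) (∨-injˡ (∧-intro (trans (cong (sub common) d≡) (sub-∪ˡ common right))
    (trans (meet-∪ d left right) (∨-injʳ {meet d left} (trans (meet-sym d right)
        (trans (meet-d right) (∨-injʳ {meet right common} (meet-self right size-right))))))))

  co-cd : t ≤ co (c ∪ d)
  co-cd = s≤s⁻¹ (≤-trans (≤-reflexive (sym (co-size d n≡ sd))) (≤-trans (co-∪-≥ d left)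
    (≤-reflexive (trans (cong₂ _+_ (cong co (trans (cong (_∪ left) d≡)
        (trans (arrange common left right) (sym (cong₂ _∪_ c≡ d≡))))) size-left) (+-comm _ 1)))))
    where
    arrange : ∀ {n} (e a b : Subset n) → (e ∪ b) ∪ a ≡ (e ∪ a) ∪ (e ∪ b)
    arrange []          []          []      = refl
    arrange (true ∷ e)  (x ∷ a)     (y ∷ b) = cong (true ∷_) (arrange e a b)
    arrange (false ∷ e) (true ∷ a)  (true ∷ b)  = cong (true ∷_) (arrange e a b)
    arrange (false ∷ e) (true ∷ a)  (false ∷ b) = cong (true ∷_) (arrange e a b)
    arrange (false ∷ e) (false ∷ a) (true ∷ b)  = cong (true ∷_) (arrange e a b)
    arrange (false ∷ e) (false ∷ a) (false ∷ b) = cong (false ∷_) (arrange e a b)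

  lower : 2 + bin n (suc r) ≤ ♯ 𝓙ᶠ + loss r t
  lower = linear (♯ (𝓙ᶠ ⁻) ∷ ♯ (𝓙ᶠ ⁺) ∷ ♯ (meeting (suc r) c d) ∷ bin t r ∷ bin t (suc r) ∷ bin n (suc r) ∷ bin
      (co (c ∪ d)) (suc r) ∷ [])
    ((con 2 ≼ x0) ∷ (x2 ≼ x1) ∷ (x5 ⊕ x6 ≼ x2 ⊕ (x3 ⊕ x4 ⊕ (x3 ⊕ x4))) ∷ (x4 ≼ x6) ∷ [])
    (con 2 ⊕ x5) (x0 ⊕ x1 ⊕ (x3 ⊕ x4 ⊕ x3))
    ( ♯-≥2 (𝓙ᶠ ⁻) {c} {d} into-c into-d c≢d
    , ♯-mono {F = meeting (suc r) c d} {𝓙ᶠ ⁺} (λ x p → let s , m = ∧-true {∣ x ∣ ≡ᵇ suc r} p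
                                                           a , b = ∧-true {meet x c} m
                                                       in into x a b (≡ᵇ-true {∣ x ∣} s))
    , ≤-reflexive (sym (subst₂ (λ a b → ♯ (meeting (suc r) c d) + (bin a (suc r) + bin b (suc r)) ≡ bin n
        (suc r) + bin (co (c ∪ d)) (suc r))
        (co-size c n≡ sc) (co-size d n≡ sd) (♯-meeting (suc r) c d)))
    , bin-mono (suc r) co-cd , tt)

pair-exchange : (e j : Subset n) → ∣ j ∣ ≡ 2 → meet e j ≡ false → ∃[ c ] ∃[ d ] Σ[ X ∈ Exchange c d ]
    (Exchange.common X ≡ e × Exchange.left X ∪ Exchange.right X ≡ j)
pair-exchange {n} e j sj dj =
  -- A 2-set is not contained in the empty set, so `missing` splits off one of its points.
  let y , w , sy , j≡ , s , _ , m = missing j empty (¬true λ p → contradiction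
          (≤-trans (≤-reflexive (sym sj)) (≤-trans (sub-size j empty p) (≤-reflexive (size-empty n)))) λ ())
      dw , dy = ∨-false {meet e w} (trans (sym (meet-∪ e w y)) (trans (cong (meet e) (sym j≡)) dj))
  in e ∪ w , e ∪ y , exchange e w y refl refl (suc-injective (trans (sym s) sj)) sy dw dy m , refl , sym j≡

superset : ℕ → Subset n → Fam n
superset k c x = (∣ x ∣ ≡ᵇ k) ∧ sub c x

♯-superset : ∀ k (c : Subset n) → ♯ (superset (∣ c ∣ + k) c) ≡ bin (co c) k
♯-superset zero    []          = refl
♯-superset (suc k) []          = refl
♯-superset k       (true ∷ c)  = trans (cong (_+ ♯ (superset (∣ c ∣ + k) c))
    (♯-empty {F = superset (suc (∣ c ∣ + k)) (true ∷ c) ⁻} λ x → ∧-zeroʳ (∣ x ∣ ≡ᵇ suc (∣ c ∣ + k)))) (♯-superset k c)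
♯-superset zero    (false ∷ c) = trans (cong₂ _+_ (♯-superset 0 c) (♯-empty none)) refl
  where
  none : None (superset (∣ c ∣ + 0) (false ∷ c) ⁺)
  none x = ¬true λ p → contradiction (≤-trans (≤-reflexive (trans (≡ᵇ-true {suc ∣ x ∣} (proj₁ (∧-true p)))
      (+-identityʳ _)))
    (sub-size c x (proj₂ (∧-true {suc ∣ x ∣ ≡ᵇ ∣ c ∣ + 0} p)))) 1+n≰n
♯-superset (suc k) (false ∷ c) = trans (cong₂ _+_ (♯-superset (suc k) c)
  (trans (♯-cong λ x → cong (λ a → (suc ∣ x ∣ ≡ᵇ a) ∧ sub c x) (+-suc ∣ c ∣ k)) (♯-superset k c)))
      (+-comm (bin (co c) (suc k)) _)

-- For k = 4 the families 𝓖₂ and 𝓖₃ are as large as 𝓙₂.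
gFam-lower : ∀ {t} {e z : Subset n} → n ≡ 4 + suc t → ∣ z ∣ ≡ 0 → ∣ e ∣ ≡ 2 ⊎ ∣ e ∣ ≡ 3 →
             2 + bin n 3 ≤ ♯ (gFam 4 (false ∷ e) (true ∷ z)) + loss 2 t
gFam-lower {n} {t} {e} {z} n≡ z0 se = go se
  where
  G : Fam (suc n)
  G = gFam 4 (false ∷ e) (true ∷ z)
  A : bin n 3 ≤ ♯ (G ⁺) + bin (co e) 3
  A = linear (♯ (meeting 3 e e) ∷ bin (co e) 3 ∷ bin n 3 ∷ bin (co (e ∪ e)) 3 ∷ ♯ (G ⁺) ∷ [])
    ((x2 ⊕ x3 ≼ x0 ⊕ (x1 ⊕ x1)) ∷ (x1 ≼ x3) ∷ (x0 ≼ x4) ∷ []) x2 (x4 ⊕ x1)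
    ( ≤-reflexive (sym (♯-meeting 3 e e)) , ≤-reflexive (cong (λ a → bin (co a) 3) (sym (∪-idem e)))
    , ♯-mono {F = meeting 3 e e} {G ⁺} (λ x p → let s , m = ∧-true {∣ x ∣ ≡ᵇ 3} p in ∧-intro s (∨-injʳ {sub e x} (proj₁ (∧-true m)))) , tt)
  B : ∀ k → ∣ e ∣ + k ≡ 4 → bin (co e) k ≤ ♯ (G ⁻)
  B k s = ≤-trans (≤-reflexive (sym (♯-superset k e))) (♯-mono {F = superset (∣ e ∣ + k) e} {G ⁻} λ x p →
    let a , b = ∧-true {∣ x ∣ ≡ᵇ ∣ e ∣ + k} p in ∧-intro (subst (λ m → (∣ x ∣ ≡ᵇ m) ≡ true) s a) (∨-injˡ b))
  go : ∣ e ∣ ≡ 2 ⊎ ∣ e ∣ ≡ 3 → 2 + bin n 3 ≤ ♯ G + loss 2 t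
  go (inj₁ s) = linear (♯ (G ⁻) ∷ ♯ (G ⁺) ∷ bin n 3 ∷ bin (suc t) 3 ∷ bin t 2 ∷ bin t 1 ∷ [])
      ((x2 ≼ x1 ⊕ (con 1 ⊕ x5 ⊕ (x5 ⊕ x4) ⊕ ((x5 ⊕ x4) ⊕ x3))) ∷ (con 2 ⊕ x5 ⊕ (con 1 ⊕ x5 ⊕ (x5 ⊕ x4)) ≼ x0) ∷ [])
      (con 2 ⊕ x2) (x0 ⊕ x1 ⊕ (x3 ⊕ x4))
      ( subst (λ a → bin n 3 ≤ ♯ (G ⁺) + bin a 3) (co-size e n≡ s) A
      , subst (λ a → bin a 2 ≤ ♯ (G ⁻)) (co-size e n≡ s) (B 2 (cong (_+ 2) s)) , tt)
  go (inj₂ s) = linear (♯ (G ⁻) ∷ ♯ (G ⁺) ∷ bin n 3 ∷ bin (suc t) 3 ∷ bin t 2 ∷ bin t 1 ∷ [])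
      ((x2 ≼ x1 ⊕ ((x5 ⊕ x4) ⊕ x3)) ∷ (con 2 ⊕ x5 ≼ x0) ∷ [])
      (con 2 ⊕ x2) (x0 ⊕ x1 ⊕ (x3 ⊕ x4))
      ( subst (λ a → bin n 3 ≤ ♯ (G ⁺) + bin a 3) (co-size e n≡ s) A
      , subst (λ a → bin a 1 ≤ ♯ (G ⁻)) (co-size e n≡ s) (B 1 (cong (_+ 1) s)) , tt)

-- From Boolean families to the notions of the theorem

bin≡C : ∀ n k → bin n k ≡ n choose k
bin≡C n       zero    = refl
bin≡C zero    (suc k) = refl
bin≡C (suc n) (suc k) = trans (cong₂ _+_ (bin≡C n k) (bin≡C n (suc k))) (nCk+nC[k+1]≡[n+1]C[k+1] n k)

does-true : ∀ {A : Set} (d : Dec A) → does d ≡ true → A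
does-true (yes a) _ = a

does-intro : ∀ {A : Set} (d : Dec A) → A → does d ≡ true
does-intro (yes _) a = refl
does-intro (no ¬a) a = contradiction a ¬a

⟦_⟧ : {H : Family n} → Decidable H → Fam n
⟦ H? ⟧ x = does (H? x)

card≡♯ : {H : Family n} (H? : Decidable H) → card H? ≡ ♯ ⟦ H? ⟧
card≡♯ {n} {H} H? = go n id
  where
  -- `f` records the points already decided, so the recursion runs over the remaining m while `H?`
  -- keeps its type.
  go : ∀ m (f : Subset m → Subset n) → length (filter (H? ∘ f) (subsets m)) ≡ ♯ (⟦ H? ⟧ ∘ f)
  go zero f with does (H? (f []))
  ... | true  = refl
  ... | false = refl
  go (suc m) f = trans (cong length (filter-++ (H? ∘ f) (map (false ∷_) (subsets m)) (map (true ∷_) (subsets m))))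
    (trans (length-++ (filter (H? ∘ f) (map (false ∷_) (subsets m))))
      (cong₂ _+_ (trans (filter-map false (subsets m)) (go m (f ∘ (false ∷_))))
          (trans (filter-map true (subsets m)) (go m (f ∘ (true ∷_))))))
    where
    filter-map : ∀ b (xs : List (Subset m)) → length (filter (H? ∘ f) (map (b ∷_) xs)) ≡ length
        (filter (H? ∘ f ∘ (b ∷_)) xs)
    filter-map b []       = refl
    filter-map b (x ∷ xs) with does (H? (f (b ∷ x)))
    ... | true  = cong suc (filter-map b xs)
    ... | false = filter-map b xs

meet⇒nonempty : (x y : Subset n) → meet x y ≡ true → Nonempty (x ∩ y)
meet⇒nonempty [] [] ()
meet⇒nonempty (true ∷ x)  (true ∷ y)  p = zero , here
meet⇒nonempty (true ∷ x)  (false ∷ y) p = let i , q = meet⇒nonempty x y p in suc i , there q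
meet⇒nonempty (false ∷ x) (b ∷ y)     p = let i , q = meet⇒nonempty x y p in suc i , there q

nonempty⇒meet : (x y : Subset n) → Nonempty (x ∩ y) → meet x y ≡ true
nonempty⇒meet (true ∷ x) (true ∷ y) _ = refl
nonempty⇒meet (true ∷ x) (false ∷ y) (suc i , there q) = nonempty⇒meet x y (i , q)
nonempty⇒meet (false ∷ x) (b ∷ y) (suc i , there q) = nonempty⇒meet x y (i , q)

sub⇒⊆ : (x y : Subset n) → sub x y ≡ true → x ⊆ y
sub⇒⊆ (true ∷ x)  (true ∷ y) p here      = here
sub⇒⊆ (true ∷ x)  (true ∷ y) p (there q) = there (sub⇒⊆ x y p q)
sub⇒⊆ (false ∷ x) (b ∷ y)    p (there q) = there (sub⇒⊆ x y p q)

⊆⇒sub : (x y : Subset n) → x ⊆ y → sub x y ≡ true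
⊆⇒sub []          []      h = refl
⊆⇒sub (false ∷ x) (b ∷ y) h = ⊆⇒sub x y (drop-∷-⊆ h)
⊆⇒sub (true ∷ x)  (b ∷ y) h with h here
... | here = ⊆⇒sub x y (drop-∷-⊆ h)

∈⇒meet : (i : Fin n) (y : Subset n) → i ∈ y → meet ⁅ i ⁆ y ≡ true
∈⇒meet zero    (true ∷ y) here      = refl
∈⇒meet (suc i) (b ∷ y)    (there q) = ∈⇒meet i y q

meet⇒∈ : (i : Fin n) (y : Subset n) → meet ⁅ i ⁆ y ≡ true → i ∈ y
meet⇒∈ zero    (true ∷ y)  p = here
meet⇒∈ zero    (false ∷ y) p = ⊥-elim (true≢false p (∅-meet y))
meet⇒∈ (suc i) (b ∷ y)     p = there (meet⇒∈ i y p)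

size-⁅⁆ : (i : Fin n) → ∣ ⁅ i ⁆ ∣ ≡ 1
size-⁅⁆ {suc n} zero    = cong suc (size-empty n)
size-⁅⁆ (suc i) = size-⁅⁆ i

singleton : (v : Subset n) → ∣ v ∣ ≡ 1 → ∃[ i ] v ≡ ⁅ i ⁆
singleton {suc n} (true ∷ v) s = zero , cong (true ∷_) (size-0 (suc-injective s) (size-empty n))
singleton (false ∷ v) s = let i , e = singleton v s in suc i , cong (false ∷_) e

disjoint⇒⊆∁ : (x y : Subset n) → meet x y ≡ false → y ⊆ ∁ x
disjoint⇒⊆∁ x y d {i} i∈y = x∉p⇒x∈∁p λ i∈x → true≢false (go x y i i∈x i∈y) d
  where
  go : ∀ {n} (x y : Subset n) (i : Fin n) → i ∈ x → i ∈ y → meet x y ≡ true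
  go (true ∷ x) (true ∷ y) zero    here      here      = refl
  go (a ∷ x)    (b ∷ y)    (suc i) (there p) (there q) = ∨-injʳ {a ∧ b} (go x y i p q)

⊆∁⇒disjoint : (x y : Subset n) → y ⊆ ∁ x → meet x y ≡ false
⊆∁⇒disjoint x y h = ¬true λ m → let i , p = meet⇒nonempty x y m in x∈∁p⇒x∉p (h (right x y p)) (left x y p)
  where
  left : ∀ {n} (x y : Subset n) {i} → i ∈ (x ∩ y) → i ∈ x
  left (true ∷ x) (true ∷ y) here      = here
  left (a ∷ x)    (b ∷ y)    (there p) = there (left x y p)
  right : ∀ {n} (x y : Subset n) {i} → i ∈ (x ∩ y) → i ∈ y
  right (true ∷ x) (true ∷ y) here      = here
  right (a ∷ x)    (b ∷ y)    (there p) = there (right x y p)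

-- Embeddings

lookup-image : (f : Fin m → Fin n) → Injective _≡_ _≡_ f → (p : Subset m) (i : Fin m) → lookup (image f p) (f i)
    ≡ lookup p i
lookup-image f inj p i = trans (lookup∘tabulate _ (f i)) (bool-cong to′ from′)
  where
  member? : Dec (∃[ x ] (x ∈ p × f x ≡ f i))
  member? = any? λ x → (x ∈? p) ×-dec (f x ≟ f i)
  to′ : does member? ≡ true → lookup p i ≡ true
  to′ h = let x , x∈p , e = does-true member? h in []=⇒lookup (subst (_∈ p) (inj e) x∈p)
  from′ : lookup p i ≡ true → does member? ≡ true
  from′ h = does-intro member? (i , lookup⇒[]= i p h , refl)

lookup-ext : {p q : Subset n} → (∀ i → lookup p i ≡ lookup q i) → p ≡ q
lookup-ext {p = p} {q} h = trans (sym (tabulate∘lookup p)) (trans (tabulate-cong h) (tabulate∘lookup q))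

image-injective : (f : Fin m → Fin n) → Injective _≡_ _≡_ f → {p q : Subset m} → image f p ≡ image f q → p ≡ q
image-injective f inj {p} {q} e = lookup-ext λ i →
  trans (sym (lookup-image f inj p i)) (trans (cong (λ a → lookup a (f i)) e) (lookup-image f inj q i))

image-id : (p : Subset n) → image id p ≡ p
image-id p = lookup-ext (lookup-image id id p)

⊆⇒⊆ₛ : {H G : Family n} → (∀ x → H x → G x) → H ⊆ₛ G
⊆⇒⊆ₛ {G = G} h = id , id , λ E p → subst G (sym (image-id E)) (h E p)

≅-from-⇔ : {H G : Family n} → (∀ x → H x → G x) → (∀ x → G x → H x) → H ≅ G
≅-from-⇔ f g = ⊆⇒⊆ₛ f , ⊆⇒⊆ₛ g

≅-refl : {H : Family n} → H ≅ H
≅-refl = ≅-from-⇔ (λ _ p → p) (λ _ p → p)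

♯-injection : (F G : Fam n) (φ : Subset n → Subset n) → (∀ {x y} → φ x ≡ φ y → x ≡ y) → (∀ x → F ∋ x → G ∋ φ x) →
    ♯ F ≤ ♯ G
♯-injection {n} F G φ inj h = go (♯ F) F G refl h
  where
  go : ∀ a (F G : Fam n) → a ≡ ♯ F → (∀ x → F ∋ x → G ∋ φ x) → a ≤ ♯ G
  go zero    F G e h = z≤n
  go (suc a) F G e h =
    let x , x∈ = ♯-member F (≤-trans (s≤s z≤n) (≤-reflexive e))
    in ≤-trans (s≤s (go a (F ∖ x) (G ∖ φ x) (suc-injective (trans e (♯-remove F x x∈)))
         λ y p → let y∈ , x≢y = ∖-member {F = F} {x} p in ∧-intro (h y y∈) (cong not (¬true λ q → x≢y (inj (==⇒≡ (φ x) (φ y) q))))))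
       (≤-reflexive (sym (♯-remove G (φ x) (h x x∈))))

-- The embeddings of K into G and of G into H compose to a map that is injective on subsets.
model-♯ : {H : Family n} (H? : Decidable H) {K : Family n} {F : Fam n} → (∀ x → F ∋ x → K x) →
          (G : Family n) → G ≅ K → H ≅ G → ♯ F ≤ ♯ ⟦ H? ⟧
model-♯ H? {F = F} i G (_ , f , finj , fK) (_ , g , ginj , gG) = ♯-injection F ⟦ H? ⟧ (image g ∘ image f)
  (image-injective f finj ∘ image-injective g ginj) λ x p → does-intro (H? _) (gG _ (fK x (i x p)))

missed-to : (φ : Sym n) (H : Fam n) (v : Subset n) → missed-by (H ∘ to φ) v ≡ missed-by H (to φ v)
missed-to φ H v = trans (♯-cong λ x → cong (λ b → H (to φ x) ∧ not b) (sym (meet-to φ v x)))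
  (♯-to φ (H ∩ᶠ λ x → not (meet (to φ v) x)))

missed-by-head : (F : Fam (suc n)) {v : Subset n} → ∣ v ∣ ≡ 0 → missed-by F (true ∷ v) ≡ ♯ (F ⁻)
missed-by-head F {v} z = trans (cong₂ _+_ (missed-by-none (F ⁻) {v} z) (♯-empty λ x → ∧-zeroʳ ((F ⁺) x)))
    (+-identityʳ _)

inJ-to : (φ : Sym n) (e j v x : Subset n) → inJ (to φ e) (to φ j) (to φ v) (to φ x) ≡ inJ e j v x
inJ-to φ e j v x = cong₂ _∨_ (cong₂ _∧_ (sub-to φ e x) (meet-to φ x j))
    (cong₂ _∨_ (sub-to φ j x) (cong₂ _∧_ (meet-to φ v x) (meet-to φ x e)))

jFam-to : ∀ k (φ : Sym n) (e j v x : Subset n) → jFam k (to φ e) (to φ j) (to φ v) (to φ x) ≡ jFam k e j v x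
jFam-to k φ e j v x = cong₂ _∧_ (cong (_≡ᵇ k) (size-to φ x)) (inJ-to φ e j v x)

gFam-to : ∀ k (φ : Sym n) (e v x : Subset n) → gFam k (to φ e) (to φ v) (to φ x) ≡ gFam k e v x
gFam-to k φ e v x = cong₂ _∧_ (cong (_≡ᵇ k) (size-to φ x)) (inG-to φ e v x)

jFam⇒familyJ : ∀ {k} (e j : Subset n) i x → jFam k e j ⁅ i ⁆ x ≡ true → familyJ k e j i x
jFam⇒familyJ {k = k} e j i x p with ∧-true {∣ x ∣ ≡ᵇ k} p
... | s , q with ∨-true {sub e x ∧ meet x j} q
...   | inj₁ a = let b , c = ∧-true {sub e x} a in inj₁ (≡ᵇ-true s , sub⇒⊆ e x b , meet⇒nonempty x j c)
...   | inj₂ q′ with ∨-true {sub j x} q′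
...     | inj₁ a = inj₂ (inj₁ (≡ᵇ-true s , sub⇒⊆ j x a))
...     | inj₂ a = let b , c = ∧-true {meet ⁅ i ⁆ x} a in inj₂ (inj₂ (≡ᵇ-true s , meet⇒∈ i x b , meet⇒nonempty x e c))

familyJ⇒jFam : ∀ {k} (e j : Subset n) i x → familyJ k e j i x → jFam k e j ⁅ i ⁆ x ≡ true
familyJ⇒jFam e j i x (inj₁ (s , a , b)) = ∧-intro (≡ᵇ-intro s) (∨-injˡ (∧-intro (⊆⇒sub e x a) (nonempty⇒meet x j b)))
familyJ⇒jFam e j i x (inj₂ (inj₁ (s , a))) = ∧-intro (≡ᵇ-intro s) (∨-injʳ {sub e x ∧ meet x j} (∨-injˡ (⊆⇒sub j x a)))
familyJ⇒jFam e j i x (inj₂ (inj₂ (s , a , b))) =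
  ∧-intro (≡ᵇ-intro s) (∨-injʳ {sub e x ∧ meet x j} (∨-injʳ {sub j x} (∧-intro (∈⇒meet i x a) (nonempty⇒meet x e b))))

gFam⇒familyG : ∀ {k} (e : Subset n) i x → gFam k e ⁅ i ⁆ x ≡ true → familyG k e i x
gFam⇒familyG {k = k} e i x p with ∧-true {∣ x ∣ ≡ᵇ k} p
... | s , q with ∨-true {sub e x} q
...   | inj₁ a = inj₁ (≡ᵇ-true s , sub⇒⊆ e x a)
...   | inj₂ a = let b , c = ∧-true {meet ⁅ i ⁆ x} a in inj₂ (≡ᵇ-true s , meet⇒∈ i x b , meet⇒nonempty x e c)

-- A relabelling puts x₀ first, which turns the given E and J into a `JModel`. With the upper bound
-- for H this yields equality.
extremal-J : ∀ {r t} {H : Family n} (H? : Decidable H) → n ≡ suc (suc (suc r) + suc t) → H ≅* 𝓙 (2 + r) 2 →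
             2 + bin (pred n) (suc r) ≤ ♯ ⟦ H? ⟧ + loss r t
extremal-J {suc n} {r} {t} {H} H? n≡ (G , (E , J , i , sE , J⊆ , sJ , i∈J , iso) , H≅G) =
  let φ , z , q , z0 = extract ⁅ i ⁆ (size-⁅⁆ i) in standard φ z q z0 (from φ E) (to-from φ E) (from φ J)
          (to-from φ J)
  where
  i∉E : i ∉ E
  i∉E = x∈∁p⇒x∉p (J⊆ i∈J)
  standard : ∀ φ z → to φ (true ∷ z) ≡ ⁅ i ⁆ → ∣ z ∣ ≡ 0 → ∀ e′ → to φ e′ ≡ E → ∀ j′ → to φ j′ ≡ J → 2 + bin n
      (suc r) ≤ ♯ ⟦ H? ⟧ + loss r t
  standard φ z q z0 (true ∷ e) e≡ j′ j≡ = ⊥-elim (i∉E (meet⇒∈ i E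
      (trans (cong₂ meet (sym q) (sym e≡)) (meet-to φ (true ∷ z) (true ∷ e)))))
  standard φ z q z0 (false ∷ e) e≡ (false ∷ j) j≡ = ⊥-elim (true≢false (∈⇒meet i J i∈J)
    (trans (cong₂ meet (sym q) (sym j≡)) (trans (meet-to φ (true ∷ z) (false ∷ j)) (meet-empty z j z0))))
  standard φ z q z0 (false ∷ e) e≡ (true ∷ j) j≡ = final (pair-exchange e j sj dj)
    where
    sj : ∣ j ∣ ≡ 2
    sj = suc-injective (trans (sym (size-to φ (true ∷ j))) (trans (cong ∣_∣ j≡) sJ))
    se : ∣ e ∣ ≡ suc r
    se = trans (sym (size-to φ (false ∷ e))) (trans (cong ∣_∣ e≡) sE)
    dj : meet e j ≡ false
    dj = trans (sym (meet-to φ (false ∷ e) (true ∷ j))) (trans (cong₂ meet e≡ j≡) (⊆∁⇒disjoint E J J⊆))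
    final : (∃[ c ] ∃[ d ] Σ[ X ∈ Exchange c d ] (Exchange.common X ≡ e × Exchange.left X ∪ Exchange.right X ≡ j)) →
        2 + bin n (suc r) ≤ ♯ ⟦ H? ⟧ + loss r t
    final (c , d , X , refl , refl) = ≤-trans M.lower (+-monoˡ-≤ (loss r t) (≤-trans (≤-reflexive (trans (♯-cong λ x →
        trans (sym (jFam-to (2 + r) φ (false ∷ e) (true ∷ j) (true ∷ z) x))
            (cong₂ (λ a b → jFam (2 + r) a b (to φ (true ∷ z)) (to φ x)) e≡ j≡))
        (♯-to φ (jFam (2 + r) E J (to φ (true ∷ z))))))
      (model-♯ H? {F = jFam (2 + r) E J (to φ (true ∷ z))}
          (λ x p → jFam⇒familyJ E J i x (subst (λ v → jFam (2 + r) E J v x ≡ true) q p)) G iso H≅G)))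
      where
      open Exchange X
      sc : ∣ c ∣ ≡ 2 + r
      sc = trans (cong ∣_∣ c≡) (trans (size-∪ common left disj-left)
          (trans (cong₂ _+_ se size-left) (+-comm (suc r) 1)))
      sd : ∣ d ∣ ≡ 2 + r
      sd = trans (cong ∣_∣ d≡) (trans (size-∪ common right disj-right)
          (trans (cong₂ _+_ se size-right) (+-comm (suc r) 1)))
      module M = JModel {r = r} {t} (suc-injective n≡) sc sd X {z} z0

extremal-G : ∀ {s t} {H : Family n} (H? : Decidable H) → n ≡ 5 + suc t → s ≡ 2 ⊎ s ≡ 3 → H ≅* 𝓖 4 s →
             2 + bin (pred n) 3 ≤ ♯ ⟦ H? ⟧ + loss 2 t
extremal-G {suc n} {s} {t} {H} H? n≡ ss (G , (E , i , sE , i∉E , iso) , H≅G) =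
  let φ , z , q , z0 = extract ⁅ i ⁆ (size-⁅⁆ i) in standard φ z q z0 (from φ E) (to-from φ E)
  where
  standard : ∀ φ z → to φ (true ∷ z) ≡ ⁅ i ⁆ → ∣ z ∣ ≡ 0 → ∀ e′ → to φ e′ ≡ E → 2 + bin n 3 ≤ ♯ ⟦ H? ⟧ + loss 2 t
  standard φ z q z0 (true ∷ e) e≡ = ⊥-elim (i∉E (meet⇒∈ i E
      (trans (cong₂ meet (sym q) (sym e≡)) (meet-to φ (true ∷ z) (true ∷ e)))))
  standard φ z q z0 (false ∷ e) e≡ = ≤-trans (gFam-lower {e = e} {z} (suc-injective n≡) z0
      (subst (λ a → a ≡ 2 ⊎ a ≡ 3) (sym se) ss))
      (+-monoˡ-≤ (loss 2 t) (≤-trans (≤-reflexive (trans (♯-cong λ x →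
        trans (sym (gFam-to 4 φ (false ∷ e) (true ∷ z) x)) (cong (λ a → gFam 4 a (to φ (true ∷ z)) (to φ x)) e≡))
        (♯-to φ (gFam 4 E (to φ (true ∷ z))))))
      (model-♯ H? {F = gFam 4 E (to φ (true ∷ z))} (λ x p → gFam⇒familyG E i x
          (subst (λ v → gFam 4 E v x ≡ true) q p)) G iso H≅G)))
    where
    se : ∣ e ∣ ≡ s
    se = trans (sym (size-to φ (false ∷ e))) (trans (cong ∣_∣ e≡) sE)

-- Assembling the bound and the cases of equality

module Main (r : ℕ) {t} (1≤r : 1 ≤ r) (r<t : r < t) where

  N k : ℕ
  N = suc (suc (suc (suc (r + t))))
  k = suc (suc r)

  n≡ : suc (suc (suc (r + t))) ≡ 2 + r + suc t
  n≡ = cong (2 +_) (sym (+-suc r t))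

  module _ {H : Family N} (H? : Decidable H) (uniform : Uniform k H) (intersecting : Intersecting H)
           (no-star : ¬ (H ⊆ₛ* 𝓕₀ k)) (no-HM : ¬ (H ⊆ₛ* 𝓕₁ k)) (no-𝓖₂ : k ≡ 3 → ¬ (H ⊆ₛ* 𝓖 k 2)) where

    B : Fam N
    B = ⟦ H? ⟧

    member : ∀ {x} → B ∋ x → H x
    member {x} = does-true (H? x)

    member′ : ∀ {x} → H x → B ∋ x
    member′ {x} = does-intro (H? x)

    u : Unif k B
    u x p = uniform x (member p)

    c : Cross B B
    c x y p q = nonempty⇒meet x y (intersecting x y (member p) (member q))

    Tight : Set
    Tight = 2 + bin (suc (suc (suc (r + t)))) (suc r) ≤ ♯ B + loss r t

    Extremal : Set₁
    Extremal = H ≅* 𝓙 k 2 ⊎ (k ≡ 4 × (H ≅* 𝓖 k 2 ⊎ H ≅* 𝓖 k 3))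

    Conclusion : Set₁
    Conclusion = Within r t B × (Tight → Extremal)

    -- i is a point missed by at most two members, and φ makes it the first point, so that the
    -- exceptional members form the trace `B′ ⁻`.
    module Few (φ : Sym N) (z : Subset (suc (suc (suc (r + t))))) (z0 : ∣ z ∣ ≡ 0) (i : Fin N)
        (v≡ : to φ (true ∷ z) ≡ ⁅ i ⁆)
               (few : ♯ ((B ∘ to φ) ⁻) ≤ 2) where

      B′ : Fam N
      B′ = B ∘ to φ

      u′ : Unif k B′
      u′ = unif-to φ u

      c′ : Cross B′ B′
      c′ = cross-to φ {B} {B} c

      back : ∀ {x} → H x → B′ ∋ from φ x
      back {x} p = subst (B ∋_) (sym (to-from φ x)) (member′ p)

      head-true : ∀ y → i ∈ to φ (true ∷ y)
      head-true y = meet⇒∈ i _ (trans (cong (λ v → meet v (to φ (true ∷ y))) (sym v≡))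
          (meet-to φ (true ∷ z) (true ∷ y)))

      head-false : ∀ y → i ∉ to φ (false ∷ y)
      head-false y p = true≢false (∈⇒meet i _ p) (trans (cong (λ v → meet v (to φ (false ∷ y))) (sym v≡))
        (trans (meet-to φ (true ∷ z) (false ∷ y)) (meet-empty z y z0)))

      none : ♯ (B′ ⁻) ≡ 0 → Conclusion
      none e = ⊥-elim (no-star (star k i , (i , ≅-refl) , ⊆⇒⊆ₛ λ x p → uniform x p , in-star x p))
        where
        in-star : ∀ x → H x → i ∈ x
        in-star x p with from φ x in eq | back p
        ... | true ∷ y  | q = subst (i ∈_) (trans (cong (to φ) (sym eq)) (to-from φ x)) (head-true y)
        ... | false ∷ y | q = contradiction (≤-trans (♯-pos {F = B′ ⁻} {y} q) (≤-reflexive e)) λ ()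

      one : ♯ (B′ ⁻) ≡ 1 → Conclusion
      one e = let y , y∈ = ♯-member (B′ ⁻) (≤-reflexive (sym e)) in go y y∈
        where
        go : ∀ y → B′ ∋ false ∷ y → Conclusion
        go y y∈ = ⊥-elim (no-HM (hiltonMilner k F i , (F , i , uniform F (member y∈) , head-false y , ≅-refl) , ⊆⇒⊆ₛ
            in-HM))
          where
          F : Subset N
          F = to φ (false ∷ y)
          in-HM : ∀ x → H x → hiltonMilner k F i x
          in-HM x p with from φ x in eq | back p
          ... | true ∷ w  | q = inj₂ (uniform x p , subst (i ∈_) (trans (cong (to φ) (sym eq)) (to-from φ x))
              (head-true w) , intersecting x F p (member y∈))
          ... | false ∷ w | q with w == y in same
          ...   | true  = inj₁ (trans (sym (to-from φ x)) (cong (to φ) (trans eq (cong (false ∷_) (==⇒≡ w y same)))))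
          ...   | false = contradiction (≤-trans (♯-≥2 (B′ ⁻) {w} {y} q y∈ λ { refl → true≢false (==-refl w) same })
              (≤-reflexive e)) λ { (s≤s ()) }

      two : 2 ≤ ♯ (B′ ⁻) → Conclusion
      two l = let a , b , a∈ , b∈ , a≢b = ♯-two (B′ ⁻) l in go a b a∈ b∈ a≢b
        where
        go : ∀ a b → B′ ∋ false ∷ a → B′ ∋ false ∷ b → a ≢ b → Conclusion
        go a b a∈ b∈ a≢b = subst (λ s → s + loss r t ≤ 2 + bin (suc (suc (suc (r + t)))) (suc r)) (♯-to φ B)
            (few-missing {r = r} {t} {B′} {a} {b} n≡ (unif⁺ u′) a≢b (u′ _ a∈) (u′ _ b∈) ha hb few) , tight
          where
          ha : Hits a (B′ ⁺)
          ha x p = c′ (true ∷ x) (false ∷ a) p a∈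
          hb : Hits b (B′ ⁺)
          hb x p = c′ (true ∷ x) (false ∷ b) p b∈
          only : ∀ x → B′ ∋ false ∷ x → x ≡ a ⊎ x ≡ b
          only x x∈ with x == a in p | x == b in q
          ... | true  | _     = inj₁ (==⇒≡ x a p)
          ... | false | true  = inj₂ (==⇒≡ x b q)
          ... | false | false = contradiction (≤-trans (s≤s (♯-≥2 (B′ ⁻ ∖ x) {a} {b} (∧-intro a∈ (cong not p))
              (∧-intro b∈ (cong not q)) a≢b))
                                  (≤-trans (≤-reflexive (sym (♯-remove (B′ ⁻) x x∈))) few)) λ { (s≤s (s≤s ())) }
          tight : Tight → Extremal
          tight h = inj₁ (familyJ k E J i , (E , J , i , trans (size-to φ (false ∷ common)) M.size-common ,
              disjoint⇒⊆∁ E J (trans (meet-to φ (false ∷ common) (true ∷ M.j)) M.disj-j) ,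
              trans (size-to φ (true ∷ M.j)) (cong suc M.size-j) , head-true M.j , ≅-refl) ,
              ≅-from-⇔ (λ x p → jFam⇒familyJ E J i x (subst (λ w → jFam k E J ⁅ i ⁆ w ≡ true) (to-from φ x)
                  (transport (from φ x) (inside (from φ x) (back p)))))
                       (λ x p → member (subst (B ∋_) (to-from φ x) (♯-equal {F = B′} {M.𝓙ᶠ} inside size (from φ x)
                          (transport′ (from φ x) (subst (λ w → jFam k E J ⁅ i ⁆ w ≡ true) (sym (to-from φ x))
                              (familyJ⇒jFam E J i x p)))))))
            where
            h′ : 2 + bin (suc (suc (suc (r + t)))) (suc r) ≤ ♯ B′ + loss r t
            h′ = subst (λ s → 2 + bin (suc (suc (suc (r + t)))) (suc r) ≤ s + loss r t) (sym (♯-to φ B)) h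
            X : Exchange a b
            X = few-missing-tight {r = r} {t} {B′} n≡ r<t (unif⁺ u′) a≢b (u′ _ a∈) (u′ _ b∈) ha hb few h′
            open Exchange X
            module M = JModel {r = r} {t} n≡ (u′ _ a∈) (u′ _ b∈) X {z} z0
            E J : Subset N
            E = to φ (false ∷ common)
            J = to φ (true ∷ M.j)
            inside : ∀ x → B′ ∋ x → M.𝓙ᶠ ∋ x
            inside (true ∷ x)  p = M.into x (ha x p) (hb x p) (suc-injective (u′ _ p))
            inside (false ∷ x) p with only x p
            ... | inj₁ refl = M.into-c
            ... | inj₂ refl = M.into-d
            size : ♯ M.𝓙ᶠ ≤ ♯ B′
            size = +-cancelʳ-≤ (loss r t) _ _ (≤-trans M.upper h′)
            transport : ∀ x → M.𝓙ᶠ ∋ x → jFam k E J ⁅ i ⁆ (to φ x) ≡ true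
            transport x p = subst (λ v → jFam k E J v (to φ x) ≡ true) v≡
                (trans (jFam-to k φ (false ∷ common) (true ∷ M.j) (true ∷ z) x) p)
            transport′ : ∀ x → jFam k E J ⁅ i ⁆ (to φ x) ≡ true → M.𝓙ᶠ ∋ x
            transport′ x p = trans (sym (jFam-to k φ (false ∷ common) (true ∷ M.j) (true ∷ z) x))
                (subst (λ v → jFam k E J v (to φ x) ≡ true) (sym v≡) p)

      result : Conclusion
      result = go (♯ (B′ ⁻)) refl
        where
        go : ∀ s → s ≡ ♯ (B′ ⁻) → Conclusion
        go zero          e = none (sym e)
        go (suc zero)    e = one (sym e)
        go (suc (suc s)) e = two (≤-trans (s≤s (s≤s z≤n)) (≤-reflexive e))

    exceptional : Exc r B → Conclusion
    exceptional (exc e v sv d se inside) with singleton v sv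
    ... | i , refl = go r refl 1≤r se
      where
      i∉e : i ∉ e
      i∉e p = true≢false (∈⇒meet i e p) d
      in-G : ∀ {j} → k ≡ j → ∀ x → H x → familyG j e i x
      in-G refl x p = gFam⇒familyG e i x (∧-intro (≡ᵇ-intro (uniform x p)) (inside x (member′ p)))
      go : ∀ j → j ≡ r → 1 ≤ j → (∣ e ∣ ≡ 2 × j ≤ 2) ⊎ (∣ e ∣ ≡ 3 × j ≡ 2) → Conclusion
      go (suc zero) refl _ (inj₁ (s , _)) = ⊥-elim (no-𝓖₂ refl (familyG 3 e i , (e , i , s , i∉e , ≅-refl) , ⊆⇒⊆ₛ
          (in-G refl)))
      go (suc zero) refl _ (inj₂ (_ , ()))
      -- For k = 4 the surrounding family of type 𝓖₂ or 𝓖₃ is itself no larger than the bound, so a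
      -- tight H fills it completely.
      go (suc (suc zero)) refl _ s = count-G {F = B} {e} {⁅ i ⁆} n≡ sv d size u inside , λ h → inj₂
          (refl , tight s (iso h))
        where
        size : ∣ e ∣ ≡ 2 ⊎ ∣ e ∣ ≡ 3
        size = [ (λ { (a , _) → inj₁ a }) , (λ { (a , _) → inj₂ a }) ]′ s
        iso : Tight → H ≅ familyG 4 e i
        iso h = ≅-from-⇔ (in-G refl) λ x p → member (♯-equal {F = B} {gFam 4 e ⁅ i ⁆}
          (λ y q → ∧-intro (≡ᵇ-intro (u y q)) (inside y q))
          (+-cancelʳ-≤ (loss 2 t) _ _ (≤-trans (count-G {F = gFam 4 e ⁅ i ⁆} {e} {⁅ i ⁆} n≡ sv d size
            (λ y q → ≡ᵇ-true {∣ y ∣} (proj₁ (∧-true q))) (λ y q → proj₂ (∧-true {∣ y ∣ ≡ᵇ 4} q))) h)) x (to-Bool x p))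
          where
          to-Bool : ∀ x → familyG 4 e i x → gFam 4 e ⁅ i ⁆ x ≡ true
          to-Bool x (inj₁ (a , b)) = ∧-intro (≡ᵇ-intro a) (∨-injˡ (⊆⇒sub e x b))
          to-Bool x (inj₂ (a , b , f)) = ∧-intro (≡ᵇ-intro a)
              (∨-injʳ {sub e x} (∧-intro (∈⇒meet i x b) (nonempty⇒meet x e f)))
        tight : (∣ e ∣ ≡ 2 × 2 ≤ 2) ⊎ (∣ e ∣ ≡ 3 × 2 ≡ 2) → H ≅ familyG 4 e i → H ≅* 𝓖 4 2 ⊎ H ≅* 𝓖 4 3
        tight (inj₁ (a , _)) w = inj₁ (familyG 4 e i , (e , i , a , i∉e , ≅-refl) , w)
        tight (inj₂ (a , _)) w = inj₂ (familyG 4 e i , (e , i , a , i∉e , ≅-refl) , w)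
      go (suc (suc (suc j))) refl _ (inj₁ (_ , s≤s (s≤s ())))
      go (suc (suc (suc j))) refl _ (inj₂ (_ , ()))

    conclusion : Conclusion
    conclusion with codegree? 2 B
    ... | inj₁ g with codegree-three r B 1≤r refl r<t u c g
    ...   | inj₁ s = <⇒≤ s , λ h → contradiction (≤-trans s h) 1+n≰n
    ...   | inj₂ w = exceptional w
    conclusion | inj₂ (v , sv , few) with singleton v sv
    ... | i , refl = let φ , z , q , z0 = extract ⁅ i ⁆ sv in Few.result φ z z0 i q
      (≤-trans (≤-reflexive (trans (sym (missed-by-head (B ∘ to φ) {z} z0))
          (trans (missed-to φ B (true ∷ z)) (cong (missed-by B) q)))) few)

    -- The truncated subtractions of `bound` are undone once, so that everything else can be argued
    -- additively.
    bound-loss : bound N k + loss r t ≡ 2 + bin (suc (suc (suc (r + t)))) (suc r)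
    bound-loss = begin
      bound N k + loss r t                                          ≡⟨ cong (_+ loss r t) unfold ⟩
      (b₁ ∸ b₂ ∸ b₃ + 2) + (b₂ + b₃)                                ≡⟨ cong (λ a → a + 2 + (b₂ + b₃))
          (∸-+-assoc b₁ b₂ b₃) ⟩
      (b₁ ∸ (b₂ + b₃) + 2) + (b₂ + b₃)                              ≡⟨ trans
          (cong (_+ (b₂ + b₃)) (+-comm (b₁ ∸ (b₂ + b₃)) 2)) (+-assoc 2 (b₁ ∸ (b₂ + b₃)) _) ⟩
      2 + (b₁ ∸ (b₂ + b₃) + (b₂ + b₃))                              ≡⟨ cong (2 +_) (m∸n+n≡m le) ⟩
      2 + b₁                                                        ∎
      where
      open ≡-Reasoning
      b₁ b₂ b₃ : ℕ
      b₁ = bin (suc (suc (suc (r + t)))) (suc r)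
      b₂ = bin (suc t) (suc r)
      b₃ = bin t r
      r+t∸r : suc (suc (r + t)) ∸ r ≡ 2 + t
      r+t∸r = trans (cong (_∸ r) (trans (cong suc (sym (+-suc r t))) (sym (+-suc r (suc t))))) (m+n∸m≡n r (2 + t))
      unfold : bound N k ≡ b₁ ∸ b₂ ∸ b₃ + 2
      unfold = cong (_+ 2) (cong₂ _∸_ (cong₂ _∸_ (sym (bin≡C _ (suc r)))
          (trans (cong (λ a → (a ∸ 1) choose suc r) r+t∸r) (sym (bin≡C (suc t) (suc r)))))
        (trans (cong (λ a → (a ∸ 2) choose r) r+t∸r) (sym (bin≡C t r))))
      le : b₂ + b₃ ≤ b₁
      le = ≤-trans (+-monoʳ-≤ b₂ (≤-trans (bin-mono r (n≤1+n t)) ≤-refl))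
          (≤-trans (≤-reflexive (+-comm b₂ (bin (suc t) r)))
              (bin-mono {suc (suc t)} (suc r) (s≤s (s≤s (≤-trans (m≤n+m t r) (n≤1+n (r + t)))))))

    card≤ : card H? ≤ bound N k
    card≤ = +-cancelʳ-≤ (loss r t) _ _ (subst₂ _≤_ (cong (_+ loss r t) (sym (card≡♯ H?))) (sym bound-loss)
        (proj₁ conclusion))

    tight⇒card : Tight → card H? ≡ bound N k
    tight⇒card h = ≤-antisym card≤ (+-cancelʳ-≤ (loss r t) _ _
        (subst₂ _≤_ (sym bound-loss) (cong (_+ loss r t) (sym (card≡♯ H?))) h))

    card⇒extremal : card H? ≡ bound N k → Extremal
    card⇒extremal e = proj₂ conclusion (≤-reflexive (trans (sym bound-loss)
        (cong (_+ loss r t) (trans (sym e) (card≡♯ H?)))))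

    𝓙-tight : H ≅* 𝓙 k 2 → Tight
    𝓙-tight = extremal-J H? (cong suc n≡)

    𝓖-tight : ∀ {s} → s ≡ 2 ⊎ s ≡ 3 → k ≡ 4 → H ≅* 𝓖 k s → Tight
    𝓖-tight s refl = extremal-G H? (cong suc n≡) s

    result : card H? ≤ bound N k
      × (k ≡ 4 → card H? ≡ bound N k ⇔ (H ≅* 𝓙 k 2 ⊎ H ≅* 𝓖 k 2 ⊎ H ≅* 𝓖 k 3))
      × (k ≢ 4 → card H? ≡ bound N k ⇔ H ≅* 𝓙 k 2)
    result = card≤ , four , other
      where
      four : k ≡ 4 → card H? ≡ bound N k ⇔ (H ≅* 𝓙 k 2 ⊎ H ≅* 𝓖 k 2 ⊎ H ≅* 𝓖 k 3)
      four k≡4 = mk⇔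
        (λ e → [ inj₁ , (λ w → inj₂ (proj₂ w)) ]′ (card⇒extremal e))
        (λ w → tight⇒card ([ 𝓙-tight , [ 𝓖-tight (inj₁ refl) k≡4 , 𝓖-tight (inj₂ refl) k≡4 ]′ ]′ w))
      other : k ≢ 4 → card H? ≡ bound N k ⇔ H ≅* 𝓙 k 2
      other k≢4 = mk⇔ (λ e → [ id , (λ w → contradiction (proj₁ w) k≢4) ]′ (card⇒extremal e))
          (λ w → tight⇒card (𝓙-tight w))

-- With k = r + 2 and t = n - k - 2, the assumption n > 2k reads r < t.
offset : ∀ r n → 2 * suc (suc r) < n → ∃[ t ] (n ≡ 4 + r + t × r < t)
offset r n 2k<n = n ∸ (4 + r) , n≡ , +-cancelˡ-≤ (4 + r) _ _ (≤-trans k+1 (≤-reflexive n≡))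
  where
  k+1 : 4 + r + suc r ≤ n
  k+1 = ≤-trans (≤-reflexive (cong (3 +_) (trans (sym (+-suc r (suc r)))
      (cong (λ a → r + suc (suc a)) (sym (+-identityʳ r)))))) 2k<n
  n≡ : n ≡ 4 + r + (n ∸ (4 + r))
  n≡ = sym (m+[n∸m]≡n (≤-trans (m≤m+n (4 + r) (suc r)) k+1))

theorem1p6 : ∀ (k n : ℕ) → 3 ≤ k → 2 * k < n →
    (H : Family n) (H? : Decidable H) →
    Uniform k H → Intersecting H →
    ¬ (H ⊆ₛ* 𝓕₀ k) →
    ¬ (H ⊆ₛ* 𝓕₁ k) →
    (k ≡ 3 → ¬ (H ⊆ₛ* 𝓖 k 2)) →
    card H? ≤ bound n k
    × (k ≡ 4 → card H? ≡ bound n k ⇔ (H ≅* 𝓙 k 2 ⊎ H ≅* 𝓖 k 2 ⊎ H ≅* 𝓖 k 3))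
    × (k ≢ 4 → card H? ≡ bound n k ⇔ H ≅* 𝓙 k 2)
theorem1p6 (suc (suc r)) n (s≤s (s≤s 1≤r)) 2k<n H H? with offset r n 2k<n
... | t , refl , r<t = Main.result r 1≤r r<t H?
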